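{- Let $n,k,t$ be positive integers with $k\ge t+1$ and $n\ge 4k+6$. Let $\mathcal F,\mathcal G\subseteq \genfrac{[}{]}{0pt}{}{V}{k}$ be cross $t$-intersecting families such that $\dim\big(\bigcap_{F\in\mathcal F}F\big)<t$ and $\dim\big(\bigcap_{G\in\mathcal G}G\big)<t$, and such that $|\mathcal F||\mathcal G|$ is maximum among all pairs of cross $t$-intersecting families $\mathcal F',\mathcal G'\subseteq\genfrac{[}{]}{0pt}{}{V}{k}$ satisfying $\dim\big(\bigcap_{F\in\mathcal F'}F\big)<t$ and $\dim\big(\bigcap_{G\in\mathcal G'}G\big)<t$. Then: (i) If $k>2t+1$, then $\mathcal F=\mathcal H_1(L,M,T)$ and $\mathcal G=\mathcal H_1(M,L,T)$ for some $M,L\in\genfrac{[}{]}{0pt}{}{V}{k+1}$ with $\dim(M\cap L)\ge t+2$ and some $T\in\genfrac{[}{]}{0pt}{}{M\cap L}{t}$. (ii) If $k\le 2t+1$, then either $\mathcal F=\mathcal G=\mathcal H_2(Z)$ for some $Z\in\genfrac{[}{]}{0pt}{}{V}{t+2}$, or $(k,t)=(3,1)$ and $\mathcal F=\mathcal H_1(L,M,T)$, $\mathcal G=\mathcal H_1(M,L,T)$ for some $M,L\in\genfrac{[}{]}{0pt}{}{V}{4}$ with $\dim(M\cap L)\ge 3$ and some $T\in\genfrac{[}{]}{0pt}{}{M\cap L}{1}$.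
   Context: Let $q$ be a prime power and $V$ an $n$-dimensional vector space over the finite field $\mathbb F_q$. For a subspace $W$ of $V$ and an integer $j$, $\genfrac{[}{]}{0pt}{}{W}{j}$ denotes the set of all $j$-dimensional subspaces of $W$. Two families $\mathcal F,\mathcal G\subseteq\genfrac{[}{]}{0pt}{}{V}{k}$ are cross $t$-intersecting if $\dim(F\cap G)\ge t$ for all $F\in\mathcal F$, $G\in\mathcal G$. For $M,L\in\genfrac{[}{]}{0pt}{}{V}{k+1}$ with $\dim(M\cap L)\ge t$ and $T\in\genfrac{[}{]}{0pt}{}{M\cap L}{t}$, define $\mathcal H_1(L,M,T)=\{F\in\genfrac{[}{]}{0pt}{}{V}{k}: T\subseteq F,\ \dim(F\cap L)\ge t+1\}\cup\{F\in\genfrac{[}{]}{0pt}{}{M}{k}: T\not\subseteq F\}$. For $Z\in\genfrac{[}{]}{0pt}{}{V}{t+2}$, define $\mathcal H_2(Z)=\{F\in\genfrac{[}{]}{0pt}{}{V}{k}: \dim(F\cap Z)\ge t+1\}$. -}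

module Defs where

open import Data.Nat using (ℕ; zero; suc; _+_)
open import Data.Fin using (Fin)
open import Data.Bool using (Bool; true; false; _∧_)
open import Data.Product using (Σ; _×_; ∃)
open import Data.Sum using (_⊎_)
open import Data.List using (List; length)
import Data.List as L
open import Data.List.Relation.Unary.All using (All)
open import Data.List.Relation.Unary.Any using (Any)
open import Data.List.Relation.Unary.AllPairs using (AllPairs)
open import Data.Vec using (Vec; []; _∷_; replicate; zipWith; map)
import Data.Vec.Relation.Unary.All as VAll
open import Relation.Binary.PropositionalEquality using (_≡_; _≢_)
open import Relation.Nullary using (¬_)
open import Algebra.Structures using (IsCommutativeRing)

-- A finite field with q elements.  Its carrier is Fin q (every finite
-- field of order q is isomorphic to one of this shape), equality is ≡.
-- (q is then automatically a prime power.)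

record FiniteField (q : ℕ) : Set where
  field
    _+F_ _*F_ : Fin q → Fin q → Fin q
    -F_       : Fin q → Fin q
    0F 1F     : Fin q
    isCommutativeRing : IsCommutativeRing _≡_ _+F_ _*F_ -F_ 0F 1F
    0≢1       : 0F ≢ 1F
    inverse   : ∀ x → x ≢ 0F → ∃ λ y → x *F y ≡ 1F

module Geometry {q : ℕ} (𝔽 : FiniteField q) (n : ℕ) where
  open FiniteField 𝔽

  K : Set
  K = Fin q

  V : Set
  V = Vec K n

  0V : V
  0V = replicate n 0F

  _⊕_ : V → V → V
  _⊕_ = zipWith _+F_

  _·_ : K → V → V
  c · v = map (c *F_) v

  lincomb : ∀ {d} → Vec K d → Vec V d → V
  lincomb []       []       = 0V
  lincomb (c ∷ cs) (b ∷ bs) = (c · b) ⊕ lincomb cs bs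

  LinIndep : ∀ {d} → Vec V d → Set
  LinIndep {d} bs = ∀ cs → lincomb cs bs ≡ 0V → cs ≡ replicate d 0F

  VSet : Set
  VSet = V → Bool

  _∩_ : VSet → VSet → VSet
  (A ∩ B) v = A v ∧ B v

  _⊆_ : VSet → VSet → Set
  A ⊆ B = ∀ v → A v ≡ true → B v ≡ true

  DimGE : VSet → ℕ → Set
  DimGE S d = Σ (Vec V d) λ bs → VAll.All (λ b → S b ≡ true) bs × LinIndep bs

  HasDim : VSet → ℕ → Set
  HasDim S d = DimGE S d × ¬ DimGE S (suc d)

  DimLT : VSet → ℕ → Set
  DimLT S d = ¬ DimGE S d

  record Subspace : Set where
    field
      mem    : VSet
      zero∈  : mem 0V ≡ true
      plus∈  : ∀ u v → mem u ≡ true → mem v ≡ true → mem (u ⊕ v) ≡ true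
      scale∈ : ∀ c v → mem v ≡ true → mem (c · v) ≡ true
  open Subspace public

  _≐_ : Subspace → Subspace → Set
  A ≐ B = ∀ v → mem A v ≡ mem B v

  record Family (k : ℕ) : Set where
    field
      members  : List Subspace
      allDim   : All (λ W → HasDim (mem W) k) members
      distinct : AllPairs (λ A B → ¬ (A ≐ B)) members
  open Family public

  ∣_∣ : ∀ {k} → Family k → ℕ
  ∣ 𝓕 ∣ = length (members 𝓕)

  _∈_ : ∀ {k} → Subspace → Family k → Set
  W ∈ 𝓕 = Any (λ F → W ≐ F) (members 𝓕)

  -- ⋂_{F ∈ 𝓕} F  (equals V for the empty family)
  ⋂ : ∀ {k} → Family k → VSet
  ⋂ 𝓕 v = L.foldr (λ F b → mem F v ∧ b) true (members 𝓕)

  CrossIntersecting : ∀ {k} → ℕ → Family k → Family k → Set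
  CrossIntersecting t 𝓕 𝓖 =
    ∀ F G → F ∈ 𝓕 → G ∈ 𝓖 → DimGE (mem F ∩ mem G) t

  _≈fam_ : ∀ {k} → Family k → (Subspace → Set) → Set
  _≈fam_ {k} 𝓕 P = ∀ W → HasDim (mem W) k → (W ∈ 𝓕 → P W) × (P W → W ∈ 𝓕)

  H₁ : ℕ → Subspace → Subspace → Subspace → Subspace → Set
  H₁ t L M T F =
      (mem T ⊆ mem F × DimGE (mem F ∩ mem L) (suc t))
    ⊎ (mem F ⊆ mem M × ¬ (mem T ⊆ mem F))

  H₂ : ℕ → Subspace → Subspace → Set
  H₂ t Z F = DimGE (mem F ∩ mem Z) (suc t)

  Admissible : ∀ {k} → ℕ → Family k → Family k → Set
  Admissible t 𝓕 𝓖 =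
    CrossIntersecting t 𝓕 𝓖 × DimLT (⋂ 𝓕) t × DimLT (⋂ 𝓖) t

  H₁Pair : ∀ {k} → ℕ → ℕ → Family k → Family k → Set
  H₁Pair {k} t m 𝓕 𝓖 =
    Σ Subspace λ M → Σ Subspace λ L → Σ Subspace λ T →
      HasDim (mem M) m × HasDim (mem L) m ×
      DimGE (mem M ∩ mem L) (t + 2) ×
      mem T ⊆ (mem M ∩ mem L) × HasDim (mem T) t ×
      (𝓕 ≈fam H₁ t L M T) × (𝓖 ≈fam H₁ t M L T)

{-# OPTIONS --safe #-}
module Submission where

-- Call S a cover of a family if it meets every member in dimension at least t.  By maximality each of
-- 𝓕, 𝓖 consists of all k-spaces covering the other, and neither family has a cover of dimension t.
-- Double counting pairs (member, vector) bounds both sizes in terms of the smallest covers of the two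
-- families; since n ≥ 4k + 6, the product falls below |H₂|² unless both have covers of dimension t + 1.
-- Let 𝓢 and 𝓣 be the lists of (t+1)-dimensional covers of 𝓖 and of 𝓕.  Up to lower order terms |𝓕||𝓖|
-- is |𝓢||𝓣| times the square of the number of k-spaces through a (t+1)-space.  By maximality 𝓢 and 𝓣
-- are cross t-intersecting, which forces |𝓢||𝓣| < max([k−t+1], [t+2])² unless all their members
-- contain a common t-space, which leads to H₁, or lie in a common (t+2)-space, which leads to H₂.
-- To leading order H₁ and H₂ tie exactly for k = 2t + 1; there the next term favours H₂ unless t = 1.

open import Defs
open import Algebra.Bundles using (Ring; AbelianGroup)
import Algebra.Properties.AbelianGroup as AbelianGroupProperties
import Algebra.Properties.Ring as RingProperties
open import Algebra.Structures using (IsCommutativeRing)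
open import Data.Bool using (Bool; true; false; _∧_)
import Data.Bool.Properties as Bool
open import Data.Fin.Base as Fin using (Fin)
import Data.Fin.Properties as Fin
open import Data.List.Base using (List; []; _∷_; length; filter; foldr; deduplicate; allFin; cartesianProductWith) renaming (map to mapL)
open import Data.List.Membership.Propositional using (lose) renaming (_∈_ to _∈ₗ_; find to find∈)
open import Data.List.Membership.Propositional.Properties using (∈-allFin; ∈-cartesianProductWith⁺; ∈-map⁺; ∈-filter⁺; ∈-filter⁻)
open import Data.List.Properties using (length-tabulate; length-++; length-map)
open import Data.List.Relation.Unary.All as All using (All; []; _∷_)
import Data.List.Relation.Unary.All.Properties as AllP
open import Data.List.Relation.Unary.AllPairs using (AllPairs; []; _∷_)
import Data.List.Relation.Unary.AllPairs.Properties as AllPairsP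
open import Data.List.Relation.Unary.Any as Any using (Any; here; there)
import Data.List.Relation.Unary.Any.Properties as AnyP
open import Data.List.Relation.Unary.Unique.Propositional using (Unique)
open import Data.List.Relation.Unary.Unique.Propositional.Properties using (allFin⁺; cartesianProductWith⁺)
open import Data.Nat hiding (_⊓_; _⊔_)
open import Data.Nat.DivMod using (m*n/n≡m; /-monoˡ-≤; m/n≤m)
open import Data.Nat.Properties
open import Data.Nat.Tactic.RingSolver using (solve-∀)
open import Data.Product using (Σ; ∃; ∃₂; _×_; _,_; proj₁; proj₂)
open import Data.Sum using (_⊎_; inj₁; inj₂)
open import Data.Vec.Base using (Vec; []; _∷_; replicate; zipWith; map)
open import Data.Vec.Properties as Vec using (∷-injective; zipWith-assoc; zipWith-comm; zipWith-identityˡ; map-cong; map-id; map-∘)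
import Data.Vec.Relation.Unary.All as VAll
open import Relation.Binary.PropositionalEquality using (_≡_; _≢_; refl; sym; trans; cong; cong₂; subst; module ≡-Reasoning; isEquivalence)
open import Relation.Nullary using (¬_; Dec; yes; no; does; contradiction)
open import Relation.Nullary.Decidable using (_×-dec_; _⊎-dec_; _→-dec_; ¬?; map′; dec-true; decidable-stable)
open import Relation.Unary using (Decidable)

-- Write [m] for (q^m - 1)/(q - 1). If S is no cover of 𝓖, some G in 𝓖 meets S in dimension below t,
-- so every member of 𝓕 through S contains a vector of G outside S. Counting such pairs passes from
-- S to spaces of one dimension more at the price of a factor at most [k-t+1]; quotient spaces are
-- avoided. The extra dimension divides the number of k-spaces through the space by at least
-- q^(n-k), which is at least q^(3k+6). The tightest estimate concerns the members of 𝓕 that contain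
-- no cover of dimension t + 1. There are at most [t+1][k-t+1]² times as many as k-spaces through a
-- (t+2)-space. The comparison of leading terms multiplies this error by q^(k+t+3), and the
-- exponents then add up to exactly 3k + 6; hence n ≥ 4k + 6. A common t-space T of the covers
-- yields (k+1)-spaces L and M, but M ∩ L may have dimension below t + 2, too small for H₁. Such a
-- pair is beaten by H₁(L,L,T) taken twice, or by H₁(M,M,T), whichever has more members through T.

ι : {P : Set} → Dec P → ℕ
ι (yes _) = 1
ι (no _)  = 0

ι-yes : {P : Set} → (P? : Dec P) → P → ι P? ≡ 1
ι-yes (yes _) p = refl
ι-yes (no ¬p) p = contradiction p ¬p

ι-no : {P : Set} → (P? : Dec P) → ¬ P → ι P? ≡ 0
ι-no (yes p) ¬p = contradiction p ¬p
ι-no (no _)  ¬p = refl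

ι≤1 : {P : Set} → (P? : Dec P) → ι P? ≤ 1
ι≤1 (yes _) = s≤s z≤n
ι≤1 (no _)  = z≤n

ι-mono : {P Q : Set} → (P? : Dec P) (Q? : Dec Q) → (P → Q) → ι P? ≤ ι Q?
ι-mono (yes p) Q? f = ≤-reflexive (sym (ι-yes Q? (f p)))
ι-mono (no _)  Q? f = z≤n

ι-⇔ : {P Q : Set} → (P? : Dec P) (Q? : Dec Q) → (P → Q) → (Q → P) → ι P? ≡ ι Q?
ι-⇔ P? Q? f g = ≤-antisym (ι-mono P? Q? f) (ι-mono Q? P? g)

ι-× : {P Q : Set} → (P? : Dec P) (Q? : Dec Q) → ι (P? ×-dec Q?) ≡ ι P? * ι Q?
ι-× (yes p) (yes q) = refl
ι-× (yes p) (no ¬q) = refl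
ι-× (no ¬p) Q?      = refl

ι-*≤ : {P : Set} → (P? : Dec P) {a b : ℕ} → (P → a ≤ b) → ι P? * a ≤ ι P? * b
ι-*≤ (yes p) f = +-monoˡ-≤ 0 (f p)
ι-*≤ (no _)  f = z≤n

ι-*≡ : {P : Set} → (P? : Dec P) {a b : ℕ} → (P → a ≡ b) → ι P? * a ≡ ι P? * b
ι-*≡ (yes p) f = cong (_+ 0) (f p)
ι-*≡ (no _)  f = refl

ι-⊎≤ : {P Q R : Set} → (P? : Dec P) (Q? : Dec Q) (R? : Dec R) → (P → Q ⊎ R) → ι P? ≤ ι Q? + ι R?
ι-⊎≤ (no _)  Q? R? f = z≤n
ι-⊎≤ (yes p) Q? R? f with f p
... | inj₁ y = ≤-trans (≤-reflexive (sym (ι-yes Q? y))) (m≤m+n _ _)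
... | inj₂ z = ≤-trans (≤-reflexive (sym (ι-yes R? z))) (m≤n+m _ (ι Q?))

-- Finite sums over lists and double counting

∑ : {X : Set} → List X → (X → ℕ) → ℕ
∑ []       f = 0
∑ (x ∷ xs) f = f x + ∑ xs f

∑-mono-All : ∀ {X : Set} {xs : List X} {f g : X → ℕ} → All (λ x → f x ≤ g x) xs → ∑ xs f ≤ ∑ xs g
∑-mono-All []       = z≤n
∑-mono-All (p ∷ ps) = +-mono-≤ p (∑-mono-All ps)

∑-mono : ∀ {X : Set} (xs : List X) {f g : X → ℕ} → (∀ x → f x ≤ g x) → ∑ xs f ≤ ∑ xs g
∑-mono xs p = ∑-mono-All (All.universal p xs)

∑-cong-All : ∀ {X : Set} {xs : List X} {f g : X → ℕ} → All (λ x → f x ≡ g x) xs → ∑ xs f ≡ ∑ xs g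
∑-cong-All []       = refl
∑-cong-All (p ∷ ps) = cong₂ _+_ p (∑-cong-All ps)

∑-cong : ∀ {X : Set} (xs : List X) {f g : X → ℕ} → (∀ x → f x ≡ g x) → ∑ xs f ≡ ∑ xs g
∑-cong xs p = ∑-cong-All (All.universal p xs)

∑-+ : ∀ {X : Set} (xs : List X) (f g : X → ℕ) → ∑ xs (λ x → f x + g x) ≡ ∑ xs f + ∑ xs g
∑-+ []       f g = refl
∑-+ (x ∷ xs) f g rewrite ∑-+ xs f g = lem (f x) (g x) (∑ xs f) (∑ xs g)
  where lem : ∀ a b c d → a + b + (c + d) ≡ a + c + (b + d)
        lem = solve-∀

∑-*ˡ : ∀ {X : Set} (xs : List X) (c : ℕ) (f : X → ℕ) → ∑ xs (λ x → c * f x) ≡ c * ∑ xs f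
∑-*ˡ []       c f = sym (*-zeroʳ c)
∑-*ˡ (x ∷ xs) c f = trans (cong (c * f x +_) (∑-*ˡ xs c f)) (sym (*-distribˡ-+ c (f x) _))

∑-*ʳ : ∀ {X : Set} (xs : List X) (f : X → ℕ) (c : ℕ) → ∑ xs (λ x → f x * c) ≡ ∑ xs f * c
∑-*ʳ xs f c = trans (∑-cong xs λ x → *-comm (f x) c) (trans (∑-*ˡ xs c f) (*-comm c _))

∑-const : ∀ {X : Set} (xs : List X) (c : ℕ) → ∑ xs (λ _ → c) ≡ length xs * c
∑-const []       c = refl
∑-const (x ∷ xs) c = cong (c +_) (∑-const xs c)

∑-1 : ∀ {X : Set} (xs : List X) → ∑ xs (λ _ → 1) ≡ length xs
∑-1 xs = trans (∑-const xs 1) (*-identityʳ _)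

∑-swap : ∀ {X Y : Set} (xs : List X) (ys : List Y) (f : X → Y → ℕ) →
         ∑ xs (λ x → ∑ ys (f x)) ≡ ∑ ys (λ y → ∑ xs (λ x → f x y))
∑-swap []       ys f = sym (trans (∑-const ys 0) (*-zeroʳ (length ys)))
∑-swap (x ∷ xs) ys f = trans (cong (∑ ys (f x) +_) (∑-swap xs ys f)) (sym (∑-+ ys (f x) _))

∑-≥ : ∀ {X : Set} (xs : List X) (f : X → ℕ) {c} → Any (λ x → c ≤ f x) xs → c ≤ ∑ xs f
∑-≥ (x ∷ xs) f (here p) = ≤-trans p (m≤m+n _ _)
∑-≥ (x ∷ xs) f (there p) = ≤-trans (∑-≥ xs f p) (m≤n+m _ (f x))

∑-filter : ∀ {X : Set} {P : X → Set} (P? : Decidable P) (xs : List X) (f : X → ℕ) →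
           ∑ (filter P? xs) f ≡ ∑ xs (λ x → ι (P? x) * f x)
∑-filter P? []       f = refl
∑-filter P? (x ∷ xs) f with P? x
... | yes _ = cong₂ _+_ (sym (+-identityʳ (f x))) (∑-filter P? xs f)
... | no  _ = ∑-filter P? xs f

length-filter-ι : ∀ {X : Set} {P : X → Set} (P? : Decidable P) (xs : List X) →
                  length (filter P? xs) ≡ ∑ xs (λ x → ι (P? x))
length-filter-ι P? xs = trans (sym (∑-1 (filter P? xs)))
  (trans (∑-filter P? xs (λ _ → 1)) (∑-cong xs λ x → *-identityʳ _))

-- The weighted form of an injection: in each use `h` is the indicator of `x` being matched with
-- `y`, and no `g y` is spent twice.
∑-transfer : ∀ {X Y : Set} (xs : List X) (ys : List Y) (f : X → ℕ) (g : Y → ℕ) (h : X → Y → ℕ) →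
             All (λ x → f x ≤ ∑ ys (λ y → h x y * g y)) xs →
             (∀ y → ∑ xs (λ x → h x y) ≤ 1) → ∑ xs f ≤ ∑ ys g
∑-transfer xs ys f g h covered once = begin
  ∑ xs f  ≤⟨ ∑-mono-All covered ⟩
  ∑ xs (λ x → ∑ ys (λ y → h x y * g y))  ≡⟨ ∑-swap xs ys _ ⟩
  ∑ ys (λ y → ∑ xs (λ x → h x y * g y))  ≡⟨ ∑-cong ys (λ y → ∑-*ʳ xs (λ x → h x y) (g y)) ⟩
  ∑ ys (λ y → ∑ xs (λ x → h x y) * g y)  ≤⟨ ∑-mono ys (λ y → *-monoˡ-≤ (g y) (once y)) ⟩
  ∑ ys (λ y → 1 * g y)  ≡⟨ ∑-cong ys (λ y → *-identityˡ (g y)) ⟩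
  ∑ ys g  ∎
  where open ≤-Reasoning

-- An arbitrary relation `_~_` takes the place of equality because lists of subspaces are distinct
-- only up to `_≐_`.
at-most-once-∈ : ∀ {X : Set} {_~_ : X → X → Set} {H : X → Set} (H? : Decidable H) {xs} →
                 (∀ {x y} → x ∈ₗ xs → y ∈ₗ xs → H x → H y → x ~ y) → AllPairs (λ x y → ¬ (x ~ y)) xs →
                 ∑ xs (λ x → ι (H? x)) ≤ 1
at-most-once-∈ H? f [] = z≤n
at-most-once-∈ H? {x ∷ xs} f (px ∷ ps) with H? x
... | no _   = at-most-once-∈ H? (λ a b → f (there a) (there b)) ps
... | yes hx = s≤s (≤-reflexive (trans (∑-cong-All (All.tabulate λ {y} y∈ → ι-no (H? y) λ hy → All.lookup px y∈ (f (here refl) (there y∈) hx hy)))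
                                       (trans (∑-const xs 0) (*-zeroʳ (length xs)))))

at-most-once : ∀ {X : Set} {_~_ : X → X → Set} {H : X → Set} (H? : Decidable H) →
               (∀ {x y} → H x → H y → x ~ y) → ∀ {xs} → AllPairs (λ x y → ¬ (x ~ y)) xs →
               ∑ xs (λ x → ι (H? x)) ≤ 1
at-most-once H? f = at-most-once-∈ H? λ _ _ → f

-- Divided by `A` and `Q` the hypotheses say `f ≤ (s + 1/Q) A`, `g ≤ (s′ + 1/Q) A` and
-- `h ≥ (μ − 1/Q) A`. The integers `s * s′` and `μ * μ` differ by at least 1, and this gap beats the
-- errors of order `(s + s′ + 2μ) / Q`.
leading-term-inequality : ∀ {A Q s s′ μ f g h} → 0 < A → f * Q ≤ (s * Q + 1) * A → g * Q ≤ (s′ * Q + 1) * A →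
                  μ * Q * A ≤ h * Q + A → s * s′ < μ * μ → s + s′ + (μ + μ) < Q → f * g < h * h
leading-term-inequality {A} {Q} {s} {s′} {μ} {f} {g} {h} 0<A fQ gQ hQ ss′ Q> = ≰⇒> λ h²≤fg → <⇒≱ Q> (Q≤ h²≤fg)
  where
  instance _ = >-nonZero 0<A
           _ = >-nonZero (≤-<-trans z≤n Q>)
  μ>0 : 0 < μ
  μ>0 = n≢0⇒n>0 λ { refl → <⇒≱ ss′ z≤n }
  -- `w / Q` is the lower estimate `μ − 1/Q` for `h / A`.
  w = pred (μ * Q)
  w+1 : suc w ≡ μ * Q
  w+1 = suc-pred (μ * Q) {{>-nonZero (*-mono-≤ μ>0 (≤-<-trans z≤n Q>))}}
  wA≤ : w * A ≤ h * Q
  wA≤ = +-cancelʳ-≤ A (w * A) (h * Q) (begin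
    w * A + A  ≡⟨ +-comm (w * A) A ⟩
    suc w * A  ≡⟨ cong (_* A) w+1 ⟩
    μ * Q * A  ≤⟨ hQ ⟩
    h * Q + A  ∎)
    where open ≤-Reasoning
  sq : h * h ≤ f * g → w * w ≤ (s * Q + 1) * (s′ * Q + 1)
  sq h²≤fg = *-cancelʳ-≤ (w * w) _ (A * A) {{m*n≢0 A A}} (begin
    w * w * (A * A)  ≡⟨ lem w A w A ⟩
    w * A * (w * A)  ≤⟨ *-mono-≤ wA≤ wA≤ ⟩
    h * Q * (h * Q)  ≡⟨ lem h Q h Q ⟨
    h * h * (Q * Q)  ≤⟨ *-monoˡ-≤ (Q * Q) h²≤fg ⟩
    f * g * (Q * Q)  ≡⟨ lem f Q g Q ⟩
    f * Q * (g * Q)  ≤⟨ *-mono-≤ fQ gQ ⟩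
    (s * Q + 1) * A * ((s′ * Q + 1) * A) ≡⟨ lem (s * Q + 1) A (s′ * Q + 1) A ⟨
    (s * Q + 1) * (s′ * Q + 1) * (A * A) ∎)
    where open ≤-Reasoning
          lem : ∀ a b c d → a * c * (b * d) ≡ a * b * (c * d)
          lem = solve-∀
  Q≤ : h * h ≤ f * g → Q ≤ s + s′ + (μ + μ)
  Q≤ h²≤fg = *-cancelʳ-≤ Q _ Q (+-cancelˡ-≤ (s * s′ * (Q * Q)) _ _ (begin
    s * s′ * (Q * Q) + Q * Q  ≡⟨ +-comm (s * s′ * (Q * Q)) _ ⟩
    suc (s * s′) * (Q * Q)  ≤⟨ *-monoˡ-≤ (Q * Q) ss′ ⟩
    μ * μ * (Q * Q)  ≡⟨ e₀ μ Q ⟩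
    μ * Q * (μ * Q)  ≡⟨ cong (λ z → z * z) (sym w+1) ⟩
    suc w * suc w  ≡⟨ e₁ w ⟩
    w * w + (w + suc w)  ≤⟨ +-monoˡ-≤ _ (sq h²≤fg) ⟩
    (s * Q + 1) * (s′ * Q + 1) + (w + suc w) ≡⟨ e₂ s s′ Q w ⟩
    s * s′ * (Q * Q) + ((s + s′) * Q + (suc w + suc w)) ≡⟨ cong (λ z → s * s′ * (Q * Q) + ((s + s′) * Q + (z + z))) w+1 ⟩
    s * s′ * (Q * Q) + ((s + s′) * Q + (μ * Q + μ * Q)) ≡⟨ e₃ s s′ Q μ ⟩
    s * s′ * (Q * Q) + (s + s′ + (μ + μ)) * Q ∎))
    where open ≤-Reasoning
          e₀ : ∀ μ Q → μ * μ * (Q * Q) ≡ μ * Q * (μ * Q)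
          e₀ = solve-∀
          e₁ : ∀ w → suc w * suc w ≡ w * w + (w + suc w)
          e₁ = solve-∀
          e₂ : ∀ s s′ Q w → (s * Q + 1) * (s′ * Q + 1) + (w + suc w)
                 ≡ s * s′ * (Q * Q) + ((s + s′) * Q + (suc w + suc w))
          e₂ = solve-∀
          e₃ : ∀ s s′ Q μ → s * s′ * (Q * Q) + ((s + s′) * Q + (μ * Q + μ * Q))
                 ≡ s * s′ * (Q * Q) + (s + s′ + (μ + μ)) * Q
          e₃ = solve-∀

-- q-numbers, Gaussian binomials and the decay of subspace counts

module QNumber (q : ℕ) (2≤q : 2 ≤ q) where

  instance
    q-nonZero : NonZero q
    q-nonZero = >-nonZero (≤-trans (s≤s z≤n) 2≤q)

  p : ℕ
  p = pred q

  q≡1+p : q ≡ suc p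
  q≡1+p = sym (suc-pred q)

  0<p : 0 < p
  0<p = s≤s⁻¹ (≤-trans 2≤q (≤-reflexive q≡1+p))

  -- qn m = (q^m − 1) / (q − 1)
  qn : ℕ → ℕ
  qn zero    = 0
  qn (suc m) = suc (q * qn m)

  q^m≡1+p*qn : ∀ m → q ^ m ≡ 1 + p * qn m
  q^m≡1+p*qn zero    = cong suc (sym (*-zeroʳ p))
  q^m≡1+p*qn (suc m) = begin
    q * q ^ m  ≡⟨ cong (q *_) (q^m≡1+p*qn m) ⟩
    q * (1 + p * qn m)  ≡⟨ lem q p (qn m) ⟩
    q + p * (q * qn m)  ≡⟨ cong (_+ p * (q * qn m)) q≡1+p ⟩
    suc p + p * (q * qn m)  ≡⟨ lem₂ p (q * qn m) ⟩
    1 + p * suc (q * qn m)  ∎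
    where open ≡-Reasoning
          lem : ∀ q p x → q * (1 + p * x) ≡ q + p * (q * x)
          lem = solve-∀
          lem₂ : ∀ p y → suc p + p * y ≡ 1 + p * suc y
          lem₂ = solve-∀

  qn-+ : ∀ a b → qn (a + b) ≡ qn a + q ^ a * qn b
  qn-+ zero    b = sym (+-identityʳ (qn b))
  qn-+ (suc a) b = cong suc (trans (cong (q *_) (qn-+ a b)) (lem q (qn a) (q ^ a) (qn b)))
    where lem : ∀ q x y z → q * (x + y * z) ≡ q * x + q * y * z
          lem = solve-∀

  qn1≡1 : qn 1 ≡ 1
  qn1≡1 = cong suc (*-zeroʳ q)

  qn-suc : ∀ a → qn (suc a) ≡ qn a + q ^ a
  qn-suc a = begin
    qn (suc a)  ≡⟨ cong qn (+-comm 1 a) ⟩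
    qn (a + 1)  ≡⟨ qn-+ a 1 ⟩
    qn a + q ^ a * qn 1  ≡⟨ cong (λ z → qn a + q ^ a * z) qn1≡1 ⟩
    qn a + q ^ a * 1  ≡⟨ cong (qn a +_) (*-identityʳ _) ⟩
    qn a + q ^ a  ∎
    where open ≡-Reasoning

  qn<q^ : ∀ m → qn m < q ^ m
  qn<q^ m = ≤-trans (s≤s (m≤n*m (qn m) p {{>-nonZero 0<p}})) (≤-reflexive (sym (q^m≡1+p*qn m)))

  qn-mono : ∀ {a b} → a ≤ b → qn a ≤ qn b
  qn-mono z≤n     = z≤n
  qn-mono (s≤s l) = s≤s (*-monoʳ-≤ q (qn-mono l))

  qn-mono-< : ∀ {a b} → a < b → qn a < qn b
  qn-mono-< {a} l = <-≤-trans (subst (qn a <_) (sym (qn-suc a)) (m<m+n (qn a) (m^n>0 q a))) (qn-mono l)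

  -- Bounds the quotient `qn (suc r + x) / qn (suc r)`, the cost of one counting step, by a factor
  -- that does not depend on `r`.
  qn-ratio : ∀ r x → qn (suc r + x) ≤ qn (suc x) * qn (suc r)
  qn-ratio r x = begin
    qn (suc r + x)  ≡⟨ cong qn (+-comm (suc r) x) ⟩
    qn (x + suc r)  ≡⟨ qn-+ x (suc r) ⟩
    qn x + q ^ x * qn (suc r)  ≤⟨ +-monoˡ-≤ _ (m≤m*n (qn x) (qn (suc r))) ⟩
    qn x * qn (suc r) + q ^ x * qn (suc r) ≡⟨ *-distribʳ-+ (qn (suc r)) (qn x) (q ^ x) ⟨
    (qn x + q ^ x) * qn (suc r)  ≡⟨ cong (_* qn (suc r)) (qn-suc x) ⟨
    qn (suc x) * qn (suc r)  ∎
    where open ≤-Reasoning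

  q^-+ : ∀ j i → q ^ (j + i) ≡ q ^ j + p * q ^ j * qn i
  q^-+ j i = trans (^-distribˡ-+-* q j i) (trans (cong (q ^ j *_) (q^m≡1+p*qn i)) (lem (q ^ j) p (qn i)))
    where lem : ∀ x p y → x * (1 + p * y) ≡ x + p * x * y
          lem = solve-∀

  q^-cancel-≤ : ∀ {a b} → q ^ a ≤ q ^ b → a ≤ b
  q^-cancel-≤ l = ≮⇒≥ λ b<a → <⇒≱ (^-monoʳ-< q 2≤q b<a) l

  q^-injective : ∀ {a b} → q ^ a ≡ q ^ b → a ≡ b
  q^-injective e = ≤-antisym (q^-cancel-≤ (≤-reflexive e)) (q^-cancel-≤ (≤-reflexive (sym e)))

  2*qn2<qn3 : qn 2 + qn 2 < qn 3
  2*qn2<qn3 = begin-strict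
    qn 2 + qn 2  ≡⟨ cong (λ z → suc (q * z) + suc (q * z)) qn1≡1 ⟩
    suc (q * 1) + suc (q * 1) ≡⟨ lem q ⟩
    2 + 2 * q  ≡⟨ +-comm 2 (2 * q) ⟩
    2 * q + 2  ≤⟨ +-mono-≤ (*-monoˡ-≤ q 2≤q) 2≤q ⟩
    q * q + q  <⟨ n<1+n _ ⟩
    suc (q * q + q)  ≡⟨ lem₂ q ⟩
    suc (q * suc (q * 1))  ≡⟨ cong (λ z → suc (q * suc (q * z))) qn1≡1 ⟨
    qn 3  ∎
    where open ≤-Reasoning
          lem : ∀ q → suc (q * 1) + suc (q * 1) ≡ 2 + 2 * q
          lem = solve-∀
          lem₂ : ∀ q → suc (q * q + q) ≡ suc (q * suc (q * 1))
          lem₂ = solve-∀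

  -- The Gaussian binomial [d choose r], through the quotient recursion that double counting produces.
  G : ℕ → ℕ → ℕ
  G d zero    = 1
  G d (suc r) = (qn d * G (pred d) r) / qn (suc r)

  -- A solution `x` of the recursion makes the division in `G` exact. For general `d` and `r` such
  -- solutions will be supplied by counting subspaces.
  G-unique : ∀ d r x → qn (suc r) * x ≡ qn d * G (pred d) r → x ≡ G d (suc r)
  G-unique d r x e = trans (sym (m*n/n≡m x (qn (suc r)))) (cong (_/ qn (suc r)) (trans (*-comm x _) e))

  -- Of `qn (x + suc r) = qn x + q ^ x * qn (suc r)` only the second summand is kept. Rounding does
  -- no harm, since the left side can be written as an exact quotient by `qn (suc r)`.
  G-ratio : ∀ x r → q ^ x * G (r + x) r ≤ G (suc r + x) (suc r)
  G-ratio x r = begin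
    q ^ x * G (r + x) r  ≡⟨ m*n/n≡m _ (qn (suc r)) ⟨
    q ^ x * G (r + x) r * qn (suc r) / qn (suc r)  ≤⟨ /-monoˡ-≤ (qn (suc r)) le ⟩
    G (suc r + x) (suc r)  ∎
    where open ≤-Reasoning
          lem : ∀ a b c → a * b * c ≡ a * c * b
          lem = solve-∀
          le : q ^ x * G (r + x) r * qn (suc r) ≤ qn (suc r + x) * G (r + x) r
          le = begin
            q ^ x * G (r + x) r * qn (suc r)  ≡⟨ lem (q ^ x) _ _ ⟩
            q ^ x * qn (suc r) * G (r + x) r  ≤⟨ *-monoˡ-≤ (G (r + x) r) (m≤n+m _ (qn x)) ⟩
            (qn x + q ^ x * qn (suc r)) * G (r + x) r ≡⟨ cong (_* G (r + x) r) (qn-+ x (suc r)) ⟨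
            qn (x + suc r) * G (r + x) r  ≡⟨ cong (λ z → qn z * G (r + x) r) (+-comm x (suc r)) ⟩
            qn (suc r + x) * G (r + x) r  ∎

  G-positive : ∀ x r → 0 < G (r + x) r
  G-positive x zero    = z<s
  G-positive x (suc r) = ≤-trans (*-mono-≤ (m^n>0 q x) (G-positive x r)) (G-ratio x r)

  G-1 : ∀ d → G d 1 ≡ qn d
  G-1 d = sym (G-unique d 0 (qn d) (trans (*-comm (qn 1) (qn d)) (cong (qn d *_) qn1≡1)))

  G-hyperplane : ∀ d → G (suc d) d ≡ qn (suc d)
  G-hyperplane zero    = sym qn1≡1
  G-hyperplane (suc d) = sym (G-unique (2 + d) d (qn (2 + d))
    (trans (*-comm (qn (suc d)) (qn (2 + d))) (cong (qn (2 + d) *_) (sym (G-hyperplane d)))))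

  -- `G (2 + t) 2` will count the (t+2)-spaces between a t-space and a (2t+2)-space, the
  -- second-order term of H₁ when k = 2t + 1.
  G-2≥ : ∀ t → q ^ t * qn (suc t) ≤ G (2 + t) 2
  G-2≥ t = subst (λ z → q ^ t * z ≤ G (2 + t) 2) (G-1 (suc t)) (G-ratio t 1)

  G-2≤ : ∀ t → G (2 + t) 2 ≤ q ^ (2 * t + 3)
  G-2≤ t = begin
    G (2 + t) 2  ≤⟨ m/n≤m _ (qn 2) ⟩
    qn (2 + t) * G (1 + t) 1  ≡⟨ cong (qn (2 + t) *_) (G-1 (suc t)) ⟩
    qn (2 + t) * qn (1 + t)  ≤⟨ *-mono-≤ (<⇒≤ (qn<q^ (2 + t))) (<⇒≤ (qn<q^ (1 + t))) ⟩
    q ^ (2 + t) * q ^ (1 + t)  ≡⟨ ^-distribˡ-+-* q (2 + t) (1 + t) ⟨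
    q ^ (2 + t + (1 + t))  ≡⟨ cong (q ^_) (lem t) ⟩
    q ^ (2 * t + 3)  ∎
    where open ≤-Reasoning
          lem : ∀ t → 2 + t + (1 + t) ≡ 2 * t + 3
          lem = solve-∀

  -- The number of k-spaces through a given s-space of an n-space.
  N : ℕ → ℕ → ℕ → ℕ
  N n k s with s ≤? k
  ... | yes _ = G (n ∸ s) (k ∸ s)
  ... | no _  = 0

  N-yes : ∀ {n k s} → s ≤ k → N n k s ≡ G (n ∸ s) (k ∸ s)
  N-yes {n} {k} {s} s≤k with s ≤? k
  ... | yes _  = refl
  ... | no s≰k = contradiction s≤k s≰k

  N-no : ∀ {n k s} → k < s → N n k s ≡ 0
  N-no {n} {k} {s} k<s with s ≤? k
  ... | yes s≤k = contradiction s≤k (<⇒≱ k<s)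
  ... | no _    = refl

  private
    ∸-split : ∀ {n k s} → s ≤ k → k ≤ n → n ∸ s ≡ (k ∸ s) + (n ∸ k)
    ∸-split {n} {k} {s} s≤k k≤n = begin
      n ∸ s  ≡⟨ cong (_∸ s) (m+[n∸m]≡n k≤n) ⟨
      k + (n ∸ k) ∸ s  ≡⟨ +-∸-comm (n ∸ k) s≤k ⟩
      (k ∸ s) + (n ∸ k)  ∎
      where open ≡-Reasoning

  N-positive : ∀ {n k s} → s ≤ k → k ≤ n → 0 < N n k s
  N-positive {n} {k} {s} s≤k k≤n = subst (0 <_) (sym (trans (N-yes {n} s≤k) (cong (λ z → G z (k ∸ s)) (∸-split s≤k k≤n))))
    (G-positive (n ∸ k) (k ∸ s))

  N-ratio : ∀ {n k} s → k ≤ n → q ^ (n ∸ k) * N n k (suc s) ≤ N n k s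
  N-ratio {n} {k} s k≤n with <-≤-connex s k
  ... | inj₂ k≤s = subst (λ z → q ^ (n ∸ k) * z ≤ N n k s) (sym (N-no {n} (s≤s k≤s)))
                     (subst (_≤ N n k s) (sym (*-zeroʳ (q ^ (n ∸ k)))) z≤n)
  ... | inj₁ s<k = begin
    q ^ (n ∸ k) * N n k (suc s)  ≡⟨ cong (q ^ (n ∸ k) *_) (N-yes {n} s<k) ⟩
    q ^ (n ∸ k) * G (n ∸ suc s) (k ∸ suc s)  ≡⟨ cong (λ z → q ^ (n ∸ k) * G z (k ∸ suc s)) (∸-split s<k k≤n) ⟩
    q ^ (n ∸ k) * G ((k ∸ suc s) + (n ∸ k)) (k ∸ suc s)  ≤⟨ G-ratio (n ∸ k) (k ∸ suc s) ⟩
    G (suc (k ∸ suc s) + (n ∸ k)) (suc (k ∸ suc s))  ≡⟨ cong (λ z → G (z + (n ∸ k)) z) (sym (+-∸-assoc 1 s<k)) ⟩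
    G ((k ∸ s) + (n ∸ k)) (k ∸ s)  ≡⟨ cong (λ z → G z (k ∸ s)) (∸-split (<⇒≤ s<k) k≤n) ⟨
    G (n ∸ s) (k ∸ s)  ≡⟨ N-yes {n} (<⇒≤ s<k) ⟨
    N n k s  ∎
    where open ≤-Reasoning

  N-ratio^ : ∀ {n k} s i → k ≤ n → q ^ ((n ∸ k) * i) * N n k (s + i) ≤ N n k s
  N-ratio^ {n} {k} s zero k≤n rewrite *-zeroʳ (n ∸ k) | +-identityʳ s | +-identityʳ (N n k s) = ≤-refl
  N-ratio^ {n} {k} s (suc i) k≤n = begin
    q ^ ((n ∸ k) * suc i) * N n k (s + suc i)  ≡⟨ cong₂ (λ a b → q ^ a * N n k b) (*-suc (n ∸ k) i) (+-suc s i) ⟩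
    q ^ ((n ∸ k) + (n ∸ k) * i) * N n k (suc s + i)  ≡⟨ cong (_* N n k (suc s + i)) (^-distribˡ-+-* q (n ∸ k) _) ⟩
    q ^ (n ∸ k) * q ^ ((n ∸ k) * i) * N n k (suc s + i)  ≡⟨ *-assoc (q ^ (n ∸ k)) _ _ ⟩
    q ^ (n ∸ k) * (q ^ ((n ∸ k) * i) * N n k (suc s + i)) ≤⟨ *-monoʳ-≤ (q ^ (n ∸ k)) (N-ratio^ (suc s) i k≤n) ⟩
    q ^ (n ∸ k) * N n k (suc s)  ≤⟨ N-ratio s k≤n ⟩
    N n k s  ∎
    where open ≤-Reasoning

  -- Since n - k is at least 3k + 6, one more dimension gains `q ^ (3 * k + 6)`. This is the budget
  -- against which error factors are measured.
  N-decay : ∀ {n k} s → 4 * k + 6 ≤ n → q ^ (3 * k + 6) * N n k (suc s) ≤ N n k s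
  N-decay {n} {k} s n≥ = ≤-trans (*-monoˡ-≤ (N n k (suc s)) (^-monoʳ-≤ q le)) (N-ratio s k≤n)
    where
    k+ : ∀ k → 4 * k + 6 ≡ 3 * k + 6 + k
    k+ = solve-∀
    le : 3 * k + 6 ≤ n ∸ k
    le = m+n≤o⇒m≤o∸n (3 * k + 6) (≤-trans (≤-reflexive (sym (k+ k))) n≥)
    k≤n : k ≤ n
    k≤n = ≤-trans (m≤n+m k (3 * k + 6)) (≤-trans (≤-reflexive (sym (k+ k))) n≥)

  -- `a` and `b` are the excesses over t + 1 of the dimensions of smallest covers. The left side
  -- equals `2t + (2 + a + b)(k + 1)`; as `a + b` is positive, each unit of excess costs at most
  -- `3(k + 1)` and gains `D`.
  covering-exponents : ∀ {k t D} a b → t < k → 3 * k + 6 ≤ D → 0 < a + b →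
                  ((2 + a) * t + suc (k ∸ t) * suc b) + ((2 + b) * t + suc (k ∸ t) * suc a) < 2 * suc t + D * (a + b)
  covering-exponents {k} {t} {D} a b t<k D≥ 0<a+b = begin-strict
    ((2 + a) * t + x * suc b) + ((2 + b) * t + x * suc a)  ≡⟨ e₁ a b t x ⟩
    2 * t + 2 * (t + x) + (a + b) * (t + x)  ≡⟨ cong (λ z → 2 * t + 2 * z + (a + b) * z) t+x ⟩
    2 * t + 2 * suc k + (a + b) * suc k  ≡⟨ cong (λ z → 2 * t + 2 * suc k + z * suc k) s≡ ⟨
    2 * t + 2 * suc k + suc s * suc k  <⟨ m<m+n _ (s≤s z≤n) ⟩
    2 * t + 2 * suc k + suc s * suc k + suc (4 + (2 * k + 5) * s) ≡⟨ e₂ t k s ⟩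
    2 * suc t + (3 * k + 6) * suc s  ≤⟨ +-monoʳ-≤ (2 * suc t) (*-mono-≤ D≥ (≤-reflexive s≡)) ⟩
    2 * suc t + D * (a + b)  ∎
    where
    open ≤-Reasoning
    x = suc (k ∸ t)
    s = pred (a + b)
    s≡ : suc s ≡ a + b
    s≡ = suc-pred (a + b) {{>-nonZero 0<a+b}}
    t+x : t + x ≡ suc k
    t+x = trans (+-suc t (k ∸ t)) (cong suc (m+[n∸m]≡n (<⇒≤ t<k)))
    e₁ : ∀ a b t x → ((2 + a) * t + x * suc b) + ((2 + b) * t + x * suc a) ≡ 2 * t + 2 * (t + x) + (a + b) * (t + x)
    e₁ = solve-∀
    e₂ : ∀ t k s → 2 * t + 2 * suc k + suc s * suc k + suc (4 + (2 * k + 5) * s) ≡ 2 * suc t + (3 * k + 6) * suc s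
    e₂ = solve-∀

  covering-inequality : ∀ {A f g h t D a b} e₁ e₂ → 0 < A → f * q ^ (D * b) ≤ q ^ e₁ * A → g * q ^ (D * a) ≤ q ^ e₂ * A →
                   q ^ suc t * A ≤ h → e₁ + e₂ < 2 * suc t + D * (a + b) → f * g < h * h
  covering-inequality {A} {f} {g} {h} {t} {D} {a} {b} e₁ e₂ 0<A f≤ g≤ h≥ lt = ≰⇒> λ h²≤fg → <⇒≱ lt (q^-cancel-≤
    (*-cancelʳ-≤ _ _ (A * A) {{m*n≢0 A A {{>-nonZero 0<A}} {{>-nonZero 0<A}}}} (begin
      q ^ (2 * suc t + D * (a + b)) * (A * A)  ≡⟨ cong (λ z → q ^ z * (A * A)) (x₁ t D a b) ⟩
      q ^ (suc t + suc t + (D * b + D * a)) * (A * A)  ≡⟨ cong (_* (A * A)) (trans (^-distribˡ-+-* q (suc t + suc t) _)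
                                                                  (cong₂ _*_ (^-distribˡ-+-* q (suc t) (suc t)) (^-distribˡ-+-* q (D * b) (D * a)))) ⟩
      T * T * (Db * Da) * (A * A)  ≡⟨ x₂ T Db Da A ⟩
      (T * A) * (T * A) * (Db * Da)  ≤⟨ *-monoˡ-≤ (Db * Da) (≤-trans (*-mono-≤ h≥ h≥) h²≤fg) ⟩
      f * g * (Db * Da)  ≡⟨ x₃ f g Db Da ⟩
      (f * Db) * (g * Da)  ≤⟨ *-mono-≤ f≤ g≤ ⟩
      (q ^ e₁ * A) * (q ^ e₂ * A)  ≡⟨ x₃ (q ^ e₁) (q ^ e₂) A A ⟨
      q ^ e₁ * q ^ e₂ * (A * A)  ≡⟨ cong (_* (A * A)) (^-distribˡ-+-* q e₁ e₂) ⟨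
      q ^ (e₁ + e₂) * (A * A)  ∎)))
    where
    open ≤-Reasoning
    T = q ^ suc t
    Db = q ^ (D * b)
    Da = q ^ (D * a)
    x₁ : ∀ t D a b → 2 * suc t + D * (a + b) ≡ suc t + suc t + (D * b + D * a)
    x₁ = solve-∀
    x₂ : ∀ T b a A → T * T * (b * a) * (A * A) ≡ (T * A) * (T * A) * (b * a)
    x₂ = solve-∀
    x₃ : ∀ f g b a → f * g * (b * a) ≡ (f * b) * (g * a)
    x₃ = solve-∀

  qn≤q^ : ∀ m → qn m ≤ q ^ m
  qn≤q^ m = <⇒≤ (qn<q^ m)

  pow-bound : ∀ {x y i j} → x ≤ q ^ i → y ≤ q ^ j → x * y ≤ q ^ (i + j)
  pow-bound {i = i} {j} x≤ y≤ = ≤-trans (*-mono-≤ x≤ y≤) (≤-reflexive (sym (^-distribˡ-+-* q i j)))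

  q^*-≤ : ∀ {x i j} → x ≤ q ^ i → i ≤ j → x ≤ q ^ j
  q^*-≤ x≤ i≤j = ≤-trans x≤ (^-monoʳ-≤ q i≤j)

  2≤q^1+ : ∀ m → 2 ≤ q ^ suc m
  2≤q^1+ m = *-mono-≤ 2≤q (m^n>0 q m)

  4*q^ : ∀ m → 4 * q ^ m ≤ q ^ (2 + m)
  4*q^ m = ≤-trans (*-monoˡ-≤ (q ^ m) (*-mono-≤ 2≤q 2≤q)) (≤-reflexive (*-assoc q q (q ^ m)))

does-true : {P : Set} (P? : Dec P) → does P? ≡ true → P
does-true (yes p) _ = p

-- Coordinate vectors as an abelian group with scalars

module VectorLaws {q : ℕ} (𝔽 : FiniteField q) (m : ℕ) where
  open FiniteField 𝔽
  open Geometry 𝔽 m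
  module F = IsCommutativeRing isCommutativeRing

  fieldRing : Ring _ _
  fieldRing = record { isRing = F.isRing }

  open RingProperties fieldRing using (-1*x≈-x) public

  ·-distribˡ : ∀ {k} c (u v : Vec K k) → map (c *F_) (zipWith _+F_ u v) ≡ zipWith _+F_ (map (c *F_) u) (map (c *F_) v)
  ·-distribˡ c []      []      = refl
  ·-distribˡ c (x ∷ u) (y ∷ v) = cong₂ _∷_ (F.distribˡ c x y) (·-distribˡ c u v)

  ·-distribʳ : ∀ {k} c d (v : Vec K k) → map ((c +F d) *F_) v ≡ zipWith _+F_ (map (c *F_) v) (map (d *F_) v)
  ·-distribʳ c d []      = refl
  ·-distribʳ c d (x ∷ v) = cong₂ _∷_ (F.distribʳ x c d) (·-distribʳ c d v)

  ·-assoc : ∀ c d v → (c *F d) · v ≡ c · (d · v)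
  ·-assoc c d v = trans (map-cong (F.*-assoc c d) v) (map-∘ (c *F_) (d *F_) v)

  ·-identity : ∀ v → 1F · v ≡ v
  ·-identity v = trans (map-cong F.*-identityˡ v) (map-id v)

  ·-zero : ∀ {k} (v : Vec K k) → map (0F *F_) v ≡ replicate k 0F
  ·-zero []      = refl
  ·-zero (x ∷ v) = cong₂ _∷_ (F.zeroˡ x) (·-zero v)

  ·-zeroV : ∀ c → c · 0V ≡ 0V
  ·-zeroV c = trans (Vec.map-replicate (c *F_) 0F m) (cong (replicate m) (F.zeroʳ c))

  -- Taken as a scalar multiple, so that subspaces are closed under it by `scale∈`.
  neg : V → V
  neg v = (-F 1F) · v

  neg-inverse : ∀ {k} (v : Vec K k) → zipWith _+F_ (map ((-F 1F) *F_) v) v ≡ replicate k 0F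
  neg-inverse []      = refl
  neg-inverse (x ∷ v) = cong₂ _∷_ (trans (cong (_+F x) (-1*x≈-x x)) (F.-‿inverseˡ x)) (neg-inverse v)

  ⊕-comm : ∀ u v → u ⊕ v ≡ v ⊕ u
  ⊕-comm = zipWith-comm F.+-comm

  ⊕-assoc : ∀ u v w → (u ⊕ v) ⊕ w ≡ u ⊕ (v ⊕ w)
  ⊕-assoc = zipWith-assoc F.+-assoc

  ⊕-identityˡ : ∀ v → 0V ⊕ v ≡ v
  ⊕-identityˡ = zipWith-identityˡ F.+-identityˡ

  vectorGroup : AbelianGroup _ _
  vectorGroup = record
    { Carrier = V ; _≈_ = _≡_ ; _∙_ = _⊕_ ; ε = 0V ; _⁻¹ = neg
    ; isAbelianGroup = record
      { isGroup = record
        { isMonoid = record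
          { isSemigroup = record
            { isMagma = record { isEquivalence = isEquivalence ; ∙-cong = cong₂ _⊕_ }
            ; assoc = ⊕-assoc }
          ; identity = ⊕-identityˡ , (λ v → trans (⊕-comm v 0V) (⊕-identityˡ v)) }
        ; inverse = neg-inverse , (λ v → trans (⊕-comm v (neg v)) (neg-inverse v))
        ; ⁻¹-cong = cong neg }
      ; comm = ⊕-comm } }

  open AbelianGroup vectorGroup using () renaming (identityʳ to ⊕-identityʳ; inverseʳ to ⊕-inverseʳ; inverseˡ to ⊕-inverseˡ) public
  open AbelianGroupProperties vectorGroup using () renaming (⁻¹-∙-comm to neg-⊕; ⁻¹-involutive to neg-involutive) public

  infixl 6 _⊖_
  _⊖_ : V → V → V
  u ⊖ v = u ⊕ neg v

  ⊖-⊕ : ∀ u v → (u ⊖ v) ⊕ v ≡ u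
  ⊖-⊕ u v = trans (⊕-assoc u (neg v) v) (trans (cong (u ⊕_) (⊕-inverseˡ v)) (⊕-identityʳ u))

  ⊕-⊖ : ∀ u v → (u ⊕ v) ⊖ v ≡ u
  ⊕-⊖ u v = trans (⊕-assoc u v (neg v)) (trans (cong (u ⊕_) (⊕-inverseʳ v)) (⊕-identityʳ u))

  ⊖-zero⇒≡ : ∀ u v → u ⊖ v ≡ 0V → u ≡ v
  ⊖-zero⇒≡ u v e = trans (sym (⊖-⊕ u v)) (trans (cong (_⊕ v) e) (⊕-identityˡ v))

  ⊖-self : ∀ u → u ⊖ u ≡ 0V
  ⊖-self = ⊕-inverseʳ

  swap-⊕ : ∀ u v w x → (u ⊕ v) ⊕ (w ⊕ x) ≡ (u ⊕ w) ⊕ (v ⊕ x)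
  swap-⊕ u v w x = begin
    (u ⊕ v) ⊕ (w ⊕ x)  ≡⟨ ⊕-assoc u v (w ⊕ x) ⟩
    u ⊕ (v ⊕ (w ⊕ x))  ≡⟨ cong (u ⊕_) (⊕-assoc v w x) ⟨
    u ⊕ ((v ⊕ w) ⊕ x)  ≡⟨ cong (λ z → u ⊕ (z ⊕ x)) (⊕-comm v w) ⟩
    u ⊕ ((w ⊕ v) ⊕ x)  ≡⟨ cong (u ⊕_) (⊕-assoc w v x) ⟩
    u ⊕ (w ⊕ (v ⊕ x))  ≡⟨ ⊕-assoc u w (v ⊕ x) ⟨
    (u ⊕ w) ⊕ (v ⊕ x)  ∎
    where open ≡-Reasoning

-- Subspaces, their cardinality and dimension

module LinearAlgebra {q : ℕ} (𝔽 : FiniteField q) (n : ℕ) where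
  open FiniteField 𝔽
  open Geometry 𝔽 n hiding (_∈_) public
  open VectorLaws 𝔽 n public

  private
    2≤q′ : ∀ {q} (x y : Fin q) → x ≢ y → 2 ≤ q
    2≤q′ {suc (suc q)} x y x≢y = s≤s (s≤s z≤n)
    2≤q′ {suc zero} Fin.zero Fin.zero x≢y = contradiction refl x≢y

  2≤q : 2 ≤ q
  2≤q = 2≤q′ 0F 1F 0≢1

  open QNumber q 2≤q public

  vecs : ∀ {X : Set} → List X → ∀ m → List (Vec X m)
  vecs xs zero    = [] ∷ []
  vecs xs (suc m) = cartesianProductWith _∷_ xs (vecs xs m)

  vecs-complete : ∀ {X : Set} {xs : List X} → (∀ x → x ∈ₗ xs) → ∀ {m} (v : Vec X m) → v ∈ₗ vecs xs m
  vecs-complete f []      = here refl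
  vecs-complete f (x ∷ v) = ∈-cartesianProductWith⁺ _∷_ (f x) (vecs-complete f v)

  allVec : ∀ m → List (Vec K m)
  allVec = vecs (allFin q)

  allVec-complete : ∀ {m} (v : Vec K m) → v ∈ₗ allVec m
  allVec-complete = vecs-complete ∈-allFin

  allVec-unique : ∀ m → Unique (allVec m)
  allVec-unique zero    = [] ∷ []
  allVec-unique (suc m) = cartesianProductWith⁺ _∷_ ∷-injective (allFin⁺ q) (allVec-unique m)

  private
    length-cart : ∀ {X Y Z : Set} (f : X → Y → Z) xs ys → length (cartesianProductWith f xs ys) ≡ length xs * length ys
    length-cart f []       ys = refl
    length-cart f (x ∷ xs) ys = trans (length-++ (mapL (f x) ys)) (cong₂ _+_ (length-map (f x) ys) (length-cart f xs ys))

  length-allVec : ∀ m → length (allVec m) ≡ q ^ m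
  length-allVec zero    = refl
  length-allVec (suc m) = trans (length-cart _∷_ (allFin q) (allVec m)) (cong₂ _*_ (length-tabulate {n = q} (λ i → i)) (length-allVec m))

  infix 4 _≟V_
  _≟V_ : ∀ {m} (u v : Vec K m) → Dec (u ≡ v)
  _≟V_ = Vec.≡-dec Fin._≟_

  -- Exhaustive search over the finitely many vectors. Together with `∀V?` it decides inclusion and
  -- equality of subspaces, so the classical case distinctions are available.
  ∃V? : ∀ {m} {P : Vec K m → Set} → Decidable P → Dec (∃ P)
  ∃V? {m} P? = map′ (λ a → let v , _ , p = find∈ a in v , p) (λ (v , p) → lose (allVec-complete v) p) (Any.any? P? (allVec m))

  ∀V? : ∀ {m} {P : Vec K m → Set} → Decidable P → Dec (∀ v → P v)
  ∀V? {m} P? = map′ (λ a v → All.lookup a (allVec-complete v)) (λ f → All.universal f (allVec m)) (All.all? P? (allVec m))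

  allV : List V
  allV = allVec n

  infix 4 _∈ˢ_ _∉ˢ_ _∈ˢ?_ _⊆ˢ_ _⊆ˢ?_
  _∈ˢ_ _∉ˢ_ : V → Subspace → Set
  v ∈ˢ W = mem W v ≡ true
  v ∉ˢ W = ¬ (v ∈ˢ W)

  _∈ˢ?_ : ∀ v W → Dec (v ∈ˢ W)
  v ∈ˢ? W = mem W v Bool.≟ true

  -- A record, so that unification can recover A and B from a proof of inclusion.
  record _⊆ˢ_ (A B : Subspace) : Set where
    constructor sub
    field on : mem A ⊆ mem B
  open _⊆ˢ_ public

  abstract
    _⊆ˢ?_ : ∀ A B → Dec (A ⊆ˢ B)
    A ⊆ˢ? B = map′ sub on (∀V? λ v → (v ∈ˢ? A) →-dec (v ∈ˢ? B))

    _≐?_ : ∀ A B → Dec (A ≐ B)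
    A ≐? B = ∀V? λ v → mem A v Bool.≟ mem B v

  ⊆-refl : ∀ {A} → A ⊆ˢ A
  ⊆-refl = sub λ v p → p

  ⊆-trans : ∀ {A B C} → A ⊆ˢ B → B ⊆ˢ C → A ⊆ˢ C
  ⊆-trans f g = sub λ v p → g .on v (f .on v p)

  ⊆-antisym : ∀ {A B} → A ⊆ˢ B → B ⊆ˢ A → A ≐ B
  ⊆-antisym {A} {B} f g v with mem A v in a | mem B v in b
  ... | true  | true  = refl
  ... | false | false = refl
  ... | true  | false = contradiction (trans (sym b) (f .on v a)) λ ()
  ... | false | true  = contradiction (trans (sym a) (g .on v b)) λ ()

  ≐⇒⊆ : ∀ A B → A ≐ B → A ⊆ˢ B
  ≐⇒⊆ A B e = sub λ v p → trans (sym (e v)) p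

  ≐⇒⊇ : ∀ A B → A ≐ B → B ⊆ˢ A
  ≐⇒⊇ A B e = sub λ v p → trans (e v) p

  ⊈⇒∃ : ∀ {A B} → ¬ (A ⊆ˢ B) → ∃ λ v → v ∈ˢ A × v ∉ˢ B
  ⊈⇒∃ {A} {B} A⊈B with ∃V? (λ v → (v ∈ˢ? A) ×-dec ¬? (v ∈ˢ? B))
  ... | yes r = r
  ... | no ¬r = contradiction (sub dec-stable) A⊈B
    where dec-stable : ∀ v → v ∈ˢ A → v ∈ˢ B
          dec-stable v a with v ∈ˢ? B
          ... | yes b = b
          ... | no ¬b = contradiction (v , a , ¬b) ¬r

  mkSub : (P : V → Set) → Decidable P → P 0V → (∀ u v → P u → P v → P (u ⊕ v)) → (∀ c v → P v → P (c · v)) → Subspace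
  mkSub P P? z p s = record
    { mem = λ v → does (P? v)
    ; zero∈ = dec-true (P? _) z
    ; plus∈ = λ u v a b → dec-true (P? _) (p u v (does-true (P? u) a) (does-true (P? v) b))
    ; scale∈ = λ c v a → dec-true (P? _) (s c v (does-true (P? v) a)) }

  infixl 7 _⊓_
  infixl 6 _⊞_

  ∧-intro : ∀ {a b} → a ≡ true → b ≡ true → a ∧ b ≡ true
  ∧-intro refl refl = refl

  ∧-elim : ∀ {a b} → a ∧ b ≡ true → a ≡ true × b ≡ true
  ∧-elim {true} {true} _ = refl , refl

  abstract
    _⊓_ : Subspace → Subspace → Subspace
    A ⊓ B = record
      { mem = mem A ∩ mem B
      ; zero∈ = ∧-intro (zero∈ A) (zero∈ B)
      ; plus∈ = λ u v a b → let a₁ , a₂ = ∧-elim a ; b₁ , b₂ = ∧-elim b in ∧-intro (plus∈ A u v a₁ b₁) (plus∈ B u v a₂ b₂)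
      ; scale∈ = λ c v a → let a₁ , a₂ = ∧-elim a in ∧-intro (scale∈ A c v a₁) (scale∈ B c v a₂) }

    mem-⊓ : ∀ A B → mem (A ⊓ B) ≡ mem A ∩ mem B
    mem-⊓ A B = refl

    ∈⊓-intro : ∀ {A B v} → v ∈ˢ A → v ∈ˢ B → v ∈ˢ A ⊓ B
    ∈⊓-intro = ∧-intro

    ∈⊓-elim : ∀ {A B v} → v ∈ˢ A ⊓ B → v ∈ˢ A × v ∈ˢ B
    ∈⊓-elim = ∧-elim

  ∩-⊆ˡ : ∀ {A B} → A ⊓ B ⊆ˢ A
  ∩-⊆ˡ {A} {B} = sub λ v p → proj₁ (∈⊓-elim {A} {B} p)

  ∩-⊆ʳ : ∀ {A B} → A ⊓ B ⊆ˢ B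
  ∩-⊆ʳ {A} {B} = sub λ v p → proj₂ (∈⊓-elim {A} {B} p)

  ∩-greatest : ∀ {A B C} → C ⊆ˢ A → C ⊆ˢ B → C ⊆ˢ A ⊓ B
  ∩-greatest {A} {B} f g = sub λ v p → ∈⊓-intro {A} {B} (f .on v p) (g .on v p)

  ∩-mono : ∀ {A B C D} → A ⊆ˢ C → B ⊆ˢ D → A ⊓ B ⊆ˢ C ⊓ D
  ∩-mono f g = ∩-greatest (⊆-trans ∩-⊆ˡ f) (⊆-trans ∩-⊆ʳ g)

  ∩-comm : ∀ A B → A ⊓ B ⊆ˢ B ⊓ A
  ∩-comm A B = ∩-greatest ∩-⊆ʳ ∩-⊆ˡ

  neg∈ : ∀ {A v} → v ∈ˢ A → neg v ∈ˢ A
  neg∈ {A} {v} p = scale∈ A (-F 1F) v p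

  ⊖∈ : ∀ {A u v} → u ∈ˢ A → v ∈ˢ A → u ⊖ v ∈ˢ A
  ⊖∈ {A} {u} {v} a b = plus∈ A u (neg v) a (neg∈ {A} b)

  abstract
    -- Only the first summand is searched for; the second is then `v ⊖ a`.
    _⊞_ : Subspace → Subspace → Subspace
    A ⊞ B = mkSub (λ v → ∃ λ a → a ∈ˢ A × v ⊖ a ∈ˢ B) (λ v → ∃V? λ a → (a ∈ˢ? A) ×-dec (v ⊖ a ∈ˢ? B))
      (0V , zero∈ A , subst (_∈ˢ B) (sym (⊖-self 0V)) (zero∈ B))
      (λ u v (a , a∈ , ua∈) (b , b∈ , vb∈) → a ⊕ b , plus∈ A a b a∈ b∈ ,
         subst (_∈ˢ B) (trans (swap-⊕ u (neg a) v (neg b)) (cong ((u ⊕ v) ⊕_) (neg-⊕ a b))) (plus∈ B _ _ ua∈ vb∈))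
      (λ c v (a , a∈ , va∈) → c · a , scale∈ A c a a∈ ,
         subst (_∈ˢ B) (trans (·-distribˡ c v (neg a)) (cong ((c · v) ⊕_) (lem c a))) (scale∈ B c _ va∈))
      where
      lem : ∀ c a → c · neg a ≡ neg (c · a)
      lem c a = trans (sym (·-assoc c (-F 1F) a)) (trans (cong (_· a) (F.*-comm c (-F 1F))) (·-assoc (-F 1F) c a))

    ⊞-intro : ∀ {A B u v} → u ∈ˢ A → v ∈ˢ B → u ⊕ v ∈ˢ A ⊞ B
    ⊞-intro {A} {B} {u} {v} a b = dec-true (∃V? _) (u , a , subst (_∈ˢ B) (sym (trans (cong (_⊖ u) (⊕-comm u v)) (⊕-⊖ v u))) b)

    ⊞-elim : ∀ {A B v} → v ∈ˢ A ⊞ B → ∃ λ a → a ∈ˢ A × v ⊖ a ∈ˢ B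
    ⊞-elim p = does-true (∃V? _) p

  ⊞-⊆ˡ : ∀ {A B} → A ⊆ˢ A ⊞ B
  ⊞-⊆ˡ {A} {B} = sub λ v p → subst (_∈ˢ A ⊞ B) (⊕-identityʳ v) (⊞-intro {A} {B} p (zero∈ B))

  ⊞-⊆ʳ : ∀ {A B} → B ⊆ˢ A ⊞ B
  ⊞-⊆ʳ {A} {B} = sub λ v p → subst (_∈ˢ A ⊞ B) (⊕-identityˡ v) (⊞-intro {A} {B} (zero∈ A) p)

  ⊞-least : ∀ {A B C} → A ⊆ˢ C → B ⊆ˢ C → A ⊞ B ⊆ˢ C
  ⊞-least {A} {B} {C} f g = sub λ v p → let a , a∈ , b∈ = ⊞-elim {A} {B} p in
    subst (_∈ˢ C) (trans (⊕-comm a (v ⊖ a)) (⊖-⊕ v a)) (plus∈ C a (v ⊖ a) (f .on a a∈) (g .on _ b∈))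

  card : Subspace → ℕ
  card A = ∑ allV λ v → ι (v ∈ˢ? A)

  card-mono : ∀ {A B} → A ⊆ˢ B → card A ≤ card B
  card-mono {A} {B} f = ∑-mono allV λ v → ι-mono (v ∈ˢ? A) (v ∈ˢ? B) (f .on v)

  card-split : ∀ {A B} → A ⊆ˢ B → card B ≡ card A + ∑ allV (λ v → ι ((v ∈ˢ? B) ×-dec ¬? (v ∈ˢ? A)))
  card-split {A} {B} f = trans (∑-cong allV pt) (∑-+ allV _ _)
    where
    pt : ∀ v → ι (v ∈ˢ? B) ≡ ι (v ∈ˢ? A) + ι ((v ∈ˢ? B) ×-dec ¬? (v ∈ˢ? A))
    pt v with v ∈ˢ? A | v ∈ˢ? B
    ... | yes a | yes b = refl
    ... | no ¬a | yes b = refl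
    ... | no ¬a | no ¬b = refl
    ... | yes a | no ¬b = contradiction (f .on v a) ¬b

  card-strict : ∀ {A B} v → A ⊆ˢ B → v ∈ˢ B → v ∉ˢ A → card A < card B
  card-strict {A} {B} v f b ¬a = subst (card A <_) (sym (card-split {A} {B} f)) (m<m+n (card A)
    (∑-≥ allV (λ v → ι ((v ∈ˢ? B) ×-dec ¬? (v ∈ˢ? A))) (lose (allVec-complete v) (≤-reflexive (sym (ι-yes ((v ∈ˢ? B) ×-dec ¬? (v ∈ˢ? A)) (b , ¬a)))))))

  card≤q^n : ∀ A → card A ≤ q ^ n
  card≤q^n A = ≤-trans (∑-mono allV (λ v → ι≤1 (v ∈ˢ? A))) (≤-reflexive (trans (∑-1 allV) (length-allVec n)))

  module Coeff (d : ℕ) = VectorLaws 𝔽 d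

  lincomb-⊕ : ∀ {d} (cs ds : Vec K d) bs → lincomb (zipWith _+F_ cs ds) bs ≡ lincomb cs bs ⊕ lincomb ds bs
  lincomb-⊕ []       []       []       = sym (⊕-identityˡ 0V)
  lincomb-⊕ (c ∷ cs) (d ∷ ds) (b ∷ bs) = trans (cong₂ _⊕_ (·-distribʳ c d b) (lincomb-⊕ cs ds bs)) (swap-⊕ _ _ _ _)

  lincomb-· : ∀ {d} c (cs : Vec K d) bs → lincomb (map (c *F_) cs) bs ≡ c · lincomb cs bs
  lincomb-· c []       []       = sym (·-zeroV c)
  lincomb-· c (d ∷ cs) (b ∷ bs) = trans (cong₂ _⊕_ (·-assoc c d b) (lincomb-· c cs bs)) (sym (·-distribˡ c _ _))

  lincomb-injective : ∀ {d} {bs : Vec V d} → LinIndep bs → ∀ cs ds → lincomb cs bs ≡ lincomb ds bs → cs ≡ ds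
  lincomb-injective {d} {bs} ind cs ds e = Coeff.⊖-zero⇒≡ d cs ds (ind _ (begin
    lincomb (zipWith _+F_ cs (map ((-F 1F) *F_) ds)) bs  ≡⟨ lincomb-⊕ cs _ bs ⟩
    lincomb cs bs ⊕ lincomb (map ((-F 1F) *F_) ds) bs  ≡⟨ cong₂ _⊕_ e (lincomb-· (-F 1F) ds bs) ⟩
    lincomb ds bs ⊖ lincomb ds bs  ≡⟨ ⊖-self _ ⟩
    0V  ∎))
    where open ≡-Reasoning

  lincomb∈ : ∀ {d} W (cs : Vec K d) {bs} → VAll.All (_∈ˢ W) bs → lincomb cs bs ∈ˢ W
  lincomb∈ W []       VAll.[]          = zero∈ W
  lincomb∈ W (c ∷ cs) (b∈ VAll.∷ bs∈) = plus∈ W _ _ (scale∈ W c _ b∈) (lincomb∈ W cs bs∈)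

  -- In a relation a nonzero coefficient of `w` could be inverted, which would put `w` into the
  -- span.
  LinIndep-∷ : ∀ {d} {w} {bs : Vec V d} → LinIndep bs → (¬ ∃ λ cs → lincomb cs bs ≡ w) → LinIndep (w ∷ bs)
  LinIndep-∷ {d} {w} {bs} ind ¬span (c ∷ cs) e with c Fin.≟ 0F
  ... | yes refl = cong (0F ∷_) (ind cs (trans (sym (⊕-identityˡ _)) (trans (cong (_⊕ lincomb cs bs) (sym (·-zero w))) e)))
  ... | no c≢0 = contradiction (map (d′ *F_) (map ((-F 1F) *F_) cs) , (begin
    lincomb (map (d′ *F_) (map ((-F 1F) *F_) cs)) bs ≡⟨ lincomb-· d′ (map ((-F 1F) *F_) cs) bs ⟩
    d′ · lincomb (map ((-F 1F) *F_) cs) bs  ≡⟨ cong (d′ ·_) (lincomb-· (-F 1F) cs bs) ⟩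
    d′ · neg (lincomb cs bs)  ≡⟨ cong (d′ ·_) (sym cw≡) ⟩
    d′ · (c · w)  ≡⟨ ·-assoc d′ c w ⟨
    (d′ *F c) · w  ≡⟨ cong (_· w) (trans (F.*-comm d′ c) cd) ⟩
    1F · w  ≡⟨ ·-identity w ⟩
    w  ∎)) ¬span
    where
    open ≡-Reasoning
    d′ = proj₁ (inverse c c≢0)
    cd : c *F d′ ≡ 1F
    cd = proj₂ (inverse c c≢0)
    cw≡ : c · w ≡ neg (lincomb cs bs)
    cw≡ = ⊖-zero⇒≡ (c · w) (neg (lincomb cs bs)) (trans (cong ((c · w) ⊕_) (neg-involutive (lincomb cs bs))) e)

  LinIndep-tail : ∀ {d} {w} {bs : Vec V d} → LinIndep (w ∷ bs) → LinIndep bs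
  LinIndep-tail {d} {w} {bs} ind cs e = proj₂ (∷-injective (ind (0F ∷ cs) (trans (cong₂ _⊕_ (·-zero w) e) (⊕-identityˡ 0V))))

  DimGE-suc⁻ : ∀ {S d} → DimGE S (suc d) → DimGE S d
  DimGE-suc⁻ (b ∷ bs , _ VAll.∷ bs∈ , ind) = bs , bs∈ , LinIndep-tail ind

  DimGE⇒≤card : ∀ {W d} → DimGE (mem W) d → q ^ d ≤ card W
  DimGE⇒≤card {W} {d} (bs , bs∈ , ind) = ≤-trans (≤-reflexive (sym (trans (∑-1 (allVec d)) (length-allVec d))))
    (∑-transfer (allVec d) allV (λ _ → 1) (λ v → ι (v ∈ˢ? W)) (λ cs v → ι (lincomb cs bs ≟V v))
      (All.universal (λ cs → ∑-≥ allV (λ v → ι (lincomb cs bs ≟V v) * ι (v ∈ˢ? W)) (lose (allVec-complete (lincomb cs bs)) (≤-reflexive (sym (cong₂ _*_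
         (ι-yes (lincomb cs bs ≟V lincomb cs bs) refl) (ι-yes (lincomb cs bs ∈ˢ? W) (lincomb∈ W cs bs∈))))))) (allVec d))
      (λ v → at-most-once (λ cs → lincomb cs bs ≟V v) (λ e e′ → lincomb-injective ind _ _ (trans e (sym e′))) (allVec-unique d)))

  span⇒card≤ : ∀ {W d} (bs : Vec V d) → (∀ w → w ∈ˢ W → ∃ λ cs → lincomb cs bs ≡ w) → card W ≤ q ^ d
  span⇒card≤ {W} {d} bs f = ≤-trans
    (∑-transfer allV (allVec d) (λ v → ι (v ∈ˢ? W)) (λ _ → 1) (λ v cs → ι (lincomb cs bs ≟V v)) (All.universal cov allV)
      (λ cs → at-most-once (λ v → lincomb cs bs ≟V v) (λ e e′ → trans (sym e) e′) (allVec-unique n)))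
    (≤-reflexive (trans (∑-1 (allVec d)) (length-allVec d)))
    where
    cov : ∀ v → ι (v ∈ˢ? W) ≤ ∑ (allVec d) (λ cs → ι (lincomb cs bs ≟V v) * 1)
    cov v with v ∈ˢ? W
    ... | no _ = z≤n
    ... | yes v∈ = let cs , e = f v v∈ in
      ∑-≥ (allVec d) (λ cs → ι (lincomb cs bs ≟V v) * 1) (lose (allVec-complete cs) (≤-reflexive (sym (cong (_* 1) (ι-yes (lincomb cs bs ≟V v) e)))))

  private
    -- Greedy extension of an independent family. The fuel suffices because `d` independent vectors
    -- have `q ^ d` distinct combinations among `q ^ n` vectors. Once no vector outside the span is
    -- left, the bounds on `card W` from independence and from spanning agree.
    grow : ∀ W fuel d → n < d + fuel → DimGE (mem W) d → ∃ λ d → DimGE (mem W) d × card W ≡ q ^ d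
    grow W zero d n<d D = contradiction (≤-trans (DimGE⇒≤card {W} D) (card≤q^n W))
                                        (<⇒≱ (^-monoʳ-< q 2≤q (subst (n <_) (+-identityʳ d) n<d)))
    grow W (suc fuel) d n<d D@(bs , bs∈ , ind)
      with ∃V? (λ w → (w ∈ˢ? W) ×-dec ¬? (∃V? λ cs → lincomb cs bs ≟V w))
    ... | yes (w , w∈ , ¬span) = grow W fuel (suc d) (subst (n <_) (+-suc d fuel) n<d) (w ∷ bs , w∈ VAll.∷ bs∈ , LinIndep-∷ ind ¬span)
    ... | no ¬∃ = d , D , ≤-antisym (span⇒card≤ {W} bs spans) (DimGE⇒≤card {W} D)
      where spans : ∀ w → w ∈ˢ W → ∃ λ cs → lincomb cs bs ≡ w
            spans w w∈ with ∃V? (λ cs → lincomb cs bs ≟V w)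
            ... | yes s = s
            ... | no ¬s = contradiction (w , w∈ , ¬s) ¬∃

    dimension : ∀ W → ∃ λ d → DimGE (mem W) d × card W ≡ q ^ d
    dimension W = grow W (suc n) 0 (n<1+n n) ([] , VAll.[] , λ { [] _ → refl })

  abstract
    -- Used mainly through `card W ≡ q ^ dim W`: monotonicity, strictness and the modular law are
    -- read off from cardinalities, without choosing compatible bases.
    dim : Subspace → ℕ
    dim W = proj₁ (dimension W)

    card≡ : ∀ W → card W ≡ q ^ dim W
    card≡ W = proj₂ (proj₂ (dimension W))

    basis : ∀ W → DimGE (mem W) (dim W)
    basis W = proj₁ (proj₂ (dimension W))

  DimGE⇒≤dim : ∀ {W d} → DimGE (mem W) d → d ≤ dim W
  DimGE⇒≤dim {W} D = q^-cancel-≤ (≤-trans (DimGE⇒≤card {W} D) (≤-reflexive (card≡ W)))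

  private
    drop-DimGE : ∀ {S} i {d} → DimGE S (i + d) → DimGE S d
    drop-DimGE zero    D = D
    drop-DimGE (suc i) D = drop-DimGE i (DimGE-suc⁻ D)

  ≤dim⇒DimGE : ∀ {W d} → d ≤ dim W → DimGE (mem W) d
  ≤dim⇒DimGE {W} {d} d≤ = drop-DimGE (dim W ∸ d) (subst (DimGE (mem W)) (sym (m∸n+n≡m d≤)) (basis W))

  HasDim⇒dim : ∀ {W d} → HasDim (mem W) d → dim W ≡ d
  HasDim⇒dim {W} (D , ¬D) = ≤-antisym (≮⇒≥ λ l → ¬D (≤dim⇒DimGE {W} l)) (DimGE⇒≤dim {W} D)

  dim⇒HasDim : ∀ {W d} → dim W ≡ d → HasDim (mem W) d
  dim⇒HasDim {W} refl = basis W , λ D → <-irrefl refl (DimGE⇒≤dim {W} D)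

  dim-mono : ∀ {A B} → A ⊆ˢ B → dim A ≤ dim B
  dim-mono {A} {B} f = q^-cancel-≤ (≤-trans (≤-reflexive (sym (card≡ A))) (≤-trans (card-mono {A} {B} f) (≤-reflexive (card≡ B))))

  dim-strict : ∀ {A B} v → A ⊆ˢ B → v ∈ˢ B → v ∉ˢ A → dim A < dim B
  dim-strict {A} {B} v f b ¬a = ≰⇒> λ B≤A → <⇒≱ (card-strict {A} {B} v f b ¬a)
    (≤-trans (≤-reflexive (card≡ B)) (≤-trans (^-monoʳ-≤ q B≤A) (≤-reflexive (sym (card≡ A)))))

  ⊆-dim⇒⊇ : ∀ {A B} → A ⊆ˢ B → dim B ≤ dim A → B ⊆ˢ A
  ⊆-dim⇒⊇ {A} {B} f le with B ⊆ˢ? A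
  ... | yes g = g
  ... | no ¬g = let v , b , ¬a = ⊈⇒∃ ¬g in contradiction le (<⇒≱ (dim-strict v f b ¬a))

  dim-≐ : ∀ A B → A ≐ B → dim A ≡ dim B
  dim-≐ A B e = ≤-antisym (dim-mono (≐⇒⊆ A B e)) (dim-mono (≐⇒⊇ A B e))

  ∑V-translate≤ : ∀ a (f : V → ℕ) → ∑ allV (λ v → f (v ⊕ a)) ≤ ∑ allV f
  ∑V-translate≤ a f = ∑-transfer allV allV (λ v → f (v ⊕ a)) f (λ v w → ι (v ⊕ a ≟V w))
    (All.universal (λ v → ∑-≥ allV (λ w → ι (v ⊕ a ≟V w) * f w) (lose (allVec-complete (v ⊕ a)) (≤-reflexive (sym (trans (cong (_* f (v ⊕ a)) (ι-yes (v ⊕ a ≟V v ⊕ a) refl)) (*-identityˡ _)))))) allV)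
    (λ w → at-most-once (λ v → v ⊕ a ≟V w) (λ {x} {y} e e′ → trans (sym (⊕-⊖ x a)) (trans (cong (_⊖ a) (trans e (sym e′))) (⊕-⊖ y a))) (allVec-unique n))

  ∑V-translate : ∀ a (f : V → ℕ) → ∑ allV (λ v → f (v ⊕ a)) ≡ ∑ allV f
  ∑V-translate a f = ≤-antisym (∑V-translate≤ a f)
    (≤-trans (≤-reflexive (∑-cong allV λ v → cong f (sym (⊖-⊕ v a)))) (∑V-translate≤ (neg a) (λ v → f (v ⊕ a))))

  -- Both sides count pairs `(v , a)` with `a` in `A` and `v ⊖ a` in `B`. For fixed `v` in the sum
  -- the possible `a` form a translate of `A ⊓ B`; for fixed `a` the possible `v` form a translate
  -- of `B`.
  card-modular : ∀ A B → card (A ⊞ B) * card (A ⊓ B) ≡ card A * card B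
  card-modular A B = begin
    card (A ⊞ B) * card (A ⊓ B)  ≡⟨ ∑-*ʳ allV _ (card (A ⊓ B)) ⟨
    ∑ allV (λ v → ι (v ∈ˢ? A ⊞ B) * card (A ⊓ B))  ≡⟨ ∑-cong allV fibre ⟩
    ∑ allV (λ v → ∑ allV (λ a → ι (a ∈ˢ? A) * ι (v ⊖ a ∈ˢ? B)))  ≡⟨ ∑-swap allV allV _ ⟩
    ∑ allV (λ a → ∑ allV (λ v → ι (a ∈ˢ? A) * ι (v ⊖ a ∈ˢ? B)))  ≡⟨ ∑-cong allV (λ a → trans (∑-*ˡ allV (ι (a ∈ˢ? A)) _)
                                                                     (cong (ι (a ∈ˢ? A) *_) (∑V-translate (neg a) (λ v → ι (v ∈ˢ? B))))) ⟩
    ∑ allV (λ a → ι (a ∈ˢ? A) * card B)  ≡⟨ ∑-*ʳ allV _ (card B) ⟩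
    card A * card B  ∎
    where
    open ≡-Reasoning
    fibre : ∀ v → ι (v ∈ˢ? A ⊞ B) * card (A ⊓ B) ≡ ∑ allV (λ a → ι (a ∈ˢ? A) * ι (v ⊖ a ∈ˢ? B))
    fibre v with v ∈ˢ? A ⊞ B
    ... | no v∉ = sym (trans (∑-cong allV λ a → trans (sym (ι-× (a ∈ˢ? A) (v ⊖ a ∈ˢ? B))) (ι-no ((a ∈ˢ? A) ×-dec (v ⊖ a ∈ˢ? B)) (λ (a∈ , b∈) → v∉
        (subst (_∈ˢ A ⊞ B) (trans (⊕-comm a (v ⊖ a)) (⊖-⊕ v a)) (⊞-intro {A} {B} a∈ b∈)))))
        (trans (∑-const allV 0) (*-zeroʳ (length allV))))
    ... | yes v∈ = trans (+-identityʳ _) (trans (∑-cong allV pt) (∑V-translate a₀ (λ a → ι (a ∈ˢ? A) * ι (v ⊖ a ∈ˢ? B))))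
      where
      a₀ = proj₁ (⊞-elim {A} {B} v∈)
      a₀∈ : a₀ ∈ˢ A
      a₀∈ = proj₁ (proj₂ (⊞-elim {A} {B} v∈))
      b₀∈ : v ⊖ a₀ ∈ˢ B
      b₀∈ = proj₂ (proj₂ (⊞-elim {A} {B} v∈))
      rearr : ∀ x → v ⊖ (x ⊕ a₀) ≡ (v ⊖ a₀) ⊖ x
      rearr x = trans (cong (v ⊕_) (trans (sym (neg-⊕ x a₀)) (⊕-comm (neg x) (neg a₀)))) (sym (⊕-assoc v (neg a₀) (neg x)))
      undo : ∀ x → (v ⊖ a₀) ⊖ ((v ⊖ a₀) ⊖ x) ≡ x
      undo x = trans (cong ((v ⊖ a₀) ⊕_) (trans (sym (neg-⊕ (v ⊖ a₀) (neg x))) (cong (neg (v ⊖ a₀) ⊕_) (neg-involutive x))))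
        (trans (sym (⊕-assoc _ _ x)) (trans (cong (_⊕ x) (⊖-self (v ⊖ a₀))) (⊕-identityˡ x)))
      pt : ∀ x → ι (x ∈ˢ? A ⊓ B) ≡ ι (x ⊕ a₀ ∈ˢ? A) * ι (v ⊖ (x ⊕ a₀) ∈ˢ? B)
      pt x = trans (ι-⇔ (x ∈ˢ? A ⊓ B) ((x ⊕ a₀ ∈ˢ? A) ×-dec (v ⊖ (x ⊕ a₀) ∈ˢ? B))
        (λ p → let xa , xb = ∈⊓-elim {A} {B} p in plus∈ A x a₀ xa a₀∈ , subst (_∈ˢ B) (sym (rearr x)) (⊖∈ {B} b₀∈ xb))
        (λ (p , r) → ∈⊓-intro {A} {B} (subst (_∈ˢ A) (⊕-⊖ x a₀) (⊖∈ {A} p a₀∈)) (subst (_∈ˢ B) (undo x) (⊖∈ {B} b₀∈ (subst (_∈ˢ B) (rearr x) r)))))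
        (ι-× (x ⊕ a₀ ∈ˢ? A) (v ⊖ (x ⊕ a₀) ∈ˢ? B))

  dim-modular : ∀ A B → dim (A ⊞ B) + dim (A ⊓ B) ≡ dim A + dim B
  dim-modular A B = q^-injective (begin
    q ^ (dim (A ⊞ B) + dim (A ⊓ B))  ≡⟨ ^-distribˡ-+-* q (dim (A ⊞ B)) _ ⟩
    q ^ dim (A ⊞ B) * q ^ dim (A ⊓ B)  ≡⟨ cong₂ _*_ (card≡ (A ⊞ B)) (card≡ (A ⊓ B)) ⟨
    card (A ⊞ B) * card (A ⊓ B)  ≡⟨ card-modular A B ⟩
    card A * card B  ≡⟨ cong₂ _*_ (card≡ A) (card≡ B) ⟩
    q ^ dim A * q ^ dim B  ≡⟨ ^-distribˡ-+-* q (dim A) _ ⟨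
    q ^ (dim A + dim B)  ∎)
    where open ≡-Reasoning

  0ˢ : Subspace
  0ˢ = mkSub (_≡ 0V) (_≟V 0V) refl (λ { _ _ refl refl → ⊕-identityˡ 0V }) (λ { c _ refl → ·-zeroV c })

  0ˢ⊆ : ∀ {W} → 0ˢ ⊆ˢ W
  0ˢ⊆ {W} = sub λ v p → subst (_∈ˢ W) (sym (does-true (v ≟V 0V) p)) (zero∈ W)

  dim-0ˢ : dim 0ˢ ≡ 0
  dim-0ˢ = n≤0⇒n≡0 (q^-cancel-≤ (≤-trans (≤-reflexive (sym (card≡ 0ˢ)))
    (span⇒card≤ {0ˢ} [] (λ w w∈ → [] , sym (does-true (w ≟V 0V) w∈)))))

  dim-0ˢ≤ : ∀ {m} → dim 0ˢ ≤ m
  dim-0ˢ≤ = ≤-trans (≤-reflexive dim-0ˢ) z≤n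

  1ˢ : Subspace
  1ˢ = record { mem = λ _ → true ; zero∈ = refl ; plus∈ = λ _ _ _ _ → refl ; scale∈ = λ _ _ _ → refl }

  ⊆1ˢ : ∀ {W} → W ⊆ˢ 1ˢ
  ⊆1ˢ = sub λ v _ → refl

  dim-1ˢ : dim 1ˢ ≡ n
  dim-1ˢ = q^-injective (trans (sym (card≡ 1ˢ)) (trans (∑-1 allV) (length-allVec n)))

  abstract
    ⟨_⟩ : V → Subspace
    ⟨ v ⟩ = mkSub (λ w → ∃ λ c → c · v ≡ w) (λ w → Fin.any? λ c → c · v ≟V w)
      (0F , ·-zero v)
      (λ { _ _ (c , refl) (d , refl) → c +F d , ·-distribʳ c d v })
      (λ { c _ (d , refl) → c *F d , ·-assoc c d v })

    ∈⟨⟩ : ∀ v → v ∈ˢ ⟨ v ⟩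
    ∈⟨⟩ v = dec-true (Fin.any? _) (1F , ·-identity v)

    ⟨⟩-elim : ∀ {v w} → w ∈ˢ ⟨ v ⟩ → ∃ λ c → c · v ≡ w
    ⟨⟩-elim {v} {w} p = does-true (Fin.any? λ c → c · v ≟V w) p

  ⟨⟩⊆ : ∀ {v W} → v ∈ˢ W → ⟨ v ⟩ ⊆ˢ W
  ⟨⟩⊆ {v} {W} v∈ = sub λ w p → let c , e = ⟨⟩-elim p in subst (_∈ˢ W) e (scale∈ W c v v∈)

  dim-⟨⟩≤1 : ∀ v → dim ⟨ v ⟩ ≤ 1
  dim-⟨⟩≤1 v = q^-cancel-≤ (≤-trans (≤-reflexive (sym (card≡ ⟨ v ⟩)))
    (span⇒card≤ {⟨ v ⟩} (v ∷ []) (λ w p → let c , e = ⟨⟩-elim p in c ∷ [] , trans (⊕-identityʳ (c · v)) e)))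

  infixl 6 _+ᵛ_
  _+ᵛ_ : Subspace → V → Subspace
  S +ᵛ v = S ⊞ ⟨ v ⟩

  ⊆+ᵛ : ∀ {S v} → S ⊆ˢ S +ᵛ v
  ⊆+ᵛ {S} {v} = ⊞-⊆ˡ {S} {⟨ v ⟩}

  ∈+ᵛ : ∀ {S v} → v ∈ˢ S +ᵛ v
  ∈+ᵛ {S} {v} = ⊞-⊆ʳ {S} {⟨ v ⟩} .on v (∈⟨⟩ v)

  +ᵛ-least : ∀ {S v W} → S ⊆ˢ W → v ∈ˢ W → S +ᵛ v ⊆ˢ W
  +ᵛ-least {S} {v} {W} f v∈ = ⊞-least {S} {⟨ v ⟩} {W} f (⟨⟩⊆ {v} {W} v∈)

  dim-+ᵛ≤ : ∀ S v → dim (S +ᵛ v) ≤ suc (dim S)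
  dim-+ᵛ≤ S v = begin
    dim (S +ᵛ v)  ≤⟨ m≤m+n _ _ ⟩
    dim (S +ᵛ v) + dim (S ⊓ ⟨ v ⟩)  ≡⟨ dim-modular S ⟨ v ⟩ ⟩
    dim S + dim ⟨ v ⟩  ≤⟨ +-monoʳ-≤ (dim S) (dim-⟨⟩≤1 v) ⟩
    dim S + 1  ≡⟨ +-comm (dim S) 1 ⟩
    suc (dim S)  ∎
    where open ≤-Reasoning

  dim-+ᵛ : ∀ {S v} → v ∉ˢ S → dim (S +ᵛ v) ≡ suc (dim S)
  dim-+ᵛ {S} {v} v∉ = ≤-antisym (dim-+ᵛ≤ S v) (dim-strict {S} {S +ᵛ v} v (⊆+ᵛ {S}) (∈+ᵛ {S}) v∉)

-- Counting the subspaces through and between given subspaces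

module SubspaceCounting {q : ℕ} (𝔽 : FiniteField q) (n : ℕ) where
  open LinearAlgebra 𝔽 n public

  span : ∀ {d} → Vec V d → Subspace
  span []       = 0ˢ
  span (b ∷ bs) = span bs +ᵛ b

  span-least : ∀ {d W} {bs : Vec V d} → VAll.All (_∈ˢ W) bs → span bs ⊆ˢ W
  span-least VAll.[]         = 0ˢ⊆
  span-least (b∈ VAll.∷ bs∈) = +ᵛ-least (span-least bs∈) b∈

  span-contains : ∀ {d} (bs : Vec V d) → VAll.All (_∈ˢ span bs) bs
  span-contains []       = VAll.[]
  span-contains (b ∷ bs) = ∈+ᵛ VAll.∷ VAll.map (λ {v} p → ⊆+ᵛ {span bs} .on v p) (span-contains bs)

  span-surjective : ∀ W → ∃ λ (bs : Vec V (dim W)) → W ≐ span bs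
  span-surjective W = let bs , bs∈ , ind = basis W ; span⊆W = span-least bs∈ in
    bs , ⊆-antisym (⊆-dim⇒⊇ span⊆W (DimGE⇒≤dim {span bs} (bs , span-contains bs , ind))) span⊆W

  ≐-refl : ∀ A → A ≐ A
  ≐-refl A v = refl

  ≐-sym : ∀ {A B} → A ≐ B → B ≐ A
  ≐-sym e v = sym (e v)

  Distinct : List Subspace → Set
  Distinct = AllPairs λ A B → ¬ (A ≐ B)

  private
    candidates : ℕ → List Subspace
    candidates m = filter (λ W → dim W ≟ m) (mapL span (vecs allV m))

  abstract
    subs : ℕ → List Subspace
    subs m = deduplicate _≐?_ (candidates m)

    subs-dim : ∀ m → All (λ W → dim W ≡ m) (subs m)
    subs-dim m = AllP.deduplicate⁺ _≐?_ (AllP.all-filter (λ W → dim W ≟ m) (mapL span (vecs allV m)))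

    subs-distinct : ∀ m → Distinct (subs m)
    subs-distinct m = go (candidates m)
      where go : ∀ xs → Distinct (deduplicate _≐?_ xs)
            go []       = []
            go (x ∷ xs) = AllP.all-filter _ (deduplicate _≐?_ xs) ∷ AllPairsP.filter⁺ _ (go xs)

    subs-complete : ∀ W → Any (W ≐_) (subs (dim W))
    subs-complete W = let bs , e = span-surjective W in
      AnyP.deduplicate⁺ _≐?_ (λ {A} {B} B≐A W≐A → λ v → trans (W≐A v) (sym (B≐A v)))
        (lose (∈-filter⁺ (λ U → dim U ≟ dim W) (∈-map⁺ span (vecs-complete allVec-complete bs)) (sym (dim-≐ W (span bs) e))) e)

  infix 8 #_∋_
  #_∋_ : List Subspace → Subspace → ℕ
  # 𝓐 ∋ S = ∑ 𝓐 λ F → ι (S ⊆ˢ? F)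

  #-0ˢ : ∀ 𝓐 → # 𝓐 ∋ 0ˢ ≡ length 𝓐
  #-0ˢ 𝓐 = trans (∑-cong 𝓐 λ F → ι-yes (0ˢ ⊆ˢ? F) 0ˢ⊆) (∑-1 𝓐)

  ∑-distinct-≤ : ∀ 𝓐 𝓑 (g : Subspace → ℕ) → Distinct 𝓐 → All (λ A → Any (A ≐_) 𝓑) 𝓐 →
                 (∀ {A B} → A ≐ B → g A ≤ g B) → ∑ 𝓐 g ≤ ∑ 𝓑 g
  ∑-distinct-≤ 𝓐 𝓑 g dist covered inv = ∑-transfer 𝓐 𝓑 g g (λ A B → ι (A ≐? B))
    (All.map (λ {A} p → ∑-≥ 𝓑 (λ B → ι (A ≐? B) * g B) (Any.map (λ {B} e → ≤-trans (inv e) (≤-reflexive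
       (sym (trans (cong (_* g B) (ι-yes (A ≐? B) e)) (*-identityˡ (g B)))))) p)) covered)
    (λ B → at-most-once {_~_ = _≐_} (_≐? B) (λ e f v → trans (e v) (sym (f v))) dist)

  ∑-subs-≥ : ∀ {m} 𝓐 (g : Subspace → ℕ) → Distinct 𝓐 → All (λ A → dim A ≡ m) 𝓐 →
             (∀ {A B} → A ≐ B → g A ≤ g B) → ∑ 𝓐 g ≤ ∑ (subs m) g
  ∑-subs-≥ {m} 𝓐 g dist dims = ∑-distinct-≤ 𝓐 (subs m) g dist (All.map (λ { {A} refl → subs-complete A }) dims)

  gap : Subspace → Subspace → ℕ
  gap C S = ∑ allV λ v → ι ((v ∈ˢ? C) ×-dec ¬? (v ∈ˢ? S))

  -- This is `q ^ dim C − q ^ j` with `j = dim (S ⊓ C)`. The factor `p * q ^ j` is split off because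
  -- it cancels from every double count.
  gap-card : ∀ C S → gap C S ≡ p * q ^ dim (S ⊓ C) * qn (dim C ∸ dim (S ⊓ C))
  gap-card C S = trans gap≡ (+-cancelˡ-≡ (card (S ⊓ C)) _ _ (begin
    card (S ⊓ C) + gap C (S ⊓ C)  ≡⟨ card-split {S ⊓ C} {C} ∩-⊆ʳ ⟨
    card C  ≡⟨ card≡ C ⟩
    q ^ dim C  ≡⟨ cong (q ^_) (m+[n∸m]≡n (dim-mono (∩-⊆ʳ {S} {C}))) ⟨
    q ^ (j + (dim C ∸ j))  ≡⟨ q^-+ j (dim C ∸ j) ⟩
    q ^ j + p * q ^ j * qn (dim C ∸ j)  ≡⟨ cong (_+ p * q ^ j * qn (dim C ∸ j)) (card≡ (S ⊓ C)) ⟨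
    card (S ⊓ C) + p * q ^ j * qn (dim C ∸ j)  ∎))
    where
    open ≡-Reasoning
    j = dim (S ⊓ C)
    gap≡ : gap C S ≡ gap C (S ⊓ C)
    gap≡ = ∑-cong allV λ v → ι-⇔ _ _ (λ (c , ¬s) → c , λ sc → ¬s (proj₁ (∈⊓-elim {S} {C} sc)))
                                     (λ (c , ¬sc) → c , λ s → ¬sc (∈⊓-intro {S} {C} s c))

  -- Both sides count pairs of a member `F` through `S` and a vector of `F ⊓ C` outside `S`.
  double-count : ∀ 𝓐 S C → ∑ allV (λ v → ι ((v ∈ˢ? C) ×-dec ¬? (v ∈ˢ? S)) * # 𝓐 ∋ (S +ᵛ v))
                         ≡ ∑ 𝓐 (λ F → ι (S ⊆ˢ? F) * gap (F ⊓ C) S)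
  double-count 𝓐 S C = begin
    ∑ allV (λ v → c v * # 𝓐 ∋ (S +ᵛ v))  ≡⟨ ∑-cong allV (λ v → ∑-*ˡ 𝓐 (c v) _) ⟨
    ∑ allV (λ v → ∑ 𝓐 (λ F → c v * ι (S +ᵛ v ⊆ˢ? F)))  ≡⟨ ∑-swap allV 𝓐 _ ⟩
    ∑ 𝓐 (λ F → ∑ allV (λ v → c v * ι (S +ᵛ v ⊆ˢ? F)))  ≡⟨ ∑-cong 𝓐 (λ F → ∑-cong allV (pt F)) ⟩
    ∑ 𝓐 (λ F → ∑ allV (λ v → ι (S ⊆ˢ? F) * g F v))  ≡⟨ ∑-cong 𝓐 (λ F → ∑-*ˡ allV (ι (S ⊆ˢ? F)) _) ⟩
    ∑ 𝓐 (λ F → ι (S ⊆ˢ? F) * gap (F ⊓ C) S)  ∎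
    where
    open ≡-Reasoning
    c : V → ℕ
    c v = ι ((v ∈ˢ? C) ×-dec ¬? (v ∈ˢ? S))
    g : Subspace → V → ℕ
    g F v = ι ((v ∈ˢ? F ⊓ C) ×-dec ¬? (v ∈ˢ? S))
    pt : ∀ F v → c v * ι (S +ᵛ v ⊆ˢ? F) ≡ ι (S ⊆ˢ? F) * g F v
    pt F v = trans (sym (ι-× ((v ∈ˢ? C) ×-dec ¬? (v ∈ˢ? S)) (S +ᵛ v ⊆ˢ? F)))
      (trans (ι-⇔ _ ((S ⊆ˢ? F) ×-dec ((v ∈ˢ? F ⊓ C) ×-dec ¬? (v ∈ˢ? S)))
        (λ ((c , ¬s) , Sv⊆F) → ⊆-trans ⊆+ᵛ Sv⊆F , ∈⊓-intro {F} {C} (Sv⊆F .on v (∈+ᵛ {S})) c , ¬s)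
        (λ (S⊆F , fc , ¬s) → (proj₂ (∈⊓-elim {F} {C} fc) , ¬s) , +ᵛ-least S⊆F (proj₁ (∈⊓-elim {F} {C} fc))))
      (ι-× (S ⊆ˢ? F) ((v ∈ˢ? F ⊓ C) ×-dec ¬? (v ∈ˢ? S))))

  gap-through : ∀ {S F C} → S ⊆ˢ F → gap (F ⊓ C) S ≡ p * q ^ dim (S ⊓ C) * qn (dim (F ⊓ C) ∸ dim (S ⊓ C))
  gap-through {S} {F} {C} S⊆F = subst (λ j → gap (F ⊓ C) S ≡ p * q ^ j * qn (dim (F ⊓ C) ∸ j))
    (≤-antisym (dim-mono (∩-mono ⊆-refl (∩-⊆ʳ {F} {C}))) (dim-mono (∩-greatest ∩-⊆ˡ (∩-mono S⊆F ⊆-refl))))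
    (gap-card (F ⊓ C) S)

  p*q^>0 : ∀ j → NonZero (p * q ^ j)
  p*q^>0 j = >-nonZero (*-mono-≤ 0<p (m^n>0 q j))

  -- With `j = dim (S ⊓ C)`, each member through `S` has at least `q ^ r − q ^ j` vectors in `C`
  -- outside `S`. There are `q ^ dim C − q ^ j` such vectors in all, and each lies in at most `X` of
  -- these members.
  step : ∀ 𝓐 S C r X → All (λ F → S ⊆ˢ F → r ≤ dim (F ⊓ C)) 𝓐 →
         (∀ v → v ∈ˢ C → v ∉ˢ S → # 𝓐 ∋ (S +ᵛ v) ≤ X) →
         qn (r ∸ dim (S ⊓ C)) * # 𝓐 ∋ S ≤ qn (dim C ∸ dim (S ⊓ C)) * X
  step 𝓐 S C r X meet bound = *-cancelˡ-≤ pq {{p*q^>0 j}} (begin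
    pq * (qn (r ∸ j) * # 𝓐 ∋ S)  ≡⟨ lem pq (qn (r ∸ j)) (# 𝓐 ∋ S) ⟩
    # 𝓐 ∋ S * (pq * qn (r ∸ j))  ≡⟨ ∑-*ʳ 𝓐 _ _ ⟨
    ∑ 𝓐 (λ F → ι (S ⊆ˢ? F) * (pq * qn (r ∸ j)))  ≤⟨ ∑-mono-All (All.map (λ {F} m → ι-*≤ (S ⊆ˢ? F) λ S⊆F →
        ≤-trans (*-monoʳ-≤ pq (qn-mono (∸-monoˡ-≤ j (m S⊆F)))) (≤-reflexive (sym (gap-through S⊆F)))) meet) ⟩
    ∑ 𝓐 (λ F → ι (S ⊆ˢ? F) * gap (F ⊓ C) S)  ≡⟨ double-count 𝓐 S C ⟨
    ∑ allV (λ v → ι ((v ∈ˢ? C) ×-dec ¬? (v ∈ˢ? S)) * # 𝓐 ∋ (S +ᵛ v))  ≤⟨ ∑-mono allV (λ v → ι-*≤ ((v ∈ˢ? C) ×-dec ¬? (v ∈ˢ? S)) λ (c , ¬s) → bound v c ¬s) ⟩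
    ∑ allV (λ v → ι ((v ∈ˢ? C) ×-dec ¬? (v ∈ˢ? S)) * X)  ≡⟨ ∑-*ʳ allV _ X ⟩
    gap C S * X  ≡⟨ cong (_* X) (gap-card C S) ⟩
    pq * qn (dim C ∸ j) * X  ≡⟨ *-assoc pq _ X ⟩
    pq * (qn (dim C ∸ j) * X)  ∎)
    where
    open ≤-Reasoning
    j = dim (S ⊓ C)
    pq = p * q ^ j
    lem : ∀ a b c → a * (b * c) ≡ c * (a * b)
    lem = solve-∀

  step-ratio : ∀ 𝓐 S C r X → dim (S ⊓ C) < r → r ≤ dim C → All (λ F → S ⊆ˢ F → r ≤ dim (F ⊓ C)) 𝓐 →
               (∀ v → v ∈ˢ C → v ∉ˢ S → # 𝓐 ∋ (S +ᵛ v) ≤ X) →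
               # 𝓐 ∋ S ≤ qn (suc (dim C ∸ r)) * X
  step-ratio 𝓐 S C r X j<r r≤c meet bound = *-cancelˡ-≤ (qn (suc i)) (begin
    qn (suc i) * # 𝓐 ∋ S  ≡⟨ cong (λ z → qn z * # 𝓐 ∋ S) (sym e₁) ⟩
    qn (r ∸ j) * # 𝓐 ∋ S  ≤⟨ step 𝓐 S C r X meet bound ⟩
    qn (dim C ∸ j) * X  ≡⟨ cong (λ z → qn z * X) e₂ ⟩
    qn (suc i + (dim C ∸ r)) * X  ≤⟨ *-monoˡ-≤ X (qn-ratio i (dim C ∸ r)) ⟩
    qn (suc (dim C ∸ r)) * qn (suc i) * X  ≡⟨ lem (qn (suc (dim C ∸ r))) (qn (suc i)) X ⟩
    qn (suc i) * (qn (suc (dim C ∸ r)) * X)  ∎)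
    where
    open ≤-Reasoning
    j = dim (S ⊓ C)
    i = r ∸ suc j
    e₁ : r ∸ j ≡ suc i
    e₁ = +-∸-assoc 1 j<r
    e₂ : dim C ∸ j ≡ suc i + (dim C ∸ r)
    e₂ = trans (cong (_∸ j) (sym (m+[n∸m]≡n r≤c))) (trans (+-∸-comm (dim C ∸ r) (<⇒≤ j<r)) (cong (_+ (dim C ∸ r)) e₁))
    lem : ∀ a b c → a * b * c ≡ b * (a * c)
    lem = solve-∀

  within : Subspace → List Subspace → List Subspace
  within W 𝓐 = filter (_⊆ˢ? W) 𝓐

  private
    -- Here the double count is exact: members lie inside `W`, so each has the same number of
    -- vectors outside `S`, and the resulting equation is the recursion of `G`.
    between : ∀ {W m} r S → m ≡ dim S + r → S ⊆ˢ W → # within W (subs m) ∋ S ≡ G (dim W ∸ dim S) r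
    between {W} {m} zero S m≡ S⊆W = ≤-antisym le ge
      where
      𝓐 = within W (subs m)
      m≡′ : m ≡ dim S
      m≡′ = trans m≡ (+-identityʳ (dim S))
      dims : All (λ F → dim F ≡ m) 𝓐
      dims = AllP.filter⁺ (_⊆ˢ? W) (subs-dim m)
      le : # 𝓐 ∋ S ≤ 1
      le = ≤-trans (∑-mono-All (All.map (λ {F} d → ι-mono (S ⊆ˢ? F) (F ≐? S) λ S⊆F →
             ⊆-antisym (⊆-dim⇒⊇ S⊆F (≤-reflexive (trans d m≡′))) S⊆F) dims))
           (at-most-once {_~_ = _≐_} (_≐? S) (λ e f v → trans (e v) (sym (f v))) (AllPairsP.filter⁺ (_⊆ˢ? W) (subs-distinct m)))
      ge : 1 ≤ # 𝓐 ∋ S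
      ge = ≤-trans (∑-≥ (subs m) (λ F → ι (F ⊆ˢ? W) * ι (S ⊆ˢ? F)) (Any.map (λ {F} e → ≤-reflexive (sym (cong₂ _*_
             (ι-yes (F ⊆ˢ? W) (⊆-trans (≐⇒⊇ S F e) S⊆W)) (ι-yes (S ⊆ˢ? F) (≐⇒⊆ S F e)))))
             (subst (λ z → Any (S ≐_) (subs z)) (sym m≡′) (subs-complete S))))
           (≤-reflexive (sym (∑-filter (_⊆ˢ? W) (subs m) _)))
    between {W} {m} (suc r) S m≡ S⊆W = G-unique (dim W ∸ s) r _ (*-cancelˡ-≡ _ _ pq {{p*q^>0 s}} (begin
      pq * (qn (suc r) * # 𝓐 ∋ S)  ≡⟨ lem pq (qn (suc r)) (# 𝓐 ∋ S) ⟩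
      # 𝓐 ∋ S * (pq * qn (suc r))  ≡⟨ ∑-*ʳ 𝓐 _ _ ⟨
      ∑ 𝓐 (λ F → ι (S ⊆ˢ? F) * (pq * qn (suc r)))  ≡⟨ ∑-cong-All (All.map (λ {F} (d , F⊆W) → ι-*≡ (S ⊆ˢ? F) λ S⊆F → sym
          (trans (gap-through S⊆F) (trans (cong₂ (λ x y → p * q ^ x * qn (y ∸ x)) (meetW S⊆W) (trans (meetW F⊆W) d))
             (cong (λ z → pq * qn z) (trans (cong (_∸ s) m≡) (m+n∸m≡n s (suc r))))))) dims) ⟩
      ∑ 𝓐 (λ F → ι (S ⊆ˢ? F) * gap (F ⊓ W) S)  ≡⟨ double-count 𝓐 S W ⟨
      ∑ allV (λ v → c v * # 𝓐 ∋ (S +ᵛ v))  ≡⟨ ∑-cong allV (λ v → ι-*≡ ((v ∈ˢ? W) ×-dec ¬? (v ∈ˢ? S)) λ (v∈ , v∉) →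
          trans (between r (S +ᵛ v) (trans m≡ (trans (+-suc s r) (cong (_+ r) (sym (dim-+ᵛ v∉))))) (+ᵛ-least S⊆W v∈))
                (cong (λ z → G z r) (trans (cong (dim W ∸_) (dim-+ᵛ v∉)) (sym (pred[m∸n]≡m∸[1+n] (dim W) s))))) ⟩
      ∑ allV (λ v → c v * G (pred (dim W ∸ s)) r)  ≡⟨ ∑-*ʳ allV c _ ⟩
      gap W S * G (pred (dim W ∸ s)) r  ≡⟨ cong (_* G (pred (dim W ∸ s)) r) (trans (gap-card W S)
                                                               (cong (λ x → p * q ^ x * qn (dim W ∸ x)) (meetW S⊆W))) ⟩
      pq * qn (dim W ∸ s) * G (pred (dim W ∸ s)) r  ≡⟨ *-assoc pq _ _ ⟩
      pq * (qn (dim W ∸ s) * G (pred (dim W ∸ s)) r)  ∎))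
      where
      open ≡-Reasoning
      𝓐 = within W (subs m)
      s = dim S
      pq = p * q ^ s
      c : V → ℕ
      c v = ι ((v ∈ˢ? W) ×-dec ¬? (v ∈ˢ? S))
      dims : All (λ F → dim F ≡ m × F ⊆ˢ W) 𝓐
      dims = All.zip (AllP.filter⁺ (_⊆ˢ? W) (subs-dim m) , AllP.all-filter (_⊆ˢ? W) (subs m))
      meetW : ∀ {F} → F ⊆ˢ W → dim (F ⊓ W) ≡ dim F
      meetW F⊆W = ≤-antisym (dim-mono ∩-⊆ˡ) (dim-mono (∩-greatest ⊆-refl F⊆W))
      lem : ∀ a b c → a * (b * c) ≡ c * (a * b)
      lem = solve-∀

  #-between : ∀ {W m S} → S ⊆ˢ W → dim S ≤ m → # within W (subs m) ∋ S ≡ G (dim W ∸ dim S) (m ∸ dim S)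
  #-between {W} {m} {S} S⊆W s≤m = between (m ∸ dim S) S (sym (m+[n∸m]≡n s≤m)) S⊆W

  #-subs : ∀ k S → # subs k ∋ S ≡ N n k (dim S)
  #-subs k S with <-≤-connex k (dim S)
  ... | inj₁ k<s = trans (trans (∑-cong-All (All.map (λ {F} d → ι-no (S ⊆ˢ? F) λ S⊆F →
                     <⇒≱ k<s (≤-trans (dim-mono S⊆F) (≤-reflexive d))) (subs-dim k))) (trans (∑-const (subs k) 0) (*-zeroʳ (length (subs k)))))
                     (sym (N-no {n} k<s))
  ... | inj₂ s≤k = begin
    # subs k ∋ S  ≡⟨ ∑-cong (subs k) (λ F → trans (sym (*-identityˡ _)) (cong (_* ι (S ⊆ˢ? F)) (sym (ι-yes (F ⊆ˢ? 1ˢ) ⊆1ˢ)))) ⟩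
    ∑ (subs k) (λ F → ι (F ⊆ˢ? 1ˢ) * ι (S ⊆ˢ? F))  ≡⟨ ∑-filter (_⊆ˢ? 1ˢ) (subs k) _ ⟨
    # within 1ˢ (subs k) ∋ S  ≡⟨ #-between ⊆1ˢ s≤k ⟩
    G (dim 1ˢ ∸ dim S) (k ∸ dim S)  ≡⟨ cong (λ z → G (z ∸ dim S) (k ∸ dim S)) dim-1ˢ ⟩
    G (n ∸ dim S) (k ∸ dim S)  ≡⟨ N-yes {n} s≤k ⟨
    N n k (dim S)  ∎
    where open ≡-Reasoning

  ι-⊆-≐ : ∀ {S A B} → A ≐ B → ι (S ⊆ˢ? A) ≤ ι (S ⊆ˢ? B)
  ι-⊆-≐ {S} {A} {B} e = ι-mono (S ⊆ˢ? A) (S ⊆ˢ? B) λ f → ⊆-trans f (≐⇒⊆ A B e)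

  #≤N : ∀ {k} 𝓐 S → Distinct 𝓐 → All (λ A → dim A ≡ k) 𝓐 → # 𝓐 ∋ S ≤ N n k (dim S)
  #≤N {k} 𝓐 S dist dims = ≤-trans (∑-subs-≥ 𝓐 _ dist dims (λ {A} {B} e → ι-⊆-≐ {S} {A} {B} e)) (≤-reflexive (#-subs k S))

  length-between : ∀ {m W S} 𝓐 → Distinct 𝓐 → All (λ A → dim A ≡ m) 𝓐 → All (S ⊆ˢ_) 𝓐 → All (_⊆ˢ W) 𝓐 →
                   S ⊆ˢ W → dim S ≤ m → length 𝓐 ≤ G (dim W ∸ dim S) (m ∸ dim S)
  length-between {m} {W} {S} 𝓐 dist dims above below S⊆W s≤m = begin
    length 𝓐  ≡⟨ ∑-1 𝓐 ⟨
    ∑ 𝓐 (λ _ → 1)  ≡⟨ ∑-cong-All (All.map (λ {F} (a , b) → sym (cong₂ _*_ (ι-yes (F ⊆ˢ? W) b) (ι-yes (S ⊆ˢ? F) a))) (All.zip (above , below))) ⟩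
    ∑ 𝓐 (λ F → ι (F ⊆ˢ? W) * ι (S ⊆ˢ? F))  ≤⟨ ∑-subs-≥ 𝓐 _ dist dims (λ {A} {B} e → *-mono-≤
                                                              (ι-mono (A ⊆ˢ? W) (B ⊆ˢ? W) (λ f → ⊆-trans (≐⇒⊇ A B e) f)) (ι-⊆-≐ {S} {A} {B} e)) ⟩
    ∑ (subs m) (λ F → ι (F ⊆ˢ? W) * ι (S ⊆ˢ? F))  ≡⟨ ∑-filter (_⊆ˢ? W) (subs m) _ ⟨
    # within W (subs m) ∋ S  ≡⟨ #-between S⊆W s≤m ⟩
    G (dim W ∸ dim S) (m ∸ dim S)  ∎
    where open ≤-Reasoning

  exchange : ∀ {S x v} → v ∈ˢ S +ᵛ x → v ∉ˢ S → S +ᵛ x ⊆ˢ S +ᵛ v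
  exchange {S} {x} {v} v∈ v∉ = ⊆-dim⇒⊇ (+ᵛ-least ⊆+ᵛ v∈) (≤-trans (dim-+ᵛ≤ S x) (≤-reflexive (sym (dim-+ᵛ v∉))))

  private
    -- Vectors outside `S ⊞ T` are added one at a time. If a new vector of `T` were acquired,
    -- exchange would put the added vector into `S ⊞ T`.
    extend′ : ∀ {W m} r S T → m ≡ dim S + r → S ⊆ˢ W → r + dim (S ⊞ T) ≤ dim W →
              ∃ λ F → S ⊆ˢ F × F ⊆ˢ W × dim F ≡ m × F ⊓ T ⊆ˢ S
    extend′ zero S T m≡ S⊆W _ = S , ⊆-refl , S⊆W , trans (sym (+-identityʳ (dim S))) (sym m≡) , ∩-⊆ˡ
    extend′ {W} {m} (suc r) S T m≡ S⊆W le =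
      let x , x∈W , x∉ = ⊈⇒∃ {W} {S ⊞ T} λ f → <⇒≱ (≤-trans (s≤s (m≤n+m (dim (S ⊞ T)) r)) le) (dim-mono f)
          x∉S : x ∉ˢ S
          x∉S = λ s → x∉ (⊞-⊆ˡ {S} {T} .on x s)
          F , Sx⊆F , F⊆W , d , F⊓T⊆ = extend′ r (S +ᵛ x) T (trans m≡ (trans (+-suc (dim S) r) (cong (_+ r) (sym (dim-+ᵛ x∉S)))))
            (+ᵛ-least S⊆W x∈W)
            (≤-trans (+-monoʳ-≤ r (≤-trans (dim-mono (⊞-least (+ᵛ-least (⊆-trans (⊞-⊆ˡ {S} {T}) ⊆+ᵛ) ∈+ᵛ) (⊆-trans ⊞-⊆ʳ ⊆+ᵛ))) (dim-+ᵛ≤ (S ⊞ T) x)))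
                     (≤-trans (≤-reflexive (+-suc r _)) le))
      in F , ⊆-trans ⊆+ᵛ Sx⊆F , F⊆W , d , sub λ v p → back x x∉ v (F⊓T⊆ .on v p) (proj₂ (∈⊓-elim {F} {T} p))
      where
      back : ∀ x → x ∉ˢ S ⊞ T → ∀ v → v ∈ˢ S +ᵛ x → v ∈ˢ T → v ∈ˢ S
      back x x∉ v v∈ v∈T with v ∈ˢ? S
      ... | yes s = s
      ... | no ¬s = contradiction (⊆-trans (exchange v∈ ¬s) (+ᵛ-least ⊞-⊆ˡ (⊞-⊆ʳ {S} {T} .on v v∈T)) .on x (∈+ᵛ {S})) x∉

  extend : ∀ {W m} S T → S ⊆ˢ W → dim S ≤ m → (m ∸ dim S) + dim (S ⊞ T) ≤ dim W →
           ∃ λ F → S ⊆ˢ F × F ⊆ˢ W × dim F ≡ m × F ⊓ T ⊆ˢ S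
  extend {W} {m} S T S⊆W s≤m = extend′ (m ∸ dim S) S T (sym (m+[n∸m]≡n s≤m)) S⊆W

-- Cross t-intersecting lists of (t+1)-spaces

module CrossIntersectingLists {q : ℕ} (𝔽 : FiniteField q) (n : ℕ) (t : ℕ) where
  open SubspaceCounting 𝔽 n

  -- `B` has codimension at most 1 in `S`, so any vector of `S` outside it generates the rest.
  -- Typically `A` and `B` are the traces on `S` of two other spaces.
  sum-fills : ∀ {A B S} → A ⊆ˢ S → B ⊆ˢ S → dim S ≡ suc t → t ≤ dim B → ¬ (A ⊆ˢ B) → S ⊆ˢ A ⊞ B
  sum-fills {A} {B} {S} A⊆S B⊆S dS t≤ A⊈B = let v , a , ¬b = ⊈⇒∃ A⊈B in
    ⊆-dim⇒⊇ (⊞-least A⊆S B⊆S) (≤-trans (≤-reflexive dS) (≤-trans (s≤s t≤) (dim-strict v ⊞-⊆ʳ (⊞-⊆ˡ {A} {B} .on v a) ¬b)))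

  meet≤ : ∀ {A B} → dim A ≡ suc t → ¬ (A ⊆ˢ B) → dim (A ⊓ B) ≤ t
  meet≤ {A} {B} dA A⊈B = let v , a , ¬b = ⊈⇒∃ A⊈B in
    s≤s⁻¹ (≤-trans (dim-strict v ∩-⊆ˡ a (λ ab → ¬b (∩-⊆ʳ {A} {B} .on v ab))) (≤-reflexive dA))

  ≐-of-⊆ : ∀ {A B} → dim A ≡ suc t → dim B ≡ suc t → A ⊆ˢ B → A ≐ B
  ≐-of-⊆ dA dB A⊆B = ⊆-antisym A⊆B (⊆-dim⇒⊇ A⊆B (≤-reflexive (trans dB (sym dA))))

  dim-⊞-near : ∀ {A B} → dim A ≡ suc t → dim B ≡ suc t → t ≤ dim (A ⊓ B) → dim (A ⊞ B) ≤ 2 + t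
  dim-⊞-near {A} {B} dA dB le = +-cancelʳ-≤ t _ _ (begin
    dim (A ⊞ B) + t  ≤⟨ +-monoʳ-≤ (dim (A ⊞ B)) le ⟩
    dim (A ⊞ B) + dim (A ⊓ B)  ≡⟨ dim-modular A B ⟩
    dim A + dim B  ≡⟨ cong₂ _+_ dA dB ⟩
    suc t + suc t  ≡⟨ cong suc (+-suc t t) ⟩
    2 + t + t  ∎)
    where open ≤-Reasoning

  dim-⊞-distinct : ∀ {A B} → dim A ≡ suc t → dim B ≡ suc t → ¬ (A ≐ B) → 2 + t ≤ dim (A ⊞ B)
  dim-⊞-distinct {A} {B} dA dB A≢B = let v , a , ¬b = ⊈⇒∃ λ f → A≢B (≐-of-⊆ dA dB f) in
    ≤-trans (s≤s (≤-reflexive (sym dB))) (dim-strict v (⊞-⊆ʳ {A}) (⊞-⊆ˡ {A} {B} .on v a) ¬b)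

  #-all : ∀ {𝓐 S} → All (S ⊆ˢ_) 𝓐 → length 𝓐 ≡ # 𝓐 ∋ S
  #-all {𝓐} {S} all = trans (sym (∑-1 𝓐)) (∑-cong-All (All.map (λ {F} f → sym (ι-yes (S ⊆ˢ? F) f)) all))

  -- Every member contains one of the `qn (suc t)` t-spaces of `C`. In the induction `qn (suc r)` is
  -- the number of t-spaces between `S` and `C`, so the factors telescope.
  pick : ∀ 𝓐 C X → dim C ≡ suc t → All (λ F → t ≤ dim (F ⊓ C)) 𝓐 →
         (∀ E → dim E ≡ t → # 𝓐 ∋ E ≤ X) → length 𝓐 ≤ qn (suc t) * X
  pick 𝓐 C X dC meet bound = subst (_≤ qn (suc t) * X) (#-0ˢ 𝓐) (go t 0ˢ 0ˢ⊆ (cong (_+ t) dim-0ˢ))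
    where
    go : ∀ r S → S ⊆ˢ C → dim S + r ≡ t → # 𝓐 ∋ S ≤ qn (suc r) * X
    go zero S S⊆C e = ≤-trans (bound S (trans (sym (+-identityʳ _)) e)) (≤-reflexive (sym (trans (cong (_* X) qn1≡1) (*-identityˡ X))))
    go (suc r) S S⊆C e = *-cancelˡ-≤ (qn (suc r)) (begin
      qn (suc r) * # 𝓐 ∋ S  ≡⟨ cong (λ z → qn z * # 𝓐 ∋ S) (sym (∸≡ t (suc r) e)) ⟩
      qn (t ∸ dim (S ⊓ C)) * # 𝓐 ∋ S  ≤⟨ step 𝓐 S C t (qn (suc r) * X) (All.map (λ m _ → m) meet)
           (λ v v∈ v∉ → go r (S +ᵛ v) (+ᵛ-least S⊆C v∈) (trans (cong (_+ r) (dim-+ᵛ v∉)) (trans (sym (+-suc (dim S) r)) e))) ⟩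
      qn (dim C ∸ dim (S ⊓ C)) * (qn (suc r) * X) ≡⟨ cong (λ z → qn z * (qn (suc r) * X)) (trans (cong (_∸ dim (S ⊓ C)) dC)
                                                       (∸≡ (suc t) (2 + r) (trans (+-suc (dim S) (suc r)) (cong suc e)))) ⟩
      qn (2 + r) * (qn (suc r) * X)  ≡⟨ lem (qn (2 + r)) (qn (suc r)) X ⟩
      qn (suc r) * (qn (2 + r) * X)  ∎)
      where
      open ≤-Reasoning
      lem : ∀ a b c → a * (b * c) ≡ b * (a * c)
      lem = solve-∀
      dS⊓ : dim (S ⊓ C) ≡ dim S
      dS⊓ = ≤-antisym (dim-mono ∩-⊆ˡ) (dim-mono (∩-greatest ⊆-refl S⊆C))
      ∸≡ : ∀ a b → dim S + b ≡ a → a ∸ dim (S ⊓ C) ≡ b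
      ∸≡ a b refl = trans (cong (dim S + b ∸_) dS⊓) (m+n∸m≡n (dim S) b)

  record CrossLists (c : ℕ) (𝓢 𝓣 : List Subspace) : Set where
    field
      distS : Distinct 𝓢
      distT : Distinct 𝓣
      dimS  : ∀ {S} → S ∈ₗ 𝓢 → dim S ≡ suc t
      dimT  : ∀ {T} → T ∈ₗ 𝓣 → dim T ≡ suc t
      cross : ∀ {S T} → S ∈ₗ 𝓢 → T ∈ₗ 𝓣 → t ≤ dim (S ⊓ T)
      starS : ∀ E → dim E ≡ t → # 𝓢 ∋ E ≤ c
      starT : ∀ E → dim E ≡ t → # 𝓣 ∋ E ≤ c

  swapLists : ∀ {c 𝓢 𝓣} → CrossLists c 𝓢 𝓣 → CrossLists c 𝓣 𝓢
  swapLists L = record { distS = distT ; distT = distS ; dimS = dimT ; dimT = dimS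
                       ; cross = λ {T} {S} T∈ S∈ → ≤-trans (cross S∈ T∈) (dim-mono (∩-comm S T)) ; starS = starT ; starT = starS }
    where open CrossLists L

  Near : List Subspace → Set
  Near 𝓢 = All (λ S → All (λ S′ → t ≤ dim (S ⊓ S′)) 𝓢) 𝓢

  FarPair : List Subspace → Set
  FarPair 𝓢 = ∃₂ λ T₁ T₂ → T₁ ∈ₗ 𝓢 × T₂ ∈ₗ 𝓢 × dim (T₁ ⊓ T₂) < t

  near-or-far : ∀ 𝓢 → Near 𝓢 ⊎ FarPair 𝓢
  near-or-far 𝓢 with All.all? (λ S → All.all? (λ S′ → t ≤? dim (S ⊓ S′)) 𝓢) 𝓢
  ... | yes near = inj₁ near
  ... | no ¬near = let S , S∈ , ¬a = find∈ (AllP.¬All⇒Any¬ (λ S → All.all? (λ S′ → t ≤? dim (S ⊓ S′)) 𝓢) 𝓢 ¬near)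
                       S′ , S′∈ , ¬b = find∈ (AllP.¬All⇒Any¬ (λ S′ → t ≤? dim (S ⊓ S′)) 𝓢 ¬a)
                   in inj₂ (S , S′ , S∈ , S′∈ , ≰⇒> ¬b)

  TwoMembers : List Subspace → Set
  TwoMembers 𝓢 = ∃₂ λ S₁ S₂ → S₁ ∈ₗ 𝓢 × S₂ ∈ₗ 𝓢 × ¬ (S₁ ≐ S₂)

  one-or-two : ∀ {𝓢} → Distinct 𝓢 → length 𝓢 ≤ 1 ⊎ TwoMembers 𝓢
  one-or-two {[]}         _ = inj₁ z≤n
  one-or-two {S ∷ []}     _ = inj₁ ≤-refl
  one-or-two {S ∷ S′ ∷ _} ((S≢S′ ∷ _) ∷ _) = inj₂ (S , S′ , here refl , there (here refl) , S≢S′)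

  third : ∀ {𝓢} → Distinct 𝓢 → ∀ A B → length 𝓢 ≤ 2 ⊎ ∃ λ C → C ∈ₗ 𝓢 × ¬ (C ≐ A) × ¬ (C ≐ B)
  third {𝓢} dist A B with Any.any? (λ C → ¬? (C ≐? A) ×-dec ¬? (C ≐? B)) 𝓢
  ... | yes a = inj₂ (find∈ a)
  ... | no ¬a = inj₁ (begin
    length 𝓢  ≡⟨ ∑-1 𝓢 ⟨
    ∑ 𝓢 (λ _ → 1)  ≤⟨ ∑-mono-All (All.map (λ {C} h → pt C h) (AllP.¬Any⇒All¬ 𝓢 ¬a)) ⟩
    ∑ 𝓢 (λ C → ι (C ≐? A) + ι (C ≐? B))  ≡⟨ ∑-+ 𝓢 _ _ ⟩
    ∑ 𝓢 (λ C → ι (C ≐? A)) + ∑ 𝓢 (λ C → ι (C ≐? B))  ≤⟨ +-mono-≤ (once A) (once B) ⟩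
    2  ∎)
    where
    open ≤-Reasoning
    once : ∀ A → ∑ 𝓢 (λ C → ι (C ≐? A)) ≤ 1
    once A = at-most-once {_~_ = _≐_} (_≐? A) (λ e f v → trans (e v) (sym (f v))) dist
    pt : ∀ C → ¬ (¬ (C ≐ A) × ¬ (C ≐ B)) → 1 ≤ ι (C ≐? A) + ι (C ≐? B)
    pt C h with C ≐? A | C ≐? B
    ... | yes _ | _     = s≤s z≤n
    ... | no _  | yes _ = ≤-refl
    ... | no ¬a | no ¬b = contradiction (¬a , ¬b) h

  #-filled : ∀ {𝓐} → Distinct 𝓐 → (∀ {A} → A ∈ₗ 𝓐 → dim A ≡ suc t) → ∀ U → dim U ≡ suc t → # 𝓐 ∋ U ≤ 1
  #-filled {𝓐} dist dims U dU = at-most-once-∈ {_~_ = _≐_} (U ⊆ˢ?_)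
    (λ {A} {B} A∈ B∈ f g v → trans (sym (≐-of-⊆ dU (dims A∈) f v)) (≐-of-⊆ dU (dims B∈) g v)) dist

  length-hyperplanes : ∀ {𝓐 Q} → Distinct 𝓐 → (∀ {A} → A ∈ₗ 𝓐 → dim A ≡ suc t) → dim Q ≡ 2 + t → All (_⊆ˢ Q) 𝓐 → length 𝓐 ≤ qn (2 + t)
  length-hyperplanes {𝓐} {Q} dist dims dQ below = begin
    length 𝓐  ≤⟨ length-between 𝓐 dist (All.tabulate dims) (All.universal (λ _ → 0ˢ⊆) 𝓐) below 0ˢ⊆
                                                  (dim-0ˢ≤) ⟩
    G (dim Q ∸ dim 0ˢ) (suc t ∸ dim 0ˢ)  ≡⟨ cong₂ (λ x y → G (x ∸ y) (suc t ∸ y)) dQ dim-0ˢ ⟩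
    G (2 + t) (suc t)  ≡⟨ G-hyperplane (suc t) ⟩
    qn (2 + t)  ∎
    where open ≤-Reasoning

  module _ {c : ℕ} {𝓢 𝓣 : List Subspace} (L : CrossLists c 𝓢 𝓣) where
    open CrossLists L

    single : ∀ {T} → T ∈ₗ 𝓣 → length 𝓢 ≤ qn (suc t) * c
    single {T} T∈ = pick 𝓢 T c (dimT T∈) (All.tabulate λ S∈ → cross S∈ T∈) starS

    -- A member through `X` must contain a vector of `T` outside `X`, and that vector together with
    -- `X` already determines the member.
    row : ∀ {T X} → T ∈ₗ 𝓣 → dim X ≡ t → ¬ (X ⊆ˢ T) → # 𝓢 ∋ X ≤ qn 2
    row {T} {X} T∈ dX X⊈T = begin
      # 𝓢 ∋ X  ≤⟨ step-ratio 𝓢 X T t 1 (let v , x , ¬t = ⊈⇒∃ X⊈T in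
                                          ≤-trans (dim-strict v ∩-⊆ˡ x (λ p → ¬t (∩-⊆ʳ {X} {T} .on v p))) (≤-reflexive dX))
                                          (≤-trans (n≤1+n t) (≤-reflexive (sym (dimT T∈)))) (All.tabulate λ S∈ _ → cross S∈ T∈)
                                          (λ v _ v∉ → #-filled distS dimS (X +ᵛ v) (trans (dim-+ᵛ v∉) (cong suc dX))) ⟩
      qn (suc (dim T ∸ t)) * 1  ≡⟨ *-identityʳ _ ⟩
      qn (suc (dim T ∸ t))  ≡⟨ cong (λ z → qn (suc z)) (trans (cong (_∸ t) (dimT T∈)) (m+n∸n≡m 1 t)) ⟩
      qn 2  ∎
      where open ≤-Reasoning

    module Far {T₁ T₂ : Subspace} (T₁∈ : T₁ ∈ₗ 𝓣) (T₂∈ : T₂ ∈ₗ 𝓣) (far : dim (T₁ ⊓ T₂) < t) where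

      P = T₁ ⊓ T₂

      -- Two traces of dimension at least t inside a (t+1)-space meet in dimension at least t - 1.
      -- As `P` has dimension below t, every member of 𝓢 contains `P`, and `dim P = t − 1` if 𝓢 has
      -- a member.
      traces : ∀ {S} → S ∈ₗ 𝓢 → t + t ≤ suc t + dim ((S ⊓ T₁) ⊓ (S ⊓ T₂))
      traces {S} S∈ = begin
        t + t  ≤⟨ +-mono-≤ (cross S∈ T₁∈) (cross S∈ T₂∈) ⟩
        dim (S ⊓ T₁) + dim (S ⊓ T₂)  ≡⟨ dim-modular (S ⊓ T₁) (S ⊓ T₂) ⟨
        dim ((S ⊓ T₁) ⊞ (S ⊓ T₂)) + dim ((S ⊓ T₁) ⊓ (S ⊓ T₂))  ≤⟨ +-monoˡ-≤ _ (≤-trans (dim-mono (⊞-least ∩-⊆ˡ ∩-⊆ˡ)) (≤-reflexive (dimS S∈))) ⟩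
        suc t + dim ((S ⊓ T₁) ⊓ (S ⊓ T₂))  ∎
        where open ≤-Reasoning

      t≤1+ : ∀ {S} → S ∈ₗ 𝓢 → t ≤ suc (dim ((S ⊓ T₁) ⊓ (S ⊓ T₂)))
      t≤1+ S∈ = +-cancelˡ-≤ t _ _ (≤-trans (traces S∈) (≤-reflexive (sym (+-suc t _))))

      P⊆ : ∀ {S} → S ∈ₗ 𝓢 → P ⊆ˢ S
      P⊆ S∈ = ⊆-trans (⊆-dim⇒⊇ (∩-mono ∩-⊆ʳ ∩-⊆ʳ) (s≤s⁻¹ (≤-trans far (t≤1+ S∈)))) (⊆-trans ∩-⊆ˡ ∩-⊆ˡ)

      t≤1+P : ∀ {S} → S ∈ₗ 𝓢 → t ≤ suc (dim P)
      t≤1+P S∈ = ≤-trans (t≤1+ S∈) (s≤s (dim-mono (∩-mono ∩-⊆ʳ ∩-⊆ʳ)))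

      ⊈T₂ : ∀ {X} → X ⊆ˢ T₁ → t ≤ dim X → ¬ (X ⊆ˢ T₂)
      ⊈T₂ X⊆T₁ t≤ X⊆T₂ = <⇒≱ far (≤-trans t≤ (dim-mono (∩-greatest X⊆T₁ X⊆T₂)))

      -- The members of 𝓢 form a grid indexed by the t-spaces between P and T₁ and those between P and T₂.
      rows : ∀ {𝓐} x → (∀ {S} → S ∈ₗ 𝓐 → S ∈ₗ 𝓢) → (∀ X → dim X ≡ t → P ⊆ˢ X → X ⊆ˢ T₁ → # 𝓐 ∋ X ≤ x) → length 𝓐 ≤ qn 2 * x
      rows {[]}         x inc bound = z≤n
      rows {𝓐@(S₀ ∷ _)} x inc bound = begin
        length 𝓐  ≡⟨ #-all (All.tabulate λ S∈ → P⊆ (inc S∈)) ⟩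
        # 𝓐 ∋ P  ≤⟨ step-ratio 𝓐 P T₁ t x (≤-<-trans (dim-mono ∩-⊆ˡ) far) (≤-trans (n≤1+n t) (≤-reflexive (sym (dimT T₁∈))))
                                           (All.tabulate λ S∈ _ → cross (inc S∈) T₁∈)
                                           (λ v v∈ v∉ → bound (P +ᵛ v) (trans (dim-+ᵛ v∉) (≤-antisym far (t≤1+P (inc (here refl))))) ⊆+ᵛ (+ᵛ-least ∩-⊆ˡ v∈)) ⟩
        qn (suc (dim T₁ ∸ t)) * x  ≡⟨ cong (λ z → qn (suc z) * x) (trans (cong (_∸ t) (dimT T₁∈)) (m+n∸n≡m 1 t)) ⟩
        qn 2 * x  ∎
        where open ≤-Reasoning

      grid : length 𝓢 ≤ qn 2 * qn 2
      grid = rows (qn 2) (λ S∈ → S∈) (λ X dX _ X⊆T₁ → row T₂∈ dX (⊈T₂ X⊆T₁ (≤-reflexive (sym dX))))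

      -- `Y` contains `P` and has one dimension less than `T₁`, so `Y ⊞ T₂` has smaller dimension
      -- than `T₁ ⊞ T₂`.
      T₁⊈ : ∀ {Y} → dim Y ≡ t → P ⊆ˢ Y → ¬ (T₁ ⊆ˢ Y ⊞ T₂)
      T₁⊈ {Y} dY P⊆Y T₁⊆ = 1+n≰n (begin
        suc t + suc t  ≡⟨ cong₂ _+_ (dimT T₁∈) (dimT T₂∈) ⟨
        dim T₁ + dim T₂  ≡⟨ dim-modular T₁ T₂ ⟨
        dim (T₁ ⊞ T₂) + dim P  ≤⟨ +-mono-≤ (dim-mono (⊞-least T₁⊆ ⊞-⊆ʳ)) (dim-mono (∩-greatest P⊆Y ∩-⊆ʳ)) ⟩
        dim (Y ⊞ T₂) + dim (Y ⊓ T₂)  ≡⟨ dim-modular Y T₂ ⟩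
        dim Y + dim T₂  ≡⟨ cong₂ _+_ dY (dimT T₂∈) ⟩
        t + suc t  ∎)
        where open ≤-Reasoning

      fills : ∀ {X S} → S ∈ₗ 𝓢 → dim X ≡ t → X ⊆ˢ S → X ⊆ˢ T₁ → S ⊆ˢ X ⊞ T₂
      fills S∈ dX X⊆S X⊆T₁ = ⊆-trans (sum-fills X⊆S ∩-⊆ˡ (dimS S∈) (cross S∈ T₂∈)
        (λ f → ⊈T₂ X⊆T₁ (≤-reflexive (sym dX)) (⊆-trans f ∩-⊆ʳ))) (⊞-least ⊞-⊆ˡ (⊆-trans ∩-⊆ʳ ⊞-⊆ʳ))

      T₁-fills : ∀ {X Y} → dim X ≡ t → dim Y ≡ t → X ⊆ˢ T₁ → Y ⊆ˢ T₁ → ¬ (X ⊆ˢ Y) → T₁ ⊆ˢ X ⊞ Y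
      T₁-fills dX dY X⊆ Y⊆ X⊈Y = sum-fills X⊆ Y⊆ (dimT T₁∈) (≤-reflexive (sym dY)) X⊈Y

      module _ {T₃ : Subspace} (T₃∈ : T₃ ∈ₗ 𝓣) (T₃≢T₁ : ¬ (T₃ ≐ T₁)) (T₃≢T₂ : ¬ (T₃ ≐ T₂)) where

        -- A third member T₃ of 𝓣 leaves at most one row of the grid with several members of 𝓢.
        record Crowded (X : Subspace) : Set where
          constructor crowded
          field
            {S S′} : Subspace
            S∈    : S ∈ₗ 𝓢
            S′∈   : S′ ∈ₗ 𝓢
            dX    : dim X ≡ t
            X⊆T₁  : X ⊆ˢ T₁
            X⊆S   : X ⊆ˢ S
            X⊆S′  : X ⊆ˢ S′
            S≢S′  : ¬ (S ≐ S′)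

        -- Two members `S`, `S′` of the row meet exactly in `X`. If the trace of `S` on `T₃` lies in
        -- `S′`, it is `X`; otherwise the two traces span `T₃`, and both members lie in `X ⊞ T₂`.
        crowded-T₃ : ∀ {X} → Crowded X → X ⊆ˢ T₃ ⊎ T₃ ⊆ˢ X ⊞ T₂
        crowded-T₃ {X} (crowded {S} {S′} S∈ S′∈ dX X⊆T₁ X⊆S X⊆S′ S≢S′) with X ⊆ˢ? T₃
        ... | yes X⊆T₃ = inj₁ X⊆T₃
        ... | no X⊈T₃ = inj₂ (⊆-trans (sum-fills {S ⊓ T₃} {S′ ⊓ T₃} ∩-⊆ʳ ∩-⊆ʳ (dimT T₃∈) (cross S′∈ T₃∈) no-sub)
                          (⊞-least (⊆-trans ∩-⊆ˡ (fills S∈ dX X⊆S X⊆T₁)) (⊆-trans ∩-⊆ˡ (fills S′∈ dX X⊆S′ X⊆T₁))))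
          where
          S⊓S′⊆X : S ⊓ S′ ⊆ˢ X
          S⊓S′⊆X = ⊆-dim⇒⊇ (∩-greatest X⊆S X⊆S′) (≤-trans (meet≤ (dimS S∈) (λ f → S≢S′ (≐-of-⊆ (dimS S∈) (dimS S′∈) f))) (≤-reflexive (sym dX)))
          no-sub : ¬ (S ⊓ T₃ ⊆ˢ S′ ⊓ T₃)
          no-sub f = X⊈T₃ (⊆-trans (⊆-dim⇒⊇ (⊆-trans (∩-greatest ∩-⊆ˡ (⊆-trans f ∩-⊆ˡ)) S⊓S′⊆X)
                                   (≤-trans (≤-reflexive dX) (cross S∈ T₃∈))) ∩-⊆ʳ)

        X⊞T₂⊆ : ∀ {X} → Crowded X → T₃ ⊆ˢ X ⊞ T₂ → X ⊞ T₂ ⊆ˢ T₂ ⊞ T₃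
        X⊞T₂⊆ {X} (crowded {S} S∈ S′∈ dX X⊆T₁ X⊆S X⊆S′ S≢S′) T₃⊆ = ⊆-dim⇒⊇ (⊞-least ⊞-⊆ʳ T₃⊆) (≤-trans (+-cancelʳ-≤ (dim P) _ _ (begin
          dim (X ⊞ T₂) + dim P  ≤⟨ +-monoʳ-≤ (dim (X ⊞ T₂)) (dim-mono (∩-greatest P⊆X ∩-⊆ʳ)) ⟩
          dim (X ⊞ T₂) + dim (X ⊓ T₂)  ≡⟨ dim-modular X T₂ ⟩
          dim X + dim T₂  ≡⟨ cong₂ _+_ dX (dimT T₂∈) ⟩
          t + suc t  ≤⟨ +-monoˡ-≤ (suc t) (t≤1+P S∈) ⟩
          suc (dim P) + suc t  ≡⟨ cong suc (trans (+-comm (dim P) (suc t)) refl) ⟩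
          2 + t + dim P  ∎)) (dim-⊞-distinct (dimT T₂∈) (dimT T₃∈) (λ e → T₃≢T₂ (≐-sym {T₂} {T₃} e))))
          where
          open ≤-Reasoning
          P⊆X : P ⊆ˢ X
          P⊆X = ⊆-trans (∩-greatest (P⊆ S∈) ∩-⊆ˡ) (⊆-dim⇒⊇ (∩-greatest X⊆S X⊆T₁)
                  (≤-trans (meet≤ (dimS S∈) (λ f → ⊈T₂ {S ⊓ T₂} (⊆-trans ∩-⊆ˡ f) (cross S∈ T₂∈) ∩-⊆ʳ)) (≤-reflexive (sym dX))))

        -- Distinct rows `X` and `Y` span `T₁`. If both lay in `T₃`, then `T₃ ≐ T₁`. In every other
        -- case `T₁` would be contained in `X ⊞ T₂` or `Y ⊞ T₂`, against `T₁⊈`.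
        crowded-unique : ∀ {X Y} → Crowded X → Crowded Y → P ⊆ˢ X → P ⊆ˢ Y → X ⊆ˢ Y
        crowded-unique {X} {Y} cX cY P⊆X P⊆Y = decidable-stable (X ⊆ˢ? Y) λ X⊈Y → go X⊈Y (crowded-T₃ cX) (crowded-T₃ cY)
          where
          module X = Crowded cX
          module Y = Crowded cY
          go : ¬ (X ⊆ˢ Y) → X ⊆ˢ T₃ ⊎ T₃ ⊆ˢ X ⊞ T₂ → ¬ (Y ⊆ˢ T₃ ⊎ T₃ ⊆ˢ Y ⊞ T₂)
          go X⊈Y = λ where
              (inj₁ X⊆T₃) (inj₁ Y⊆T₃) → T₃≢T₁ (≐-sym {T₁} {T₃} (≐-of-⊆ (dimT T₁∈) (dimT T₃∈) (⊆-trans T₁⊆ (⊞-least X⊆T₃ Y⊆T₃))))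
              (inj₁ X⊆T₃) (inj₂ T₃⊆Y) → T₁⊈ Y.dX P⊆Y (⊆-trans T₁⊆ (⊞-least (⊆-trans X⊆T₃ T₃⊆Y) ⊞-⊆ˡ))
              (inj₂ T₃⊆X) (inj₁ Y⊆T₃) → T₁⊈ X.dX P⊆X (⊆-trans T₁⊆ (⊞-least ⊞-⊆ˡ (⊆-trans Y⊆T₃ T₃⊆X)))
              (inj₂ T₃⊆X) (inj₂ T₃⊆Y) → T₁⊈ Y.dX P⊆Y (⊆-trans T₁⊆ (⊞-least (⊆-trans ⊞-⊆ˡ (⊆-trans (X⊞T₂⊆ cX T₃⊆X) (⊞-least ⊞-⊆ʳ T₃⊆Y))) ⊞-⊆ˡ))
            where
            T₁⊆ : T₁ ⊆ˢ X ⊞ Y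
            T₁⊆ = T₁-fills X.dX Y.dX X.X⊆T₁ Y.X⊆T₁ X⊈Y

        private
          uncrowded⇒≤1 : ∀ {𝓐} X → Distinct 𝓐 → (∀ {S} → S ∈ₗ 𝓐 → S ∈ₗ 𝓢) → dim X ≡ t → X ⊆ˢ T₁ →
                         (∀ {S S′} → S ∈ₗ 𝓐 → S′ ∈ₗ 𝓐 → X ⊆ˢ S → X ⊆ˢ S′ → ¬ (S ≐ S′) → Crowded X → S ≐ S′) → # 𝓐 ∋ X ≤ 1
          uncrowded⇒≤1 X dist inc dX X⊆T₁ h = at-most-once-∈ {_~_ = _≐_} (X ⊆ˢ?_) (λ {S} {S′} S∈ S′∈ X⊆S X⊆S′ →
            decidable-stable (S ≐? S′) λ S≢S′ → S≢S′ (h S∈ S′∈ X⊆S X⊆S′ S≢S′ (crowded (inc S∈) (inc S′∈) dX X⊆T₁ X⊆S X⊆S′ S≢S′))) dist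

          CrowdedRow : Subspace → Set
          CrowdedRow S = Any (λ S′ → S ⊓ T₁ ⊆ˢ S′ × ¬ (S ≐ S′)) 𝓢

          trace-dim : ∀ {S} → S ∈ₗ 𝓢 → dim (S ⊓ T₁) ≡ t
          trace-dim {S} S∈ = ≤-antisym (meet≤ (dimS S∈) (λ f → ⊈T₂ {S ⊓ T₂} (⊆-trans ∩-⊆ˡ f) (cross S∈ T₂∈) ∩-⊆ʳ)) (cross S∈ T₁∈)

        three : length 𝓢 ≤ qn 2 + qn 2
        three with Any.any? (λ S → Any.any? (λ S′ → (S ⊓ T₁ ⊆ˢ? S′) ×-dec ¬? (S ≐? S′)) 𝓢) 𝓢
        ... | no none = ≤-trans (rows 1 (λ S∈ → S∈) (λ X dX _ X⊆T₁ → uncrowded⇒≤1 X distS (λ S∈ → S∈) dX X⊆T₁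
                λ {S} {S′} S∈ S′∈ X⊆S X⊆S′ S≢S′ _ → contradiction (lose S∈ (lose S′∈ (⊆-trans (⊆-dim⇒⊇ (∩-greatest X⊆S X⊆T₁)
                   (≤-reflexive (trans (trace-dim S∈) (sym dX)))) X⊆S′ , S≢S′))) none))
                (≤-trans (≤-reflexive (*-identityʳ (qn 2))) (m≤m+n _ _))
        ... | yes some = begin
            length 𝓢  ≡⟨ split ⟩
            # 𝓢 ∋ X₀ + length rest  ≤⟨ +-mono-≤ (row T₂∈ dX₀ (⊈T₂ ∩-⊆ʳ (≤-reflexive (sym dX₀)))) rest≤ ⟩
            qn 2 + qn 2  ∎
          where
          open ≤-Reasoning
          S₀ = proj₁ (find∈ some)
          S₀∈ : S₀ ∈ₗ 𝓢
          S₀∈ = proj₁ (proj₂ (find∈ some))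
          inner : CrowdedRow S₀
          inner = proj₂ (proj₂ (find∈ some))
          X₀ = S₀ ⊓ T₁
          dX₀ : dim X₀ ≡ t
          dX₀ = trace-dim S₀∈
          c₀ : Crowded X₀
          c₀ = let S′ , S′∈ , f , ne = find∈ inner in crowded S₀∈ S′∈ dX₀ ∩-⊆ʳ ∩-⊆ˡ f ne
          rest = filter (λ S → ¬? (X₀ ⊆ˢ? S)) 𝓢
          split : length 𝓢 ≡ # 𝓢 ∋ X₀ + length rest
          split = trans (sym (∑-1 𝓢)) (trans (trans (∑-cong 𝓢 pt) (∑-+ 𝓢 _ _)) (cong (# 𝓢 ∋ X₀ +_) (sym (length-filter-ι (λ S → ¬? (X₀ ⊆ˢ? S)) 𝓢))))
            where pt : ∀ S → 1 ≡ ι (X₀ ⊆ˢ? S) + ι (¬? (X₀ ⊆ˢ? S))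
                  pt S with X₀ ⊆ˢ? S
                  ... | yes _ = refl
                  ... | no _  = refl
          inc : ∀ {S} → S ∈ₗ rest → S ∈ₗ 𝓢
          inc S∈ = proj₁ (∈-filter⁻ (λ S → ¬? (X₀ ⊆ˢ? S)) S∈)
          rest≤ : length rest ≤ qn 2
          rest≤ = ≤-trans (rows 1 inc (λ X dX P⊆X X⊆T₁ → uncrowded⇒≤1 X (AllPairsP.filter⁺ _ distS) inc dX X⊆T₁
                    λ S∈ S′∈ X⊆S X⊆S′ S≢S′ cX → contradiction (⊆-trans (crowded-unique c₀ cX (∩-greatest (P⊆ S₀∈) ∩-⊆ˡ) P⊆X) X⊆S)
                      (proj₂ (∈-filter⁻ (λ S → ¬? (X₀ ⊆ˢ? S)) {xs = 𝓢} S∈))))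
                    (≤-reflexive (*-identityʳ (qn 2)))

      module _ (near : Near 𝓢) where

        near∈ : ∀ {S S′} → S ∈ₗ 𝓢 → S′ ∈ₗ 𝓢 → t ≤ dim (S ⊓ S′)
        near∈ S∈ S′∈ = All.lookup (All.lookup near S∈) S′∈

        -- Members of a near list share a row or a column of the grid: otherwise `T₁` and `T₂` both
        -- lie in `S ⊞ S′`, whose dimension is at most t + 2, while `T₁ ⊞ T₂` has dimension at least
        -- t + 3.
        agree : ∀ {S S′} → S ∈ₗ 𝓢 → S′ ∈ₗ 𝓢 → S ⊓ T₁ ⊆ˢ S′ ⊎ S ⊓ T₂ ⊆ˢ S′
        agree {S} {S′} S∈ S′∈ with S ⊓ T₁ ⊆ˢ? S′ | S ⊓ T₂ ⊆ˢ? S′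
        ... | yes f | _ = inj₁ f
        ... | no _ | yes g = inj₂ g
        ... | no ¬f | no ¬g = contradiction (begin
            suc t + suc t  ≡⟨ cong₂ _+_ (dimT T₁∈) (dimT T₂∈) ⟨
            dim T₁ + dim T₂  ≡⟨ dim-modular T₁ T₂ ⟨
            dim (T₁ ⊞ T₂) + dim P  ≤⟨ +-monoˡ-≤ (dim P) (dim-mono (⊞-least (inS⊞ T₁∈ ¬f) (inS⊞ T₂∈ ¬g))) ⟩
            dim (S ⊞ S′) + dim P  ≤⟨ +-monoˡ-≤ (dim P) (dim-⊞-near (dimS S∈) (dimS S′∈) (near∈ S∈ S′∈)) ⟩
            2 + t + dim P  ≡⟨ cong suc (+-suc t (dim P)) ⟨
            suc t + suc (dim P)  ∎) (<⇒≱ (+-monoʳ-< (suc t) (s≤s far)))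
          where
          open ≤-Reasoning
          inS⊞ : ∀ {T} → T ∈ₗ 𝓣 → ¬ (S ⊓ T ⊆ˢ S′) → T ⊆ˢ S ⊞ S′
          inS⊞ T∈ ¬f = ⊆-trans (sum-fills ∩-⊆ʳ ∩-⊆ʳ (dimT T∈) (cross S′∈ T∈) (λ f → ¬f (⊆-trans f ∩-⊆ˡ)))
                               (⊞-least (⊆-trans ∩-⊆ˡ ⊞-⊆ˡ) (⊆-trans ∩-⊆ˡ ⊞-⊆ʳ))

        -- A grid argument: when two cells share a row but not a column, any cell sharing a row or a
        -- column with each of them lies in the same row.
        same-row : ∀ {S₁ S₂} → S₁ ∈ₗ 𝓢 → S₂ ∈ₗ 𝓢 → S₂ ⊓ T₁ ⊆ˢ S₁ → ¬ (S₁ ⊓ T₂ ⊆ˢ S₂) → length 𝓢 ≤ qn 2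
        same-row {S₁} {S₂} S₁∈ S₂∈ X₂⊆X₁ Y₁⊈Y₂ = ≤-trans (≤-reflexive (#-all (All.tabulate all)))
            (row T₂∈ dX (⊈T₂ ∩-⊆ʳ (≤-reflexive (sym dX))))
          where
          dX : dim (S₁ ⊓ T₁) ≡ t
          dX = ≤-antisym (meet≤ (dimS S₁∈) (λ f → ⊈T₂ {S₁ ⊓ T₂} (⊆-trans ∩-⊆ˡ f) (cross S₁∈ T₂∈) ∩-⊆ʳ)) (cross S₁∈ T₁∈)
          X₁⊆X₂ : S₁ ⊓ T₁ ⊆ˢ S₂ ⊓ T₁
          X₁⊆X₂ = ⊆-dim⇒⊇ (∩-greatest X₂⊆X₁ ∩-⊆ʳ) (≤-trans (≤-reflexive dX) (cross S₂∈ T₁∈))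
          dY : ∀ {S} → S ∈ₗ 𝓢 → dim (S ⊓ T₂) ≤ t
          dY {S} S∈ = meet≤ (dimS S∈) (λ f → <⇒≱ far (≤-trans (cross S∈ T₁∈) (dim-mono (∩-greatest ∩-⊆ʳ (⊆-trans ∩-⊆ˡ f)))))
          all : ∀ {S} → S ∈ₗ 𝓢 → S₁ ⊓ T₁ ⊆ˢ S
          all {S} S∈ with S₁ ⊓ T₁ ⊆ˢ? S
          ... | yes f = f
          ... | no ¬f with agree S₁∈ S∈ | agree S∈ S₂∈
          ...   | inj₁ f | _ = f
          ...   | inj₂ g | inj₂ h = contradiction (⊆-trans (∩-greatest g ∩-⊆ʳ) h) Y₁⊈Y₂
          ...   | inj₂ g | inj₁ h = ⊆-trans X₁⊆X₂ (⊆-trans (⊆-dim⇒⊇ (∩-greatest h ∩-⊆ʳ)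
                    (≤-trans (dim-mono X₂⊆) (≤-trans (≤-reflexive dX) (cross S∈ T₁∈)))) ∩-⊆ˡ)
              where X₂⊆ : S₂ ⊓ T₁ ⊆ˢ S₁ ⊓ T₁
                    X₂⊆ = ∩-greatest X₂⊆X₁ ∩-⊆ʳ

        row-bound : ∀ {S₁ S₂} → S₁ ∈ₗ 𝓢 → S₂ ∈ₗ 𝓢 → ¬ (S₁ ≐ S₂) → S₂ ⊓ T₁ ⊆ˢ S₁ → length 𝓢 ≤ qn 2
        row-bound {S₁} {S₂} S₁∈ S₂∈ S₁≢S₂ X₂⊆S₁ = same-row S₁∈ S₂∈ X₂⊆S₁ λ Y₁⊆S₂ → S₁≢S₂ (≐-of-⊆ (dimS S₁∈) (dimS S₂∈)
          (⊆-trans (sum-fills ∩-⊆ˡ ∩-⊆ˡ (dimS S₁∈) (cross S₁∈ T₂∈) (λ f → ⊈T₂ {S₁ ⊓ T₁} ∩-⊆ʳ (cross S₁∈ T₁∈) (⊆-trans f ∩-⊆ʳ)))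
                   (⊞-least (⊆-trans X₁⊆X₂ ∩-⊆ˡ) Y₁⊆S₂)))
          where
          X₁⊆X₂ : S₁ ⊓ T₁ ⊆ˢ S₂ ⊓ T₁
          X₁⊆X₂ = ⊆-dim⇒⊇ (∩-greatest X₂⊆S₁ ∩-⊆ʳ) (≤-trans (meet≤ (dimS S₁∈) (λ f → ⊈T₂ {S₁ ⊓ T₂} (⊆-trans ∩-⊆ˡ f) (cross S₁∈ T₂∈) ∩-⊆ʳ)) (cross S₂∈ T₁∈))

    -- If the traces of `S₁` and `S₂` on `T` differ, they fill `T`; if not, the common trace lies in
    -- `S₁ ⊓ S₂` and equals it by dimension.
    near-bound : ∀ {S₁ S₂} → S₁ ∈ₗ 𝓢 → S₂ ∈ₗ 𝓢 → ¬ (S₁ ≐ S₂) → t ≤ dim (S₁ ⊓ S₂) → ∀ {T} → T ∈ₗ 𝓣 → S₁ ⊓ S₂ ⊆ˢ T ⊎ T ⊆ˢ S₁ ⊞ S₂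
    near-bound {S₁} {S₂} S₁∈ S₂∈ S₁≢S₂ near {T} T∈ with S₁ ⊓ T ⊆ˢ? S₂ ⊓ T
    ... | no ¬f = inj₂ (⊆-trans (sum-fills ∩-⊆ʳ ∩-⊆ʳ (dimT T∈) (cross S₂∈ T∈) ¬f) (⊞-least (⊆-trans ∩-⊆ˡ ⊞-⊆ˡ) (⊆-trans ∩-⊆ˡ ⊞-⊆ʳ)))
    ... | yes f = inj₁ (⊆-trans (⊆-dim⇒⊇ (∩-greatest ∩-⊆ˡ (⊆-trans f ∩-⊆ˡ))
                    (≤-trans (meet≤ (dimS S₁∈) (λ g → S₁≢S₂ (≐-of-⊆ (dimS S₁∈) (dimS S₂∈) g))) (cross S₁∈ T∈))) ∩-⊆ʳ)

    dim-pair : ∀ {S₁ S₂} → S₁ ∈ₗ 𝓢 → S₂ ∈ₗ 𝓢 → ¬ (S₁ ≐ S₂) → t ≤ dim (S₁ ⊓ S₂) → dim (S₁ ⊓ S₂) ≡ t × dim (S₁ ⊞ S₂) ≡ 2 + t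
    dim-pair S₁∈ S₂∈ S₁≢S₂ near = ≤-antisym (meet≤ (dimS S₁∈) (λ g → S₁≢S₂ (≐-of-⊆ (dimS S₁∈) (dimS S₂∈) g))) near
                                , ≤-antisym (dim-⊞-near (dimS S₁∈) (dimS S₂∈) near) (dim-⊞-distinct (dimS S₁∈) (dimS S₂∈) S₁≢S₂)

    near-length : ∀ {S₁ S₂} → S₁ ∈ₗ 𝓢 → S₂ ∈ₗ 𝓢 → ¬ (S₁ ≐ S₂) → t ≤ dim (S₁ ⊓ S₂) → length 𝓣 ≤ c + qn (2 + t)
    near-length {S₁} {S₂} S₁∈ S₂∈ S₁≢S₂ near = begin
      length 𝓣  ≡⟨ ∑-1 𝓣 ⟨
      ∑ 𝓣 (λ _ → 1)  ≤⟨ ∑-mono-All (All.tabulate λ {T} T∈ → ι-⊎≤ (yes T∈) (E ⊆ˢ? T) (T ⊆ˢ? Q) (near-bound S₁∈ S₂∈ S₁≢S₂ near)) ⟩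
      ∑ 𝓣 (λ T → ι (E ⊆ˢ? T) + ι (T ⊆ˢ? Q))  ≡⟨ ∑-+ 𝓣 _ _ ⟩
      # 𝓣 ∋ E + ∑ 𝓣 (λ T → ι (T ⊆ˢ? Q))  ≡⟨ cong (# 𝓣 ∋ E +_) (length-filter-ι (_⊆ˢ? Q) 𝓣) ⟨
      # 𝓣 ∋ E + length (within Q 𝓣)  ≤⟨ +-mono-≤ (starT E dE) (length-hyperplanes (AllPairsP.filter⁺ (_⊆ˢ? Q) distT)
                                                          (λ A∈ → dimT (proj₁ (∈-filter⁻ (_⊆ˢ? Q) A∈))) dQ (AllP.all-filter (_⊆ˢ? Q) 𝓣)) ⟩
      c + qn (2 + t)  ∎
      where
      open ≤-Reasoning
      E = S₁ ⊓ S₂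
      Q = S₁ ⊞ S₂
      dE = proj₁ (dim-pair S₁∈ S₂∈ S₁≢S₂ near)
      dQ = proj₂ (dim-pair S₁∈ S₂∈ S₁≢S₂ near)

  near-far : ∀ {c 𝓢 𝓣} (L : CrossLists c 𝓢 𝓣) → Near 𝓢 → TwoMembers 𝓢 → FarPair 𝓣 → length 𝓢 ≤ qn 2
  near-far L near (S₁ , S₂ , S₁∈ , S₂∈ , S₁≢S₂) (T₁ , T₂ , T₁∈ , T₂∈ , far) with Far.agree L T₁∈ T₂∈ far near S₂∈ S₁∈
  ... | inj₁ f = Far.row-bound L T₁∈ T₂∈ far near S₁∈ S₂∈ S₁≢S₂ f
  ... | inj₂ g = Far.row-bound L T₂∈ T₁∈ (≤-<-trans (dim-mono (∩-comm T₂ T₁)) far) near S₁∈ S₂∈ S₁≢S₂ g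

  Sunflower Flat : List Subspace → List Subspace → Set
  Sunflower 𝓢 𝓣 = ∃ λ E → dim E ≡ t × All (E ⊆ˢ_) 𝓢 × All (E ⊆ˢ_) 𝓣
  Flat 𝓢 𝓣 = ∃ λ Z → dim Z ≡ 2 + t × All (_⊆ˢ Z) 𝓢 × All (_⊆ˢ Z) 𝓣

  -- Individually each member contains `T₁ ⊓ T₂` or lies in `T₁ ⊞ T₂`. The types do not mix: a
  -- member leaving `T₁ ⊞ T₂` meets it only in `T₁ ⊓ T₂`, and a near member inside `T₁ ⊞ T₂` must
  -- then contain that t-space.
  star-or-plane : ∀ {c 𝓢 𝓣} → CrossLists c 𝓢 𝓣 → Near 𝓢 → ∀ {T₁ T₂} → T₁ ∈ₗ 𝓣 → T₂ ∈ₗ 𝓣 → ¬ (T₁ ≐ T₂) → t ≤ dim (T₁ ⊓ T₂) →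
                  All (T₁ ⊓ T₂ ⊆ˢ_) 𝓢 ⊎ All (_⊆ˢ T₁ ⊞ T₂) 𝓢
  star-or-plane {𝓢 = 𝓢} L near {T₁} {T₂} T₁∈ T₂∈ T₁≢T₂ nT with All.all? (T₁ ⊓ T₂ ⊆ˢ?_) 𝓢 | All.all? (_⊆ˢ? T₁ ⊞ T₂) 𝓢
  ... | yes a | _     = inj₁ a
  ... | no _  | yes b = inj₂ b
  ... | no ¬a | no ¬b = contradiction mixed λ ()
    where
    open CrossLists L
    P = T₁ ⊓ T₂
    Q = T₁ ⊞ T₂
    mixed : 1 ≤ 0
    mixed with find∈ (AllP.¬All⇒Any¬ (P ⊆ˢ?_) 𝓢 ¬a) | find∈ (AllP.¬All⇒Any¬ (_⊆ˢ? Q) 𝓢 ¬b)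
    ... | S₁ , S₁∈ , P⊈S₁ | S₂ , S₂∈ , S₂⊈Q with near-bound (swapLists L) T₁∈ T₂∈ T₁≢T₂ nT S₁∈ | near-bound (swapLists L) T₁∈ T₂∈ T₁≢T₂ nT S₂∈
    ...   | inj₁ f    | _         = contradiction f P⊈S₁
    ...   | inj₂ _    | inj₂ g    = contradiction g S₂⊈Q
    ...   | inj₂ S₁⊆Q | inj₁ P⊆S₂ = contradiction (⊆-trans P⊆ ∩-⊆ˡ) P⊈S₁
      where
      S₂⊓Q⊆P : S₂ ⊓ Q ⊆ˢ P
      S₂⊓Q⊆P = ⊆-dim⇒⊇ (∩-greatest P⊆S₂ (⊆-trans ∩-⊆ˡ ⊞-⊆ˡ)) (≤-trans (meet≤ (dimS S₂∈) S₂⊈Q) nT)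
      P⊆ : P ⊆ˢ S₁ ⊓ S₂
      P⊆ = ⊆-dim⇒⊇ (⊆-trans (∩-greatest ∩-⊆ʳ (⊆-trans ∩-⊆ˡ S₁⊆Q)) S₂⊓Q⊆P)
        (≤-trans (≤-reflexive (proj₁ (dim-pair (swapLists L) T₁∈ T₂∈ T₁≢T₂ nT))) (All.lookup (All.lookup near S₁∈) S₂∈))

  -- The delicate case has 𝓣 inside `Q` while some `S₃` in 𝓢 leaves `Q`. Then `S₃ ⊓ Q` is `E`, so
  -- each `T`, meeting `S₃` in dimension t inside `Q`, contains `E`.
  star-case : ∀ {c 𝓢 𝓣} → CrossLists c 𝓢 𝓣 → Near 𝓢 → Near 𝓣 → TwoMembers 𝓢 → ∀ {E} → dim E ≡ t → All (E ⊆ˢ_) 𝓢 → Sunflower 𝓢 𝓣 ⊎ Flat 𝓢 𝓣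
  star-case {𝓢 = 𝓢} {𝓣} L nearS nearT (S₁ , S₂ , S₁∈ , S₂∈ , S₁≢S₂) {E} dE E⊆𝓢 = go (star-or-plane (swapLists L) nearT S₁∈ S₂∈ S₁≢S₂ nS)
    where
    open CrossLists L
    Q = S₁ ⊞ S₂
    nS : t ≤ dim (S₁ ⊓ S₂)
    nS = All.lookup (All.lookup nearS S₁∈) S₂∈
    E⊆S₁⊓S₂ : E ⊆ˢ S₁ ⊓ S₂
    E⊆S₁⊓S₂ = ∩-greatest (All.lookup E⊆𝓢 S₁∈) (All.lookup E⊆𝓢 S₂∈)
    go : All (S₁ ⊓ S₂ ⊆ˢ_) 𝓣 ⊎ All (_⊆ˢ Q) 𝓣 → Sunflower 𝓢 𝓣 ⊎ Flat 𝓢 𝓣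
    go (inj₁ a) = inj₁ (E , dE , E⊆𝓢 , All.map (⊆-trans E⊆S₁⊓S₂) a)
    go (inj₂ b) with All.all? (_⊆ˢ? Q) 𝓢
    ... | yes a = inj₂ (Q , proj₂ (dim-pair L S₁∈ S₂∈ S₁≢S₂ nS) , a , b)
    ... | no ¬a = let S₃ , S₃∈ , S₃⊈Q = find∈ (AllP.¬All⇒Any¬ (_⊆ˢ? Q) 𝓢 ¬a) in
      inj₁ (E , dE , E⊆𝓢 , All.tabulate λ {T} T∈ → ⊆-trans
        (⊆-dim⇒⊇ (⊆-trans (∩-mono ⊆-refl (All.lookup b T∈)) (S₃⊓Q⊆E S₃∈ S₃⊈Q)) (≤-trans (≤-reflexive dE) (cross S₃∈ T∈))) ∩-⊆ʳ)
      where
      S₃⊓Q⊆E : ∀ {S₃} → S₃ ∈ₗ 𝓢 → ¬ (S₃ ⊆ˢ Q) → S₃ ⊓ Q ⊆ˢ E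
      S₃⊓Q⊆E S₃∈ S₃⊈Q = ⊆-dim⇒⊇ (∩-greatest (All.lookup E⊆𝓢 S₃∈) (⊆-trans E⊆S₁⊓S₂ (⊆-trans ∩-⊆ˡ ⊞-⊆ˡ)))
                          (≤-trans (meet≤ (dimS S₃∈) S₃⊈Q) (≤-reflexive (sym dE)))

  near-near : ∀ {c 𝓢 𝓣} → CrossLists c 𝓢 𝓣 → Near 𝓢 → Near 𝓣 → TwoMembers 𝓢 → TwoMembers 𝓣 → Sunflower 𝓢 𝓣 ⊎ Flat 𝓢 𝓣
  near-near {𝓢 = 𝓢} {𝓣} L nearS nearT twoS@(S₁ , S₂ , S₁∈ , S₂∈ , S₁≢S₂) twoT@(T₁ , T₂ , T₁∈ , T₂∈ , T₁≢T₂)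
    with star-or-plane L nearS T₁∈ T₂∈ T₁≢T₂ nT | star-or-plane (swapLists L) nearT S₁∈ S₂∈ S₁≢S₂ nS
    where nT = All.lookup (All.lookup nearT T₁∈) T₂∈
          nS = All.lookup (All.lookup nearS S₁∈) S₂∈
  ... | inj₁ a | _ = star-case L nearS nearT twoS (proj₁ (dim-pair (swapLists L) T₁∈ T₂∈ T₁≢T₂ (All.lookup (All.lookup nearT T₁∈) T₂∈))) a
  ... | inj₂ _ | inj₁ b with star-case (swapLists L) nearT nearS twoT (proj₁ (dim-pair L S₁∈ S₂∈ S₁≢S₂ (All.lookup (All.lookup nearS S₁∈) S₂∈))) b
  ...   | inj₁ (E , dE , x , y) = inj₁ (E , dE , y , x)
  ...   | inj₂ (Z , dZ , x , y) = inj₂ (Z , dZ , y , x)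
  near-near {𝓢 = 𝓢} {𝓣} L nearS nearT twoS@(S₁ , S₂ , S₁∈ , S₂∈ , S₁≢S₂) twoT@(T₁ , T₂ , T₁∈ , T₂∈ , T₁≢T₂)
      | inj₂ a | inj₂ b = inj₂ (T₁ ⊞ T₂ , dQ , a , All.map (λ f → ⊆-trans f (⊞-least (All.lookup a S₁∈) (All.lookup a S₂∈))) b)
    where dQ = proj₂ (dim-pair (swapLists L) T₁∈ T₂∈ T₁≢T₂ (All.lookup (All.lookup nearT T₁∈) T₂∈))

  module _ {c μ : ℕ} (c≤μ : c ≤ μ) (q≤μ : qn (2 + t) ≤ μ) (1≤t : 1 ≤ t) where

    private
      -- Far pairs lead to bounds that are multiples of `qn 2`. With t ≥ 1, `μ` is at least `qn 3`,
      -- which exceeds `2 * qn 2` even for q = 2.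
      2σ<μ : qn 2 + qn 2 < μ
      2σ<μ = <-≤-trans 2*qn2<qn3 (≤-trans (qn-mono (+-monoʳ-≤ 2 1≤t)) q≤μ)

      0<μ : 0 < μ
      0<μ = ≤-<-trans z≤n 2σ<μ

    one-member : ∀ {𝓢 𝓣} → CrossLists c 𝓢 𝓣 → length 𝓢 ≤ 1 → length 𝓢 * length 𝓣 < μ * μ
    one-member {[]}    L _ = *-mono-≤ 0<μ 0<μ
    one-member {S ∷ 𝓢} {𝓣} L ≤1 = begin-strict
      length (S ∷ 𝓢) * length 𝓣  ≤⟨ *-mono-≤ ≤1 (single (swapLists L) (here refl)) ⟩
      1 * (qn (suc t) * c)  ≡⟨ *-identityˡ _ ⟩
      qn (suc t) * c  ≤⟨ *-monoʳ-≤ (qn (suc t)) c≤μ ⟩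
      qn (suc t) * μ  <⟨ *-monoˡ-< μ {{>-nonZero 0<μ}} (<-≤-trans (qn-mono-< (n<1+n (suc t))) q≤μ) ⟩
      μ * μ  ∎
      where open ≤-Reasoning

    four-σ² : ∀ {a b} → a ≤ qn 2 + qn 2 → b ≤ qn 2 + qn 2 → a * b < μ * μ
    four-σ² a≤ b≤ = *-mono-< (≤-<-trans a≤ 2σ<μ) (≤-<-trans b≤ 2σ<μ)

    two-σ² : ∀ {a b} → a ≤ 2 → b ≤ qn 2 * qn 2 → a * b < μ * μ
    two-σ² {a} {b} a≤ b≤ = begin-strict
      a * b  ≤⟨ *-mono-≤ a≤ b≤ ⟩
      2 * (qn 2 * qn 2)  ≤⟨ m≤m+n _ (2 * (qn 2 * qn 2)) ⟩
      2 * (qn 2 * qn 2) + 2 * (qn 2 * qn 2)  ≡⟨ lem (qn 2) ⟩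
      (qn 2 + qn 2) * (qn 2 + qn 2)  <⟨ *-mono-< 2σ<μ 2σ<μ ⟩
      μ * μ  ∎
      where open ≤-Reasoning
            lem : ∀ s → 2 * (s * s) + 2 * (s * s) ≡ (s + s) * (s + s)
            lem = solve-∀

    far-near : ∀ {𝓢 𝓣} → CrossLists c 𝓢 𝓣 → Near 𝓢 → TwoMembers 𝓢 → FarPair 𝓣 → length 𝓢 * length 𝓣 < μ * μ
    far-near {𝓢} {𝓣} L near two@(S₁ , S₂ , S₁∈ , S₂∈ , S₁≢S₂) far = begin-strict
      length 𝓢 * length 𝓣  ≤⟨ *-mono-≤ (near-far L near two far) (near-length L S₁∈ S₂∈ S₁≢S₂ (All.lookup (All.lookup near S₁∈) S₂∈)) ⟩
      qn 2 * (c + qn (2 + t))  ≤⟨ *-monoʳ-≤ (qn 2) (+-mono-≤ c≤μ q≤μ) ⟩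
      qn 2 * (μ + μ)  ≡⟨ lem (qn 2) μ ⟩
      (qn 2 + qn 2) * μ  <⟨ *-monoˡ-< μ {{>-nonZero 0<μ}} 2σ<μ ⟩
      μ * μ  ∎
      where open ≤-Reasoning
            lem : ∀ s m → s * (m + m) ≡ (s + s) * m
            lem = solve-∀

    far-far : ∀ {𝓢 𝓣} → CrossLists c 𝓢 𝓣 → FarPair 𝓢 → FarPair 𝓣 → length 𝓢 * length 𝓣 < μ * μ
    far-far {𝓢} {𝓣} L (S₁ , S₂ , S₁∈ , S₂∈ , farS) (T₁ , T₂ , T₁∈ , T₂∈ , farT)
      with third (CrossLists.distS L) S₁ S₂ | third (CrossLists.distT L) T₁ T₂
    ... | inj₁ ≤2 | _ = two-σ² ≤2 (Far.grid (swapLists L) S₁∈ S₂∈ farS)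
    ... | inj₂ _ | inj₁ ≤2 = subst (_< μ * μ) (*-comm (length 𝓣) (length 𝓢)) (two-σ² ≤2 (Far.grid L T₁∈ T₂∈ farT))
    ... | inj₂ (S₃ , S₃∈ , n₁ , n₂) | inj₂ (T₃ , T₃∈ , m₁ , m₂) =
      four-σ² (Far.three L T₁∈ T₂∈ farT T₃∈ m₁ m₂) (Far.three (swapLists L) S₁∈ S₂∈ farS S₃∈ n₁ n₂)

    classify : ∀ {𝓢 𝓣} → CrossLists c 𝓢 𝓣 → length 𝓢 * length 𝓣 < μ * μ ⊎ Sunflower 𝓢 𝓣 ⊎ Flat 𝓢 𝓣
    classify {𝓢} {𝓣} L with one-or-two (CrossLists.distS L) | one-or-two (CrossLists.distT L) | near-or-far 𝓢 | near-or-far 𝓣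
    ... | inj₁ ≤1 | _ | _ | _ = inj₁ (one-member L ≤1)
    ... | inj₂ _ | inj₁ ≤1 | _ | _ = inj₁ (subst (_< μ * μ) (*-comm (length 𝓣) (length 𝓢)) (one-member (swapLists L) ≤1))
    ... | inj₂ twoS | inj₂ twoT | inj₁ nearS | inj₁ nearT = inj₂ (near-near L nearS nearT twoS twoT)
    ... | inj₂ twoS | inj₂ twoT | inj₁ nearS | inj₂ farT  = inj₁ (far-near L nearS twoS farT)
    ... | inj₂ twoS | inj₂ twoT | inj₂ farS  | inj₁ nearT =
      inj₁ (subst (_< μ * μ) (*-comm (length 𝓣) (length 𝓢)) (far-near (swapLists L) nearT twoT farS))
    ... | inj₂ twoS | inj₂ twoT | inj₂ farS  | inj₂ farT  = inj₁ (far-far L farS farT)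

-- Admissible pairs and the two extremal constructions

module AdmissibleFamilies {q : ℕ} (𝔽 : FiniteField q) (n k t : ℕ) (1≤t : 1 ≤ t) (t<k : t < k) (n≥ : 4 * k + 6 ≤ n) where
  open SubspaceCounting 𝔽 n public

  k<n : k < n
  k<n = ≤-trans (≤-trans (m≤m+n (suc k) (3 * k + 5)) (≤-reflexive (lem k))) n≥
    where lem : ∀ k → suc k + (3 * k + 5) ≡ 4 * k + 6
          lem = solve-∀

  Cover : List Subspace → Subspace → Set
  Cover 𝓛 S = All (λ G → t ≤ dim (S ⊓ G)) 𝓛

  cover? : ∀ 𝓛 → Decidable (Cover 𝓛)
  cover? 𝓛 S = All.all? (λ G → t ≤? dim (S ⊓ G)) 𝓛

  cover-mono : ∀ {𝓛 S S′} → S ⊆ˢ S′ → Cover 𝓛 S → Cover 𝓛 S′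
  cover-mono f = All.map λ le → ≤-trans le (dim-mono (∩-mono f ⊆-refl))

  uncovered : ∀ {𝓛 S} → ¬ Cover 𝓛 S → ∃ λ G → G ∈ₗ 𝓛 × dim (S ⊓ G) < t
  uncovered {𝓛} {S} ¬c = let G , G∈ , ¬le = find∈ (AllP.¬All⇒Any¬ (λ G → t ≤? dim (S ⊓ G)) 𝓛 ¬c) in G , G∈ , ≰⇒> ¬le

  -- The condition that the common intersection has dimension below t, in the form in which it
  -- supplies members. It also makes the list nonempty, by taking `E` to be the whole space.
  SmallCore : List Subspace → Set
  SmallCore 𝓛 = ∀ E → t ≤ dim E → ∃ λ F → F ∈ₗ 𝓛 × ¬ (E ⊆ˢ F)

  record Adm (𝓕 𝓖 : List Subspace) : Set where
    field
      distF : Distinct 𝓕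
      distG : Distinct 𝓖
      dimF  : All (λ F → dim F ≡ k) 𝓕
      dimG  : All (λ G → dim G ≡ k) 𝓖
      cross : ∀ {F G} → F ∈ₗ 𝓕 → G ∈ₗ 𝓖 → t ≤ dim (F ⊓ G)
      ntF   : SmallCore 𝓕
      ntG   : SmallCore 𝓖

  swapAdm : ∀ {𝓕 𝓖} → Adm 𝓕 𝓖 → Adm 𝓖 𝓕
  swapAdm a = record { distF = distG ; distG = distF ; dimF = dimG ; dimG = dimF
                     ; cross = λ {G} {F} G∈ F∈ → ≤-trans (cross F∈ G∈) (dim-mono (∩-comm F G)) ; ntF = ntG ; ntG = ntF }
    where open Adm a

  Max : List Subspace → List Subspace → Set
  Max 𝓕 𝓖 = ∀ 𝓕′ 𝓖′ → Adm 𝓕′ 𝓖′ → length 𝓕′ * length 𝓖′ ≤ length 𝓕 * length 𝓖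

  swapMax : ∀ {𝓕 𝓖} → Max 𝓕 𝓖 → Max 𝓖 𝓕
  swapMax {𝓕} {𝓖} mx 𝓕′ 𝓖′ a = begin
    length 𝓕′ * length 𝓖′  ≡⟨ *-comm (length 𝓕′) _ ⟩
    length 𝓖′ * length 𝓕′  ≤⟨ mx 𝓖′ 𝓕′ (swapAdm a) ⟩
    length 𝓕 * length 𝓖  ≡⟨ *-comm (length 𝓕) _ ⟩
    length 𝓖 * length 𝓕  ∎
    where open ≤-Reasoning

  DimGE-⊓⇒ : ∀ {A B d} → DimGE (mem A ∩ mem B) d → d ≤ dim (A ⊓ B)
  DimGE-⊓⇒ {A} {B} {d} D = DimGE⇒≤dim {A ⊓ B} (subst (λ S → DimGE S d) (sym (mem-⊓ A B)) D)

  ⇒DimGE-⊓ : ∀ {A B d} → d ≤ dim (A ⊓ B) → DimGE (mem A ∩ mem B) d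
  ⇒DimGE-⊓ {A} {B} {d} le = subst (λ S → DimGE S d) (mem-⊓ A B) (≤dim⇒DimGE {A ⊓ B} le)

  ∈-family : ∀ {𝓛 : List Subspace} {F} → F ∈ₗ 𝓛 → Any (F ≐_) 𝓛
  ∈-family {F = F} F∈ = lose F∈ (≐-refl F)

  ⋂-intro : ∀ (𝓛 : List Subspace) v → All (λ F → v ∈ˢ F) 𝓛 → foldr (λ F b → mem F v ∧ b) true 𝓛 ≡ true
  ⋂-intro []      v []       = refl
  ⋂-intro (F ∷ 𝓛) v (p ∷ ps) = ∧-intro p (⋂-intro 𝓛 v ps)

  ⋂-elim : ∀ (𝓛 : List Subspace) v → foldr (λ F b → mem F v ∧ b) true 𝓛 ≡ true → All (λ F → v ∈ˢ F) 𝓛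
  ⋂-elim []      v _ = []
  ⋂-elim (F ∷ 𝓛) v e = proj₁ (∧-elim {mem F v} e) ∷ ⋂-elim 𝓛 v (proj₂ (∧-elim {mem F v} e))

  DimLT⇒SmallCore : ∀ (𝓕 : Family k) → DimLT (⋂ 𝓕) t → SmallCore (members 𝓕)
  DimLT⇒SmallCore 𝓕 lt E t≤ with All.all? (E ⊆ˢ?_) (members 𝓕)
  ... | no ¬a = find∈ (AllP.¬All⇒Any¬ (E ⊆ˢ?_) (members 𝓕) ¬a)
  ... | yes a = let bs , bs∈ , ind = ≤dim⇒DimGE {E} t≤ in
    contradiction (bs , VAll.map (λ {v} v∈ → ⋂-intro (members 𝓕) v (All.map (λ f → f .on v v∈) a)) bs∈ , ind) lt

  SmallCore⇒DimLT : ∀ (𝓕 : Family k) → SmallCore (members 𝓕) → DimLT (⋂ 𝓕) t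
  SmallCore⇒DimLT 𝓕 nt (bs , bs∈ , ind) = let F , F∈ , ¬f = nt (span bs) (DimGE⇒≤dim {span bs} (bs , span-contains bs , ind)) in
    ¬f (span-least (VAll.map (λ {v} p → All.lookup (⋂-elim (members 𝓕) v p) F∈) bs∈))

  fromAdmissible : ∀ {𝓕 𝓖 : Family k} → Admissible t 𝓕 𝓖 → Adm (members 𝓕) (members 𝓖)
  fromAdmissible {𝓕} {𝓖} (cr , ltF , ltG) = record
    { distF = distinct 𝓕 ; distG = distinct 𝓖
    ; dimF = All.map (λ {F} → HasDim⇒dim {F}) (allDim 𝓕) ; dimG = All.map (λ {F} → HasDim⇒dim {F}) (allDim 𝓖)
    ; cross = λ {F} {G} F∈ G∈ → DimGE-⊓⇒ {F} {G} (cr F G (∈-family F∈) (∈-family G∈))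
    ; ntF = DimLT⇒SmallCore 𝓕 ltF ; ntG = DimLT⇒SmallCore 𝓖 ltG }

  toFamily : ∀ 𝓛 → Distinct 𝓛 → All (λ F → dim F ≡ k) 𝓛 → Family k
  toFamily 𝓛 dist dims = record { members = 𝓛 ; allDim = All.map (λ {F} → dim⇒HasDim {F}) dims ; distinct = dist }

  toAdmissible : ∀ {𝓕 𝓖} (a : Adm 𝓕 𝓖) → Admissible t (toFamily 𝓕 (Adm.distF a) (Adm.dimF a)) (toFamily 𝓖 (Adm.distG a) (Adm.dimG a))
  toAdmissible {𝓕} {𝓖} a = cr , SmallCore⇒DimLT 𝓕′ ntF , SmallCore⇒DimLT 𝓖′ ntG
    where
    open Adm a
    𝓕′ = toFamily 𝓕 distF dimF
    𝓖′ = toFamily 𝓖 distG dimG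
    cr : CrossIntersecting t 𝓕′ 𝓖′
    cr F G F∈ G∈ = let F₀ , F₀∈ , e = find∈ F∈ ; G₀ , G₀∈ , e′ = find∈ G∈ in
      ⇒DimGE-⊓ {F} {G} (≤-trans (cross F₀∈ G₀∈) (dim-mono (∩-mono (≐⇒⊇ F F₀ e) (≐⇒⊇ G G₀ e′))))

  -- Adding a missing `W` would keep the pair admissible and, as 𝓖 is nonempty, raise the product.
  saturated : ∀ {𝓕 𝓖} → Adm 𝓕 𝓖 → Max 𝓕 𝓖 → ∀ W → dim W ≡ k → Cover 𝓖 W → Any (W ≐_) 𝓕
  saturated {𝓕} {𝓖} a mx W dW cov with Any.any? (W ≐?_) 𝓕
  ... | yes W∈ = W∈
  ... | no W∉ = contradiction (mx (W ∷ 𝓕) 𝓖 a′) (<⇒≱ (*-monoˡ-< (length 𝓖) {{G≢[]}} (n<1+n (length 𝓕))))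
    where
    open Adm a
    G≢[] : NonZero (length 𝓖)
    G≢[] with ntG 1ˢ (≤-trans (<⇒≤ (<-trans t<k k<n)) (≤-reflexive (sym dim-1ˢ)))
    ... | _ , here _  , _ = _
    ... | _ , there _ , _ = _
    a′ : Adm (W ∷ 𝓕) 𝓖
    a′ = record { distF = AllP.¬Any⇒All¬ 𝓕 W∉ ∷ distF ; distG = distG ; dimF = dW ∷ dimF ; dimG = dimG
                ; cross = λ { (here refl) G∈ → All.lookup cov G∈ ; (there F∈) G∈ → cross F∈ G∈ }
                ; ntF = λ E t≤ → let F , F∈ , ¬f = ntF E t≤ in F , there F∈ , ¬f ; ntG = ntG }

  dim-meet≥ : ∀ {A B U} → A ⊆ˢ U → B ⊆ˢ U → dim A + dim B ≤ dim U + dim (A ⊓ B)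
  dim-meet≥ {A} {B} f g = ≤-trans (≤-reflexive (sym (dim-modular A B))) (+-monoˡ-≤ (dim (A ⊓ B)) (dim-mono (⊞-least f g)))

  avoid : ∀ {W m S} v → v ∉ˢ S → S ⊆ˢ W → dim S ≤ m → m < dim W → ∃ λ F → S ⊆ˢ F × F ⊆ˢ W × dim F ≡ m × v ∉ˢ F
  avoid {W} {m} {S} v v∉ S⊆W s≤m m<W =
    let F , S⊆F , F⊆W , dF , h = extend S ⟨ v ⟩ S⊆W s≤m bound
    in F , S⊆F , F⊆W , dF , λ v∈F → v∉ (h .on v (∈⊓-intro {F} {⟨ v ⟩} v∈F (∈⟨⟩ v)))
    where
    open ≤-Reasoning
    bound : (m ∸ dim S) + dim (S +ᵛ v) ≤ dim W
    bound = begin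
      (m ∸ dim S) + dim (S +ᵛ v)  ≡⟨ cong ((m ∸ dim S) +_) (dim-+ᵛ v∉) ⟩
      (m ∸ dim S) + suc (dim S)  ≡⟨ +-suc (m ∸ dim S) (dim S) ⟩
      suc ((m ∸ dim S) + dim S)  ≡⟨ cong suc (m∸n+n≡m s≤m) ⟩
      suc m  ≤⟨ m<W ⟩
      dim W  ∎

  -- Covers of the two sides meet: a cover S of 𝓖 extends to a member of 𝓕 that gains nothing inside T.
  cover-cross : ∀ {𝓕 𝓖} → Adm 𝓕 𝓖 → Max 𝓕 𝓖 → ∀ {S T} → dim S ≡ suc t → dim T ≡ suc t → Cover 𝓖 S → Cover 𝓕 T → t ≤ dim (S ⊓ T)
  cover-cross {𝓕} {𝓖} a mx {S} {T} dS dT covS covT =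
    let F , S⊆F , _ , dF , h = extend {1ˢ} S T ⊆1ˢ (≤-trans (≤-reflexive dS) t<k) bound
        F₀ , F₀∈ , e = find∈ (saturated a mx F dF (cover-mono S⊆F covS))
    in ≤-trans (All.lookup covT F₀∈) (dim-mono (∩-greatest (⊆-trans (∩-greatest (⊆-trans ∩-⊆ʳ (≐⇒⊇ F F₀ e)) ∩-⊆ˡ) h) ∩-⊆ˡ))
    where
    open ≤-Reasoning
    bound : (k ∸ dim S) + dim (S ⊞ T) ≤ dim 1ˢ
    bound = begin
      (k ∸ dim S) + dim (S ⊞ T)  ≤⟨ +-mono-≤ (m∸n≤m k (dim S)) (≤-trans (m≤m+n _ _) (≤-reflexive (dim-modular S T))) ⟩
      k + (dim S + dim T)  ≡⟨ cong₂ (λ x y → k + (x + y)) dS dT ⟩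
      k + (suc t + suc t)  ≤⟨ +-monoʳ-≤ k (+-mono-≤ t<k t<k) ⟩
      k + (k + k)  ≤⟨ m≤m+n _ (k + 6) ⟩
      k + (k + k) + (k + 6)  ≡⟨ lem k ⟩
      4 * k + 6  ≤⟨ n≥ ⟩
      n  ≡⟨ dim-1ˢ ⟨
      dim 1ˢ  ∎
      where lem : ∀ k → k + (k + k) + (k + 6) ≡ 4 * k + 6
            lem = solve-∀

  nonzero∈ : ∀ {E} → t ≤ dim E → ∃ λ v → v ∈ˢ E × v ∉ˢ 0ˢ
  nonzero∈ {E} t≤ = ⊈⇒∃ λ f → <⇒≱ (≤-trans 1≤t t≤) (≤-trans (dim-mono f) (≤-reflexive dim-0ˢ))

  listed : ∀ {P : Subspace → Set} (P? : Decidable P) → (∀ {A B} → A ≐ B → P A → P B) → ∀ F → dim F ≡ k → P F →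
           ∃ λ F′ → F′ ∈ₗ filter P? (subs k) × F ≐ F′
  listed P? resp F refl pF = let F′ , F′∈ , e = find∈ (subs-complete F) in F′ , ∈-filter⁺ P? F′∈ (resp {F} {F′} e pF) , e

  module _ {P : Subspace → Set} (P? : Decidable P) where
    filter-distinct : Distinct (filter P? (subs k))
    filter-distinct = AllPairsP.filter⁺ P? (subs-distinct k)

    filter-dim : All (λ F → dim F ≡ k) (filter P? (subs k))
    filter-dim = AllP.filter⁺ P? (subs-dim k)

    filter-holds : ∀ {F} → F ∈ₗ filter P? (subs k) → P F
    filter-holds F∈ = proj₂ (∈-filter⁻ P? {xs = subs k} F∈)

  InH₂ : Subspace → Subspace → Set
  InH₂ Z F = suc t ≤ dim (F ⊓ Z)

  inH₂? : ∀ Z → Decidable (InH₂ Z)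
  inH₂? Z F = suc t ≤? dim (F ⊓ Z)

  h₂ : Subspace → List Subspace
  h₂ Z = filter (inH₂? Z) (subs k)

  h₂-cross : ∀ {Z} → dim Z ≡ 2 + t → ∀ {F G} → InH₂ Z F → InH₂ Z G → t ≤ dim (F ⊓ G)
  h₂-cross {Z} dZ {F} {G} f g = +-cancelˡ-≤ (2 + t) _ _ (begin
    2 + t + t  ≡⟨ cong suc (+-suc t t) ⟨
    suc t + suc t  ≤⟨ +-mono-≤ f g ⟩
    dim (F ⊓ Z) + dim (G ⊓ Z)  ≤⟨ dim-meet≥ {F ⊓ Z} {G ⊓ Z} {Z} ∩-⊆ʳ ∩-⊆ʳ ⟩
    dim Z + dim ((F ⊓ Z) ⊓ (G ⊓ Z))  ≤⟨ +-mono-≤ (≤-reflexive dZ) (dim-mono (∩-mono ∩-⊆ˡ ∩-⊆ˡ)) ⟩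
    2 + t + dim (F ⊓ G)  ∎)
    where open ≤-Reasoning

  h₂-nontrivial : ∀ {Z} → dim Z ≡ 2 + t → SmallCore (h₂ Z)
  h₂-nontrivial {Z} dZ E t≤ =
    let v , v∈ , v∉0 = nonzero∈ {E} t≤
        D , _ , D⊆Z , dD , v∉D = avoid {Z} {suc t} v v∉0 0ˢ⊆ (dim-0ˢ≤) (≤-reflexive (sym dZ))
        F , D⊆F , _ , dF , v∉F = avoid {1ˢ} {k} v v∉D ⊆1ˢ (≤-trans (≤-reflexive dD) t<k) (≤-trans k<n (≤-reflexive (sym dim-1ˢ)))
        F′ , F′∈ , e = listed (inH₂? Z) (λ {A} {B} e a → ≤-trans a (dim-mono (∩-mono (≐⇒⊆ A B e) ⊆-refl))) F dF
                         (≤-trans (≤-reflexive (sym dD)) (dim-mono (∩-greatest D⊆F D⊆Z)))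
    in F′ , F′∈ , λ f → v∉F (≐⇒⊇ F F′ e .on v (f .on v v∈))

  h₂-adm : ∀ {Z} → dim Z ≡ 2 + t → Adm (h₂ Z) (h₂ Z)
  h₂-adm {Z} dZ = record
    { distF = filter-distinct (inH₂? Z) ; distG = filter-distinct (inH₂? Z) ; dimF = filter-dim (inH₂? Z) ; dimG = filter-dim (inH₂? Z)
    ; cross = λ {F} {G} F∈ G∈ → h₂-cross dZ {F} {G} (filter-holds (inH₂? Z) F∈) (filter-holds (inH₂? Z) G∈)
    ; ntF = h₂-nontrivial dZ ; ntG = h₂-nontrivial dZ }

  InH₁ : Subspace → Subspace → Subspace → Subspace → Set
  InH₁ L M E F = (E ⊆ˢ F × suc t ≤ dim (F ⊓ L)) ⊎ (F ⊆ˢ M × ¬ (E ⊆ˢ F))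

  inH₁? : ∀ L M E → Decidable (InH₁ L M E)
  inH₁? L M E F = ((E ⊆ˢ? F) ×-dec (suc t ≤? dim (F ⊓ L))) ⊎-dec ((F ⊆ˢ? M) ×-dec ¬? (E ⊆ˢ? F))

  inH₁-resp : ∀ L M E {A B} → A ≐ B → InH₁ L M E A → InH₁ L M E B
  inH₁-resp L M E {A} {B} e (inj₁ (f , le)) = inj₁ (⊆-trans f (≐⇒⊆ A B e) , ≤-trans le (dim-mono (∩-mono (≐⇒⊆ A B e) ⊆-refl)))
  inH₁-resp L M E {A} {B} e (inj₂ (g , ¬f)) = inj₂ (⊆-trans (≐⇒⊇ A B e) g , λ f → ¬f (⊆-trans f (≐⇒⊇ A B e)))

  h₁ : Subspace → Subspace → Subspace → List Subspace
  h₁ L M E = filter (inH₁? L M E) (subs k)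

  record Frame (L M E : Subspace) : Set where
    field
      dL  : dim L ≡ suc k
      dM  : dim M ≡ suc k
      dE  : dim E ≡ t
      E⊆L : E ⊆ˢ L
      E⊆M : E ⊆ˢ M

  swapFrame : ∀ {L M E} → Frame L M E → Frame M L E
  swapFrame f = record { dL = dM ; dM = dL ; dE = dE ; E⊆L = E⊆M ; E⊆M = E⊆L }
    where open Frame f

  private
    h₁-cross₂ : ∀ {L F G} → dim L ≡ suc k → suc t ≤ dim (F ⊓ L) → G ⊆ˢ L → dim G ≡ k → t ≤ dim (F ⊓ G)
    h₁-cross₂ {L} {F} {G} dL le G⊆L dG = +-cancelʳ-≤ (suc k) _ _ (begin
      t + suc k  ≡⟨ +-suc t k ⟩
      suc t + k  ≤⟨ +-mono-≤ le (≤-reflexive (sym dG)) ⟩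
      dim (F ⊓ L) + dim G  ≤⟨ dim-meet≥ {F ⊓ L} {G} {L} ∩-⊆ʳ G⊆L ⟩
      dim L + dim ((F ⊓ L) ⊓ G)  ≤⟨ +-mono-≤ (≤-reflexive dL) (dim-mono (∩-mono ∩-⊆ˡ ⊆-refl)) ⟩
      suc k + dim (F ⊓ G)  ≡⟨ +-comm (suc k) _ ⟩
      dim (F ⊓ G) + suc k  ∎)
      where open ≤-Reasoning

  hyperplane-meet : ∀ {M F D} → dim M ≡ suc k → dim F ≡ k → F ⊆ˢ M → D ⊆ˢ M → dim D ≤ suc (dim (F ⊓ D))
  hyperplane-meet {M} {F} {D} dM dF F⊆M D⊆M = +-cancelˡ-≤ k _ _ (begin
    k + dim D  ≡⟨ cong (_+ dim D) dF ⟨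
    dim F + dim D  ≤⟨ dim-meet≥ F⊆M D⊆M ⟩
    dim M + dim (F ⊓ D)  ≡⟨ cong (_+ dim (F ⊓ D)) dM ⟩
    suc k + dim (F ⊓ D)  ≡⟨ +-suc k _ ⟨
    k + suc (dim (F ⊓ D))  ∎)
    where open ≤-Reasoning

  -- The bound on `dim (M ⊓ L)` serves the last case: hyperplanes of `M` and of `L` cut `M ⊓ L` in
  -- codimension at most 1 each.
  h₁-cross : ∀ {L M E} → Frame L M E → 2 + t ≤ dim (M ⊓ L) → ∀ {F G} → dim F ≡ k → dim G ≡ k →
             InH₁ L M E F → InH₁ M L E G → t ≤ dim (F ⊓ G)
  h₁-cross fr le dF dG (inj₁ (E⊆F , _)) (inj₁ (E⊆G , _)) = ≤-trans (≤-reflexive (sym (Frame.dE fr))) (dim-mono (∩-greatest E⊆F E⊆G))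
  h₁-cross fr le dF dG (inj₁ (_ , x)) (inj₂ (G⊆L , _)) = h₁-cross₂ (Frame.dL fr) x G⊆L dG
  h₁-cross fr le {F} {G} dF dG (inj₂ (F⊆M , _)) (inj₁ (_ , x)) = ≤-trans (h₁-cross₂ (Frame.dM fr) x F⊆M dF) (dim-mono (∩-comm G F))
  h₁-cross {L} {M} fr le {F} {G} dF dG (inj₂ (F⊆M , _)) (inj₂ (G⊆L , _)) = s≤s⁻¹ (s≤s⁻¹ (≤-trans le (+-cancelˡ-≤ d _ _ (begin
    d + d  ≤⟨ +-mono-≤ (hyperplane-meet (Frame.dM fr) dF F⊆M ∩-⊆ˡ) (hyperplane-meet (Frame.dL fr) dG G⊆L ∩-⊆ʳ) ⟩
    suc (dim (F ⊓ D)) + suc (dim (G ⊓ D))  ≡⟨ cong suc (+-suc _ _) ⟩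
    2 + (dim (F ⊓ D) + dim (G ⊓ D))  ≤⟨ +-monoʳ-≤ 2 (dim-meet≥ {F ⊓ D} {G ⊓ D} {D} ∩-⊆ʳ ∩-⊆ʳ) ⟩
    2 + (d + dim ((F ⊓ D) ⊓ (G ⊓ D)))  ≤⟨ +-monoʳ-≤ 2 (+-monoʳ-≤ d (dim-mono (∩-mono ∩-⊆ˡ ∩-⊆ˡ))) ⟩
    2 + (d + dim (F ⊓ G))  ≡⟨ lem d (dim (F ⊓ G)) ⟩
    d + (2 + dim (F ⊓ G))  ∎))))
    where
    open ≤-Reasoning
    D = M ⊓ L
    d = dim D
    lem : ∀ d x → 2 + (d + x) ≡ d + (2 + x)
    lem = solve-∀

  h₁-nontrivial : ∀ {L M E} → Frame L M E → SmallCore (h₁ L M E)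
  h₁-nontrivial {L} {M} {E} fr E′ t≤ with E′ ⊆ˢ? E
  ... | yes E′⊆E =
    let v , v∈ , v∉0 = nonzero∈ {E′} t≤
        F , _ , F⊆M , dF , v∉F = avoid {M} {k} v v∉0 0ˢ⊆ (dim-0ˢ≤) (≤-reflexive (sym (Frame.dM fr)))
        F′ , F′∈ , e = listed (inH₁? L M E) (inH₁-resp L M E) F dF (inj₂ (F⊆M , λ f → v∉F (f .on v (E′⊆E .on v v∈))))
    in F′ , F′∈ , λ f → v∉F (≐⇒⊇ F F′ e .on v (f .on v v∈))
  ... | no E′⊈E =
    let v , v∈ , v∉E = ⊈⇒∃ E′⊈E
        -- Chosen outside `E +ᵛ v` so that `E +ᵛ x` does not contain `v`; `L` has room because k + 1
        -- > t + 1.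
        x , x∈L , x∉ = ⊈⇒∃ {L} {E +ᵛ v} λ f → <⇒≱ (s≤s t<k) (≤-trans (≤-reflexive (sym dL))
                         (≤-trans (dim-mono f) (≤-reflexive (trans (dim-+ᵛ v∉E) (cong suc dE)))))
        x∉E : x ∉ˢ E
        x∉E = λ x∈ → x∉ (⊆+ᵛ {E} .on x x∈)
        dEx : dim (E +ᵛ x) ≡ suc t
        dEx = trans (dim-+ᵛ x∉E) (cong suc dE)
        F , S⊆F , _ , dF , v∉F = avoid {1ˢ} {k} {E +ᵛ x} v (λ v∈S → x∉ (exchange v∈S v∉E .on x (∈+ᵛ {E}))) ⊆1ˢ
                                   (≤-trans (≤-reflexive dEx) t<k) (≤-trans k<n (≤-reflexive (sym dim-1ˢ)))
        F′ , F′∈ , e = listed (inH₁? L M E) (inH₁-resp L M E) F dF (inj₁ (⊆-trans ⊆+ᵛ S⊆F ,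
                         ≤-trans (≤-reflexive (sym dEx)) (dim-mono (∩-greatest S⊆F (+ᵛ-least E⊆L x∈L)))))
    in F′ , F′∈ , λ f → v∉F (≐⇒⊇ F F′ e .on v (f .on v v∈))
    where open Frame fr

  h₁-adm : ∀ {L M E} → Frame L M E → 2 + t ≤ dim (M ⊓ L) → Adm (h₁ L M E) (h₁ M L E)
  h₁-adm {L} {M} {E} fr le = record
    { distF = filter-distinct (inH₁? L M E) ; distG = filter-distinct (inH₁? M L E)
    ; dimF = filter-dim (inH₁? L M E) ; dimG = filter-dim (inH₁? M L E)
    ; cross = λ F∈ G∈ → h₁-cross fr le (All.lookup (filter-dim (inH₁? L M E)) F∈) (All.lookup (filter-dim (inH₁? M L E)) G∈)
                          (filter-holds (inH₁? L M E) F∈) (filter-holds (inH₁? M L E) G∈)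
    ; ntF = h₁-nontrivial fr ; ntG = h₁-nontrivial (swapFrame fr) }

  -- The units of the leading terms and of the next-order terms.
  A B : ℕ
  A = N n k (suc t)
  B = N n k (2 + t)

  N-antitone : ∀ {s s′} → s ≤ s′ → N n k s′ ≤ N n k s
  N-antitone {s} {s′} s≤s′ = subst (λ z → N n k z ≤ N n k s) (m+[n∸m]≡n s≤s′) (go (s′ ∸ s))
    where
    go : ∀ i → N n k (s + i) ≤ N n k s
    go i = ≤-trans (m≤n*m _ (q ^ ((n ∸ k) * i)) {{m^n≢0 q ((n ∸ k) * i)}}) (N-ratio^ s i (<⇒≤ k<n))

  -- Distinct hyperplanes of `Z` span `Z`, so a k-space not containing `Z` contains at most one of
  -- them. The `B` term corrects for the k-spaces through `Z`.
  h₂-lower : ∀ {Z} → dim Z ≡ 2 + t → qn (2 + t) * A ≤ length (h₂ Z) + qn (2 + t) * B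
  h₂-lower {Z} dZ = begin
    qn (2 + t) * A  ≡⟨ cong (_* A) size ⟨
    length 𝒵 * A  ≡⟨ ∑-const 𝒵 A ⟨
    ∑ 𝒵 (λ _ → A)  ≡⟨ ∑-cong-All (All.map (λ {D} d → trans (cong (N n k) (sym d)) (sym (#-subs k D))) dims) ⟩
    ∑ 𝒵 (λ D → # subs k ∋ D)  ≡⟨ ∑-swap 𝒵 (subs k) _ ⟩
    ∑ (subs k) (λ F → ∑ 𝒵 (λ D → ι (D ⊆ˢ? F)))  ≤⟨ ∑-mono (subs k) pt ⟩
    ∑ (subs k) (λ F → ι (inH₂? Z F) + ι (Z ⊆ˢ? F) * length 𝒵)  ≡⟨ ∑-+ (subs k) _ _ ⟩
    ∑ (subs k) (λ F → ι (inH₂? Z F)) + ∑ (subs k) (λ F → ι (Z ⊆ˢ? F) * length 𝒵)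
      ≡⟨ cong₂ _+_ (sym (length-filter-ι (inH₂? Z) (subs k))) (trans (∑-*ʳ (subs k) _ (length 𝒵)) (trans (cong₂ _*_ (trans (#-subs k Z) (cong (N n k) dZ)) size) (*-comm B _))) ⟩
    length (h₂ Z) + qn (2 + t) * B  ∎
    where
    open ≤-Reasoning
    𝒵 = within Z (subs (suc t))
    dims : All (λ D → dim D ≡ suc t) 𝒵
    dims = AllP.filter⁺ (_⊆ˢ? Z) (subs-dim (suc t))
    size : length 𝒵 ≡ qn (2 + t)
    size = begin-equality
      length 𝒵  ≡⟨ #-0ˢ 𝒵 ⟨
      # 𝒵 ∋ 0ˢ  ≡⟨ #-between 0ˢ⊆ (dim-0ˢ≤) ⟩
      G (dim Z ∸ dim 0ˢ) (suc t ∸ dim 0ˢ)  ≡⟨ cong₂ (λ x y → G (x ∸ y) (suc t ∸ y)) dZ dim-0ˢ ⟩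
      G (2 + t) (suc t)  ≡⟨ G-hyperplane (suc t) ⟩
      qn (2 + t)  ∎
    pt : ∀ F → ∑ 𝒵 (λ D → ι (D ⊆ˢ? F)) ≤ ι (inH₂? Z F) + ι (Z ⊆ˢ? F) * length 𝒵
    pt F with Z ⊆ˢ? F
    ... | yes _ = ≤-trans (∑-mono 𝒵 (λ D → ι≤1 (D ⊆ˢ? F))) (≤-trans (≤-reflexive (trans (∑-1 𝒵) (sym (+-identityʳ _)))) (m≤n+m _ (ι (inH₂? Z F))))
    ... | no Z⊈F with inH₂? Z F
    ...   | yes _ = at-most-once-∈ {_~_ = _≐_} (_⊆ˢ? F) (λ {D} {D′} D∈ D′∈ f g → decidable-stable (D ≐? D′) λ D≢D′ →
              Z⊈F (⊆-trans (fill D∈ D′∈ D≢D′) (⊞-least f g))) (AllPairsP.filter⁺ (_⊆ˢ? Z) (subs-distinct (suc t)))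
      where
      fill : ∀ {D D′} → D ∈ₗ 𝒵 → D′ ∈ₗ 𝒵 → ¬ (D ≐ D′) → Z ⊆ˢ D ⊞ D′
      fill {D} {D′} D∈ D′∈ D≢D′ =
        let v , v∈ , v∉ = ⊈⇒∃ {D} {D′} λ f → D≢D′ (⊆-antisym f (⊆-dim⇒⊇ f (≤-reflexive (trans (All.lookup dims D′∈) (sym (All.lookup dims D∈))))))
        in ⊆-dim⇒⊇ (⊞-least (proj₂ (∈-filter⁻ (_⊆ˢ? Z) {xs = subs (suc t)} D∈)) (proj₂ (∈-filter⁻ (_⊆ˢ? Z) {xs = subs (suc t)} D′∈)))
             (≤-trans (≤-reflexive (trans dZ (cong suc (sym (All.lookup dims D′∈))))) (dim-strict v (⊞-⊆ʳ {D}) (⊞-⊆ˡ {D} {D′} .on v v∈) v∉))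
    ...   | no ∉H₂ = ≤-reflexive (trans (∑-cong-All (All.tabulate λ {D} D∈ → ι-no (D ⊆ˢ? F) λ f →
              ∉H₂ (≤-trans (≤-reflexive (sym (All.lookup dims D∈))) (dim-mono (∩-greatest f (proj₂ (∈-filter⁻ (_⊆ˢ? Z) {xs = subs (suc t)} D∈)))))))
              (trans (∑-const 𝒵 0) (*-zeroʳ (length 𝒵))))

  ContainsOne : List Subspace → Subspace → Set
  ContainsOne 𝓓 F = Any (_⊆ˢ F) 𝓓

  abstract
    containsOne? : ∀ 𝓓 → Decidable (ContainsOne 𝓓)
    containsOne? 𝓓 F = Any.any? (_⊆ˢ? F) 𝓓

  -- Bonferroni's inequality to second order: two distinct `r`-spaces lie together in at most
  -- `N n k (suc r)` k-spaces. The number of pairs is rounded up to a square.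
  union-bound : ∀ 𝓓 r → Distinct 𝓓 → All (λ D → dim D ≡ r) 𝓓 →
                length 𝓓 * N n k r ≤ ∑ (subs k) (λ F → ι (containsOne? 𝓓 F)) + length 𝓓 * length 𝓓 * N n k (suc r)
  union-bound []      r _          _        = z≤n
  union-bound (D ∷ 𝓓) r (D≢ ∷ dist) (dD ∷ ds) = begin
    N n k r + m * N n k r  ≤⟨ +-monoʳ-≤ (N n k r) (union-bound 𝓓 r dist ds) ⟩
    N n k r + (U 𝓓 + m * m * N′)  ≡⟨ +-assoc (N n k r) _ _ ⟨
    N n k r + U 𝓓 + m * m * N′  ≤⟨ +-monoˡ-≤ (m * m * N′) one ⟩
    U (D ∷ 𝓓) + m * N′ + m * m * N′  ≤⟨ m≤m+n _ ((1 + m) * N′) ⟩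
    U (D ∷ 𝓓) + m * N′ + m * m * N′ + (1 + m) * N′  ≡⟨ lem (U (D ∷ 𝓓)) m N′ ⟩
    U (D ∷ 𝓓) + (1 + m) * (1 + m) * N′  ∎
    where
    open ≤-Reasoning
    m = length 𝓓
    N′ = N n k (suc r)
    U : List Subspace → ℕ
    U 𝓓 = ∑ (subs k) (λ F → ι (containsOne? 𝓓 F))
    lem : ∀ u m x → u + m * x + m * m * x + (1 + m) * x ≡ u + (1 + m) * (1 + m) * x
    lem = solve-∀
    pt : ∀ F → ι (D ⊆ˢ? F) + ι (containsOne? 𝓓 F) ≤ ι (containsOne? (D ∷ 𝓓) F) + ∑ 𝓓 (λ D′ → ι (D ⊞ D′ ⊆ˢ? F))
    pt F with D ⊆ˢ? F | containsOne? 𝓓 F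
    ... | yes D⊆F | yes a = +-mono-≤ (≤-reflexive (sym (ι-yes (containsOne? (D ∷ 𝓓) F) (here D⊆F))))
                               (∑-≥ 𝓓 _ (Any.map (λ {D′} D′⊆F → ≤-reflexive (sym (ι-yes (D ⊞ D′ ⊆ˢ? F) (⊞-least D⊆F D′⊆F)))) a))
    ... | yes D⊆F | no _ = ≤-trans (≤-reflexive (sym (ι-yes (containsOne? (D ∷ 𝓓) F) (here D⊆F)))) (m≤m+n _ _)
    ... | no _ | yes a = ≤-trans (≤-reflexive (sym (ι-yes (containsOne? (D ∷ 𝓓) F) (there a)))) (m≤m+n _ _)
    ... | no _ | no _ = z≤n
    one : N n k r + U 𝓓 ≤ U (D ∷ 𝓓) + m * N′
    one = begin
      N n k r + U 𝓓  ≡⟨ cong (_+ U 𝓓) (trans (cong (N n k) (sym dD)) (sym (#-subs k D))) ⟩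
      # subs k ∋ D + U 𝓓  ≡⟨ ∑-+ (subs k) _ _ ⟨
      ∑ (subs k) (λ F → ι (D ⊆ˢ? F) + ι (containsOne? 𝓓 F))  ≤⟨ ∑-mono (subs k) pt ⟩
      ∑ (subs k) (λ F → ι (containsOne? (D ∷ 𝓓) F) + ∑ 𝓓 (λ D′ → ι (D ⊞ D′ ⊆ˢ? F)))  ≡⟨ ∑-+ (subs k) _ _ ⟩
      U (D ∷ 𝓓) + ∑ (subs k) (λ F → ∑ 𝓓 (λ D′ → ι (D ⊞ D′ ⊆ˢ? F)))  ≡⟨ cong (U (D ∷ 𝓓) +_) (∑-swap (subs k) 𝓓 _) ⟩
      U (D ∷ 𝓓) + ∑ 𝓓 (λ D′ → # subs k ∋ (D ⊞ D′))  ≤⟨ +-monoʳ-≤ (U (D ∷ 𝓓)) (∑-mono-All (All.map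
          (λ {D′} (D≢D′ , dD′) → ≤-trans (≤-reflexive (#-subs k (D ⊞ D′))) (N-antitone (big D≢D′ dD′))) (All.zip (D≢ , ds)))) ⟩
      U (D ∷ 𝓓) + ∑ 𝓓 (λ _ → N′)  ≡⟨ cong (U (D ∷ 𝓓) +_) (∑-const 𝓓 N′) ⟩
      U (D ∷ 𝓓) + m * N′  ∎
      where
      big : ∀ {D′} → ¬ (D ≐ D′) → dim D′ ≡ r → suc r ≤ dim (D ⊞ D′)
      big {D′} D≢D′ dD′ = let v , v∈ , v∉ = ⊈⇒∃ {D} {D′} λ f → D≢D′ (⊆-antisym f (⊆-dim⇒⊇ f (≤-reflexive (trans dD′ (sym dD))))) in
        ≤-trans (s≤s (≤-reflexive (sym dD′))) (dim-strict v (⊞-⊆ʳ {D}) (⊞-⊆ˡ {D} {D′} .on v v∈) v∉)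

  -- `i` measures the excess over t of the intersection with `L`; `i = 1` gives the first half of
  -- H₁.
  rich : Subspace → Subspace → ℕ → ℕ
  rich E L i = ∑ (subs k) λ F → ι ((E ⊆ˢ? F) ×-dec (i + t ≤? dim (F ⊓ L)))

  rich-lower : ∀ {E L i} → dim E ≡ t → E ⊆ˢ L → let m = G (dim L ∸ t) i in
               m * N n k (i + t) ≤ rich E L i + m * m * N n k (suc (i + t))
  rich-lower {E} {L} {i} dE E⊆L = subst (λ m → m * N n k (i + t) ≤ rich E L i + m * m * N n k (suc (i + t))) size
    (≤-trans (union-bound 𝓓 (i + t) (AllPairsP.filter⁺ (E ⊆ˢ?_) (AllPairsP.filter⁺ (_⊆ˢ? L) (subs-distinct (i + t))))
               (AllP.filter⁺ (E ⊆ˢ?_) (AllP.filter⁺ (_⊆ˢ? L) (subs-dim (i + t)))))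
             (+-monoˡ-≤ _ (∑-mono (subs k) (λ F → ι-mono (containsOne? 𝓓 F) ((E ⊆ˢ? F) ×-dec (i + t ≤? dim (F ⊓ L))) (hit F)))))
    where
    𝓓 = filter (E ⊆ˢ?_) (within L (subs (i + t)))
    size : length 𝓓 ≡ G (dim L ∸ t) i
    size = trans (length-filter-ι (E ⊆ˢ?_) (within L (subs (i + t)))) (trans (#-between E⊆L (≤-trans (≤-reflexive dE) (m≤n+m t i)))
      (cong₂ G (cong (dim L ∸_) dE) (trans (cong (i + t ∸_) dE) (m+n∸n≡m i t))))
    hit : ∀ F → ContainsOne 𝓓 F → E ⊆ˢ F × i + t ≤ dim (F ⊓ L)
    hit F a = let D , D∈ , D⊆F = find∈ a
                  D∈′ , E⊆D = ∈-filter⁻ (E ⊆ˢ?_) {xs = within L (subs (i + t))} D∈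
                  D∈″ , D⊆L = ∈-filter⁻ (_⊆ˢ? L) {xs = subs (i + t)} D∈′
              in ⊆-trans E⊆D D⊆F , ≤-trans (≤-reflexive (sym (All.lookup (subs-dim (i + t)) D∈″))) (dim-mono (∩-greatest D⊆F D⊆L))

-- Size estimates from covers

module Extremal {q : ℕ} (𝔽 : FiniteField q) (n k t : ℕ) (1≤t : 1 ≤ t) (t<k : t < k) (n≥ : 4 * k + 6 ≤ n) where
  open AdmissibleFamilies 𝔽 n k t 1≤t t<k n≥
  open CrossIntersectingLists 𝔽 n t

  -- The price of one enlargement through a k-space, and also the number of (t+1)-spaces between a
  -- t-space and a (k+1)-space.
  c : ℕ
  c = qn (suc (k ∸ t))

  -- The denominator `Q` for `leading-term-inequality`. It has to exceed a sum of four numbers of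
  -- size at most `q ^ (2 + k)`, and `4 * q ^ (2 + k) ≤ q ^ (4 + k)`.
  scale : ℕ
  scale = q ^ (k + t + 3)

  k≤n : k ≤ n
  k≤n = <⇒≤ k<n

  0<A : 0 < A
  0<A = N-positive t<k k≤n

  3k+6≤n∸k : 3 * k + 6 ≤ n ∸ k
  3k+6≤n∸k = m+n≤o⇒m≤o∸n (3 * k + 6) (≤-trans (≤-reflexive (lem k)) n≥)
    where lem : ∀ k → 3 * k + 6 + k ≡ 4 * k + 6
          lem = solve-∀

  absorb : ∀ {x i} → x ≤ q ^ i → i ≤ 3 * k + 6 → ∀ s → x * N n k (suc s) ≤ N n k s
  absorb x≤ i≤ s = ≤-trans (*-monoˡ-≤ (N n k (suc s)) (q^*-≤ x≤ i≤)) (N-decay s n≥)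

  above : ∀ {W m} S → S ⊆ˢ W → dim S ≤ m → m ≤ dim W → ∃ λ F → S ⊆ˢ F × F ⊆ˢ W × dim F ≡ m
  above {W} {m} S S⊆W s≤m m≤W = let F , S⊆F , F⊆W , dF , _ = extend S S S⊆W s≤m
                                      (≤-trans (+-monoʳ-≤ (m ∸ dim S) (dim-mono (⊞-least ⊆-refl ⊆-refl))) (≤-trans (≤-reflexive (m∸n+n≡m s≤m)) m≤W))
                                  in F , S⊆F , F⊆W , dF

  of-dim : ∀ {W m} → m ≤ dim W → ∃ λ F → F ⊆ˢ W × dim F ≡ m
  of-dim {W} m≤W = let F , _ , F⊆W , dF = above {W} 0ˢ 0ˢ⊆ (dim-0ˢ≤) m≤W in F , F⊆W , dF

  ≤n⇒≤1ˢ : ∀ {m} → m ≤ n → m ≤ dim 1ˢ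
  ≤n⇒≤1ˢ m≤ = ≤-trans m≤ (≤-reflexive (sym dim-1ˢ))

  MinimalCover : List Subspace → Subspace → Set
  MinimalCover 𝓛 C = Cover 𝓛 C × (∀ S → dim S < dim C → ¬ Cover 𝓛 S)

  minimal-cover : ∀ 𝓛 d C → dim C ≤ d → Cover 𝓛 C → ∃ λ C′ → MinimalCover 𝓛 C′
  minimal-cover 𝓛 d C dC≤ cov with anyUpTo? (λ m → Any.any? (cover? 𝓛) (subs m)) (dim C)
  ... | no none = C , cov , λ S lt covS → none (dim S , lt , Any.map (λ {U} e → cover-mono (≐⇒⊆ S U e) covS) (subs-complete S))
  minimal-cover 𝓛 zero C dC≤ cov | yes (m , lt , _) = contradiction (≤-trans lt dC≤) λ ()
  minimal-cover 𝓛 (suc d) C dC≤ cov | yes (m , lt , a) = let C′ , C′∈ , cov′ = find∈ a in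
    minimal-cover 𝓛 d C′ (s≤s⁻¹ (≤-trans (s≤s (≤-reflexive (All.lookup (subs-dim m) C′∈))) (≤-trans lt dC≤))) cov′

  module _ {𝓕 𝓖 : List Subspace} (a : Adm 𝓕 𝓖) where
    open Adm a

    coverF-of-G : ∀ {G} → G ∈ₗ 𝓖 → Cover 𝓕 G
    coverF-of-G {G} G∈ = All.tabulate λ {F} F∈ → ≤-trans (cross F∈ G∈) (dim-mono (∩-comm F G))

    -- Such a cover would be contained in every member of 𝓖, against `SmallCore`.
    no-small-cover : ∀ {C} → dim C ≤ t → ¬ Cover 𝓖 C
    no-small-cover {C} dC≤ cov =
      let G₀ , G₀∈ , _ = ntG 1ˢ (≤n⇒≤1ˢ (≤-trans (<⇒≤ t<k) k≤n))
          G , G∈ , C⊈G = ntG C (≤-trans (All.lookup cov G₀∈) (dim-mono ∩-⊆ˡ))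
      in C⊈G (⊆-trans (⊆-dim⇒⊇ ∩-⊆ˡ (≤-trans dC≤ (All.lookup cov G∈))) ∩-⊆ʳ)

    -- The list 𝓐 is left general: besides 𝓕, the argument is applied to `missed` and to the list
    -- `covers` itself.
    step-out : ∀ {𝓐} S X → (∀ {F} → F ∈ₗ 𝓐 → Cover 𝓖 F) → ¬ Cover 𝓖 S → (∀ v → v ∉ˢ S → # 𝓐 ∋ (S +ᵛ v) ≤ X) → # 𝓐 ∋ S ≤ c * X
    step-out {𝓐} S X covs ¬cov bound = let G , G∈ , lt = uncovered ¬cov in
      subst (λ z → # 𝓐 ∋ S ≤ qn (suc (z ∸ t)) * X) (All.lookup dimG G∈)
        (step-ratio 𝓐 S G t X lt (≤-trans (<⇒≤ t<k) (≤-reflexive (sym (All.lookup dimG G∈))))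
          (All.tabulate λ F∈ _ → All.lookup (covs F∈) G∈) (λ v _ v∉ → bound v v∉))

    coverG-of-F : ∀ {F} → F ∈ₗ 𝓕 → Cover 𝓖 F
    coverG-of-F F∈ = All.tabulate λ G∈ → cross F∈ G∈

    through-bound : ∀ m → (∀ S → dim S < m → ¬ Cover 𝓖 S) → ∀ r S → dim S + r ≡ m → # 𝓕 ∋ S ≤ c ^ r * N n k m
    through-bound m none zero S e = ≤-trans (#≤N 𝓕 S distF dimF) (≤-reflexive (trans (cong (N n k) (trans (sym (+-identityʳ _)) e)) (sym (+-identityʳ _))))
    through-bound m none (suc r) S e = ≤-trans
      (step-out S (c ^ r * N n k m) coverG-of-F (none S (subst (dim S <_) e (m<m+n (dim S) z<s)))
        (λ v v∉ → through-bound m none r (S +ᵛ v) (trans (cong (_+ r) (dim-+ᵛ v∉)) (trans (sym (+-suc (dim S) r)) e))))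
      (≤-reflexive (sym (*-assoc c (c ^ r) _)))

    -- The first t dimensions are gained inside a cover `C` of 𝓕. This costs `qn (suc (dim C ∸ t))`
    -- a step, less than `c` when `dim C` is below k.
    inside-bound : ∀ {C} X → t ≤ dim C → Cover 𝓕 C → (∀ E → dim E ≡ t → # 𝓕 ∋ E ≤ X) →
                   ∀ r S → dim S + r ≡ t → # 𝓕 ∋ S ≤ qn (suc (dim C ∸ t)) ^ r * X
    inside-bound X t≤ cov bound zero S e = ≤-trans (bound S (trans (sym (+-identityʳ _)) e)) (≤-reflexive (sym (+-identityʳ X)))
    inside-bound {C} X t≤ cov bound (suc r) S e = ≤-trans
      (step-ratio 𝓕 S C t (d ^ r * X) (≤-<-trans (dim-mono ∩-⊆ˡ) (subst (dim S <_) e (m<m+n (dim S) z<s))) t≤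
        (All.map (λ {F} le _ → ≤-trans le (dim-mono (∩-comm C F))) cov)
        (λ v _ v∉ → inside-bound X t≤ cov bound r (S +ᵛ v) (trans (cong (_+ r) (dim-+ᵛ v∉)) (trans (sym (+-suc (dim S) r)) e))))
      (≤-reflexive (sym (*-assoc d (d ^ r) X)))
      where d = qn (suc (dim C ∸ t))

    -- After t steps inside `C`, the spaces of dimension up to t + b are not covers of 𝓖 and allow
    -- `suc b` steps out. Reaching dimension t + 1 + b rather than t + 1 gains `b` factors
    -- `q ^ (n ∸ k)` relative to `A`.
    size-bound : ∀ {C a b} → dim C ≡ suc (t + a) → Cover 𝓕 C → (∀ S → dim S < suc (t + b) → ¬ Cover 𝓖 S) →
                 length 𝓕 * q ^ ((n ∸ k) * b) ≤ q ^ ((2 + a) * t + suc (k ∸ t) * suc b) * A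
    size-bound {C} {a} {b} dC cov none = begin
      length 𝓕 * Db  ≡⟨ cong (_* Db) (#-0ˢ 𝓕) ⟨
      # 𝓕 ∋ 0ˢ * Db  ≤⟨ *-monoˡ-≤ Db (inside-bound X t≤dC cov through t 0ˢ (cong (_+ t) dim-0ˢ)) ⟩
      qn (suc (dim C ∸ t)) ^ t * X * Db  ≡⟨ cong (λ z → qn (suc z) ^ t * X * Db) dC∸t ⟩
      qn (2 + a) ^ t * (c ^ suc b * N n k (suc (t + b))) * Db ≡⟨ lem (qn (2 + a) ^ t) (c ^ suc b) (N n k (suc (t + b))) Db ⟩
      qn (2 + a) ^ t * c ^ suc b * (Db * N n k (suc (t + b))) ≤⟨ *-mono-≤ (pow-bound {i = (2 + a) * t} {j = suc (k ∸ t) * suc b} (pow (2 + a) t) (pow (suc (k ∸ t)) (suc b))) (N-ratio^ (suc t) b k≤n) ⟩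
      q ^ ((2 + a) * t + suc (k ∸ t) * suc b) * A  ∎
      where
      open ≤-Reasoning
      Db = q ^ ((n ∸ k) * b)
      X = c ^ suc b * N n k (suc (t + b))
      through : ∀ E → dim E ≡ t → # 𝓕 ∋ E ≤ X
      through E dE = through-bound (suc (t + b)) none (suc b) E (trans (cong (_+ suc b) dE) (+-suc t b))
      dC∸t : dim C ∸ t ≡ suc a
      dC∸t = trans (cong (_∸ t) (trans dC (sym (+-suc t a)))) (m+n∸m≡n t (suc a))
      t≤dC : t ≤ dim C
      t≤dC = ≤-trans (m≤m+n t (suc a)) (≤-reflexive (trans (+-suc t a) (sym dC)))
      lem : ∀ x y z w → x * (y * z) * w ≡ x * y * (w * z)
      lem = solve-∀
      pow : ∀ m i → qn m ^ i ≤ q ^ (m * i)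
      pow m i = ≤-trans (^-monoˡ-≤ i (qn≤q^ m)) (≤-reflexive (^-*-assoc q m i))

    covers : List Subspace
    covers = filter (cover? 𝓖) (subs (suc t))

    covers-cover : ∀ {S} → S ∈ₗ covers → Cover 𝓖 S
    covers-cover S∈ = proj₂ (∈-filter⁻ (cover? 𝓖) {xs = subs (suc t)} S∈)

    covers-dim : ∀ {S} → S ∈ₗ covers → dim S ≡ suc t
    covers-dim S∈ = All.lookup (subs-dim (suc t)) (proj₁ (∈-filter⁻ (cover? 𝓖) {xs = subs (suc t)} S∈))

    covers-distinct : Distinct covers
    covers-distinct = AllPairsP.filter⁺ (cover? 𝓖) (subs-distinct (suc t))

    covers-complete : ∀ {S} → dim S ≡ suc t → Cover 𝓖 S → Any (S ≐_) covers
    covers-complete {S} dS cov = let S′ , S′∈ , e = find∈ (subst (λ m → Any (S ≐_) (subs m)) dS (subs-complete S)) in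
      lose (∈-filter⁺ (cover? 𝓖) S′∈ (cover-mono (≐⇒⊆ S S′ e) cov)) e

    covers-star : ∀ E → dim E ≡ t → # covers ∋ E ≤ c
    covers-star E dE = ≤-trans (step-out E 1 covers-cover (no-small-cover (≤-reflexive dE))
      (λ v v∉ → #-filled covers-distinct covers-dim (E +ᵛ v) (trans (dim-+ᵛ v∉) (cong suc dE)))) (≤-reflexive (*-identityʳ c))

    private
      missed? : Decidable (λ F → ¬ ContainsOne covers F)
      missed? F = ¬? (containsOne? covers F)

    missed : List Subspace
    missed = filter missed? 𝓕

    length-split : length 𝓕 ≤ length covers * A + length missed
    length-split = begin
      length 𝓕  ≡⟨ ∑-1 𝓕 ⟨
      ∑ 𝓕 (λ _ → 1)  ≤⟨ ∑-mono 𝓕 pt ⟩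
      ∑ 𝓕 (λ F → ∑ covers (λ S → ι (S ⊆ˢ? F)) + ι (missed? F))  ≡⟨ ∑-+ 𝓕 _ _ ⟩
      ∑ 𝓕 (λ F → ∑ covers (λ S → ι (S ⊆ˢ? F))) + ∑ 𝓕 (λ F → ι (missed? F))  ≡⟨ cong₂ _+_ (∑-swap 𝓕 covers _) (sym (length-filter-ι missed? 𝓕)) ⟩
      ∑ covers (λ S → # 𝓕 ∋ S) + length missed  ≤⟨ +-monoˡ-≤ (length missed) (∑-mono-All (All.tabulate λ {S} S∈ →
                                                                                     ≤-trans (#≤N 𝓕 S distF dimF) (≤-reflexive (cong (N n k) (covers-dim S∈))))) ⟩
      ∑ covers (λ _ → A) + length missed  ≡⟨ cong (_+ length missed) (∑-const covers A) ⟩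
      length covers * A + length missed  ∎
      where
      open ≤-Reasoning
      pt : ∀ F → 1 ≤ ∑ covers (λ S → ι (S ⊆ˢ? F)) + ι (missed? F)
      pt F with containsOne? covers F
      ... | yes h = ≤-trans (∑-≥ covers _ (Any.map (λ {S} f → ≤-reflexive (sym (ι-yes (S ⊆ˢ? F) f))) h)) (m≤m+n _ _)
      ... | no _  = m≤n+m 1 _

    -- Two enlargements, of a t-space and of a (t+1)-space that is no cover, cost `c` each and lead
    -- to `B`. A (t+1)-space that is a cover lies in no missed member.
    missed-bound : ∀ {T} → dim T ≡ suc t → Cover 𝓕 T → length missed ≤ qn (suc t) * (c * (c * B))
    missed-bound {T} dT cov = pick missed T (c * (c * B)) dT
      (All.tabulate λ {F} F∈ → ≤-trans (All.lookup cov (inc F∈)) (dim-mono (∩-comm T F)))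
      λ E dE → step-out E (c * B) (λ F∈ → coverG-of-F (inc F∈)) (no-small-cover (≤-reflexive dE)) λ v v∉ → next (E +ᵛ v) (trans (dim-+ᵛ v∉) (cong suc dE))
      where
      inc : ∀ {F} → F ∈ₗ missed → F ∈ₗ 𝓕
      inc F∈ = proj₁ (∈-filter⁻ missed? {xs = 𝓕} F∈)
      next : ∀ U → dim U ≡ suc t → # missed ∋ U ≤ c * B
      next U dU with cover? 𝓖 U
      ... | no ¬cov = step-out U B (λ F∈ → coverG-of-F (inc F∈)) ¬cov λ v v∉ →
              ≤-trans (#≤N missed (U +ᵛ v) (AllPairsP.filter⁺ missed? distF) (AllP.filter⁺ missed? dimF)) (≤-reflexive (cong (N n k) (trans (dim-+ᵛ v∉) (cong suc dU))))
      ... | yes covU = subst (_≤ c * B) (sym (trans (∑-cong-All (All.tabulate λ {F} F∈ → ι-no (U ⊆ˢ? F) λ f →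
              proj₂ (∈-filter⁻ missed? {xs = 𝓕} F∈) (Any.map (λ {S} e → ⊆-trans (≐⇒⊇ U S e) f) (covers-complete dU covU))))
              (trans (∑-const missed 0) (*-zeroʳ (length missed))))) z≤n

    scaled-size : ∀ {T} → dim T ≡ suc t → Cover 𝓕 T → length 𝓕 * scale ≤ (length covers * scale + 1) * A
    scaled-size {T} dT cov = begin
      length 𝓕 * scale  ≤⟨ *-monoˡ-≤ scale (≤-trans length-split (+-monoʳ-≤ (length covers * A) (missed-bound dT cov))) ⟩
      (length covers * A + qn (suc t) * (c * (c * B))) * scale ≡⟨ lem (length covers) A (qn (suc t)) c B scale ⟩
      length covers * scale * A + qn (suc t) * (c * (c * scale)) * B ≤⟨ +-monoʳ-≤ (length covers * scale * A) (absorb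
          (pow-bound {i = suc t} (qn≤q^ (suc t)) (pow-bound {i = suc (k ∸ t)} (qn≤q^ (suc (k ∸ t))) (pow-bound {i = suc (k ∸ t)} {j = k + t + 3} (qn≤q^ (suc (k ∸ t))) ≤-refl)))
          (≤-reflexive exponent) (suc t)) ⟩
      length covers * scale * A + A  ≡⟨ lem₂ (length covers * scale) A ⟩
      (length covers * scale + 1) * A  ∎
      where
      open ≤-Reasoning
      lem : ∀ s a x c b z → (s * a + x * (c * (c * b))) * z ≡ s * z * a + x * (c * (c * z)) * b
      lem = solve-∀
      lem₂ : ∀ s a → s * a + a ≡ (s + 1) * a
      lem₂ = solve-∀
      e₁ : ∀ t x → suc t + (suc x + (suc x + (t + x + t + 3))) ≡ 3 * (t + x) + 6
      e₁ = solve-∀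
      exponent : suc t + (suc (k ∸ t) + (suc (k ∸ t) + (k + t + 3))) ≡ 3 * k + 6
      exponent = subst (λ z → suc t + (suc (k ∸ t) + (suc (k ∸ t) + (z + t + 3))) ≡ 3 * z + 6) (m+[n∸m]≡n (<⇒≤ t<k)) (e₁ t (k ∸ t))

  no-small-coverF : ∀ {𝓕 𝓖} → Adm 𝓕 𝓖 → ∀ {C} → dim C ≤ t → ¬ Cover 𝓕 C
  no-small-coverF a = no-small-cover (swapAdm a)

  Z₀ : ∃ λ Z → dim Z ≡ 2 + t
  Z₀ = let Z , _ , dZ = of-dim {1ˢ} (≤n⇒≤1ˢ (≤-trans (s≤s t<k) k<n)) in Z , dZ

  -- The part `qn (suc t) * A` of the main term is given up to pay for the error `qn (2 + t) * B`,
  -- which is at most `A`.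
  h₂-big : ∀ {Z} → dim Z ≡ 2 + t → q ^ suc t * A ≤ length (h₂ Z)
  h₂-big {Z} dZ = +-cancelʳ-≤ A _ _ (begin
    q ^ suc t * A + A  ≤⟨ +-monoʳ-≤ (q ^ suc t * A) (m≤n*m A (qn (suc t))) ⟩
    q ^ suc t * A + qn (suc t) * A  ≡⟨ *-distribʳ-+ A (q ^ suc t) _ ⟨
    (q ^ suc t + qn (suc t)) * A  ≡⟨ cong (_* A) (trans (+-comm (q ^ suc t) _) (sym (qn-suc (suc t)))) ⟩
    qn (2 + t) * A  ≤⟨ h₂-lower dZ ⟩
    length (h₂ Z) + qn (2 + t) * B  ≤⟨ +-monoʳ-≤ (length (h₂ Z)) (absorb (qn≤q^ (2 + t)) exp (suc t)) ⟩
    length (h₂ Z) + A  ∎)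
    where
    open ≤-Reasoning
    exp : 2 + t ≤ 3 * k + 6
    exp = ≤-trans (s≤s t<k) (≤-trans (m≤m+n (suc k) (2 * k + 5)) (≤-reflexive (lem k)))
      where lem : ∀ k → suc k + (2 * k + 5) ≡ 3 * k + 6
            lem = solve-∀

  -- Both sides have covers of dimension t + 1: otherwise the product is far below that of H₂.
  short-covers : ∀ {𝓕 𝓖} → Adm 𝓕 𝓖 → Max 𝓕 𝓖 → (∃ λ S → dim S ≡ suc t × Cover 𝓖 S) × (∃ λ T → dim T ≡ suc t × Cover 𝓕 T)
  short-covers {𝓕} {𝓖} a mx =
    let G₀ , G₀∈ , _ = Adm.ntG a 1ˢ (≤n⇒≤1ˢ (≤-trans (<⇒≤ t<k) k≤n))
        F₀ , F₀∈ , _ = Adm.ntF a 1ˢ (≤n⇒≤1ˢ (≤-trans (<⇒≤ t<k) k≤n))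
        T , covT , minT = minimal-cover 𝓕 (dim G₀) G₀ ≤-refl (coverF-of-G a G₀∈)
        S , covS , minS = minimal-cover 𝓖 (dim F₀) F₀ ≤-refl (coverG-of-F a F₀∈)
    in go T S covT minT covS minS
    where
    go : ∀ T S → Cover 𝓕 T → (∀ U → dim U < dim T → ¬ Cover 𝓕 U) → Cover 𝓖 S → (∀ U → dim U < dim S → ¬ Cover 𝓖 U) →
         (∃ λ S → dim S ≡ suc t × Cover 𝓖 S) × (∃ λ T → dim T ≡ suc t × Cover 𝓕 T)
    go T S covT minT covS minS with dim T ∸ suc t + (dim S ∸ suc t) ≟ 0
    ... | yes e = (S , trans dS (cong suc (trans (cong (t +_) (m+n≡0⇒n≡0 (dim T ∸ suc t) e)) (+-identityʳ t))) , covS)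
                , (T , trans dT (cong suc (trans (cong (t +_) (m+n≡0⇒m≡0 (dim T ∸ suc t) e)) (+-identityʳ t))) , covT)
      where
      dT : dim T ≡ suc (t + (dim T ∸ suc t))
      dT = sym (m+[n∸m]≡n (≰⇒> λ le → no-small-coverF a le covT))
      dS : dim S ≡ suc (t + (dim S ∸ suc t))
      dS = sym (m+[n∸m]≡n (≰⇒> λ le → no-small-cover a le covS))
    ... | no ≢0 = contradiction (mx (h₂ Z) (h₂ Z) (h₂-adm dZ)) (<⇒≱ (covering-inequality {A} {length 𝓕} {length 𝓖} {length (h₂ Z)} {t} {n ∸ k} {x} {y}
                    ((2 + x) * t + suc (k ∸ t) * suc y) ((2 + y) * t + suc (k ∸ t) * suc x) 0<A
                    (size-bound a dT covT (λ U lt → minS U (subst (dim U <_) (sym dS) lt)))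
                    (size-bound (swapAdm a) dS covS (λ U lt → minT U (subst (dim U <_) (sym dT) lt)))
                    (h₂-big dZ) (covering-exponents x y t<k 3k+6≤n∸k (n≢0⇒n>0 ≢0))))
      where
      x = dim T ∸ suc t
      y = dim S ∸ suc t
      Z = proj₁ Z₀
      dZ = proj₂ Z₀
      dT : dim T ≡ suc (t + x)
      dT = sym (m+[n∸m]≡n (≰⇒> λ le → no-small-coverF a le covT))
      dS : dim S ≡ suc (t + y)
      dS = sym (m+[n∸m]≡n (≰⇒> λ le → no-small-cover a le covS))

  module _ {𝓕 𝓖 : List Subspace} (a : Adm 𝓕 𝓖) (mx : Max 𝓕 𝓖) where

    private
      𝓢 = covers a
      𝓣 = covers (swapAdm a)

    cover-lists : CrossLists c 𝓢 𝓣
    cover-lists = record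
      { distS = covers-distinct a ; distT = covers-distinct (swapAdm a) ; dimS = covers-dim a ; dimT = covers-dim (swapAdm a)
      ; cross = λ S∈ T∈ → cover-cross a mx (covers-dim a S∈) (covers-dim (swapAdm a) T∈) (covers-cover a S∈) (covers-cover (swapAdm a) T∈)
      ; starS = covers-star a ; starT = covers-star (swapAdm a) }

    -- The leading terms decide: 𝓢 and 𝓣 must be as large as the corresponding lists of any admissible 𝓗.
    many-covers : ∀ {μ} 𝓗 → Adm 𝓗 𝓗 → μ ≤ q ^ (2 + k) → μ * scale * A ≤ length 𝓗 * scale + A → μ * μ ≤ length 𝓢 * length 𝓣
    many-covers {μ} 𝓗 adm μ≤ h≥ = ≮⇒≥ λ lt →
      let (S , dS , covS) , (T , dT , covT) = short-covers a mx
          _ , S∈ , _ = find∈ (covers-complete a dS covS)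
          _ , T∈ , _ = find∈ (covers-complete (swapAdm a) dT covT)
      in contradiction (mx 𝓗 𝓗 adm) (<⇒≱ (leading-term-inequality {A} {scale} {length 𝓢} {length 𝓣} {μ} {length 𝓕} {length 𝓖} {length 𝓗} 0<A (scaled-size a dT covT) (scaled-size (swapAdm a) dS covS) h≥ lt
           (begin-strict
             length 𝓢 + length 𝓣 + (μ + μ)  <⟨ +-mono-<-≤ (+-mono-<-≤ (small (single cover-lists T∈))
                                                                           (<⇒≤ (small (single (swapLists cover-lists) S∈)))) (+-mono-≤ μ≤ μ≤) ⟩
             q ^ (2 + k) + q ^ (2 + k) + (q ^ (2 + k) + q ^ (2 + k))  ≡⟨ lem (q ^ (2 + k)) ⟩
             4 * q ^ (2 + k)  ≤⟨ 4*q^ (2 + k) ⟩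
             q ^ (4 + k)  ≤⟨ ^-monoʳ-≤ q (≤-trans (≤-reflexive (lem₂ k)) (+-monoˡ-≤ 3 (+-monoʳ-≤ k 1≤t))) ⟩
             scale  ∎)))
      where
      open ≤-Reasoning
      lem : ∀ x → x + x + (x + x) ≡ 4 * x
      lem = solve-∀
      lem₂ : ∀ k → 4 + k ≡ k + 1 + 3
      lem₂ = solve-∀
      small : ∀ {x} → x ≤ qn (suc t) * c → x < q ^ (2 + k)
      small {x} x≤ = begin-strict
        x  ≤⟨ x≤ ⟩
        qn (suc t) * c  <⟨ *-mono-< (qn<q^ (suc t)) (qn<q^ (suc (k ∸ t))) ⟩
        q ^ suc t * q ^ suc (k ∸ t)  ≡⟨ ^-distribˡ-+-* q (suc t) (suc (k ∸ t)) ⟨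
        q ^ (suc t + suc (k ∸ t))  ≡⟨ cong (q ^_) (cong suc (trans (+-suc t (k ∸ t)) (cong suc (m+[n∸m]≡n (<⇒≤ t<k))))) ⟩
        q ^ (2 + k)  ∎

-- From the shape of the covers to the shape of the families

module Structure {q : ℕ} (𝔽 : FiniteField q) (n k t : ℕ) (1≤t : 1 ≤ t) (t<k : t < k) (n≥ : 4 * k + 6 ≤ n) where
  open AdmissibleFamilies 𝔽 n k t 1≤t t<k n≥ public
  open CrossIntersectingLists 𝔽 n t public
  open Extremal 𝔽 n k t 1≤t t<k n≥ public

  -- What a common t-space `E` of the covers imposes on 𝓖. The space `L` and its counterpart for 𝓕
  -- become the parameters of H₁.
  record Wing (𝓖 : List Subspace) (E : Subspace) : Set where
    field
      {L G₀} : Subspace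
      dL     : dim L ≡ suc k
      E⊆L    : E ⊆ˢ L
      G₀∈    : G₀ ∈ₗ 𝓖
      E⊈G₀   : ¬ (E ⊆ˢ G₀)
      others : ∀ {G} → G ∈ₗ 𝓖 → ¬ (E ⊆ˢ G) → G ⊆ˢ L

  module _ {𝓕 𝓖 : List Subspace} (a : Adm 𝓕 𝓖) where
    open Adm a

    -- By their number, the covers are all hyperplanes of `Z`. Take one that misses a vector of
    -- `G ⊓ Z`: `G` meets it in dimension at least t, and the vector adds one more.
    flat-half : ∀ {Z} → dim Z ≡ 2 + t → All (_⊆ˢ Z) (covers a) → qn (2 + t) ≤ length (covers a) → ∀ {G} → G ∈ₗ 𝓖 → InH₂ Z G
    flat-half {Z} dZ below many {G} G∈ =
      let W₀ , W₀⊆Z , dW₀ = of-dim {Z} (≤-trans (n≤1+n (suc t)) (≤-reflexive (sym dZ)))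
          v , v∈ , v∉0 = nonzero∈ {G ⊓ Z} (≤-trans (All.lookup (all-cover W₀ dW₀ W₀⊆Z) G∈) (dim-mono (∩-greatest ∩-⊆ʳ (⊆-trans ∩-⊆ˡ W₀⊆Z))))
          W , _ , W⊆Z , dW , v∉W = avoid {Z} {suc t} v v∉0 0ˢ⊆ (dim-0ˢ≤) (≤-reflexive (sym dZ))
      in ≤-<-trans (All.lookup (all-cover W dW W⊆Z) G∈)
           (dim-strict v (∩-greatest ∩-⊆ʳ (⊆-trans ∩-⊆ˡ W⊆Z)) v∈ λ p → v∉W (∩-⊆ˡ {W} {G} .on v p))
      where
      all-cover : ∀ W → dim W ≡ suc t → W ⊆ˢ Z → Cover 𝓖 W
      all-cover W dW W⊆Z with cover? 𝓖 W
      ... | yes cov = cov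
      ... | no ¬cov = contradiction (length-hyperplanes {W ∷ covers a} {Z}
              (All.tabulate (λ {S} S∈ e → ¬cov (cover-mono (≐⇒⊇ W S e) (covers-cover a S∈))) ∷ covers-distinct a)
              (λ { (here refl) → dW ; (there S∈) → covers-dim a S∈ }) dZ (W⊆Z ∷ below)) (<⇒≱ (s≤s many))

    -- If the covers of 𝓖 through E are as many as possible, then E + G is the same for all G not through E.
    wing : ∀ {E} → dim E ≡ t → All (E ⊆ˢ_) (covers a) → c ≤ length (covers a) → Wing 𝓖 E
    wing {E} dE above-E many with ntG E (≤-reflexive (sym dE)) | member many
      where
      member : ∀ {xs : List Subspace} → c ≤ length xs → ∃ λ S → S ∈ₗ xs
      member {S ∷ _} _ = S , here refl
    ... | G₀ , G₀∈ , E⊈G₀ | S₀ , S₀∈ = record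
      { L = E ⊞ G₀ ; dL = dim-E⊞ G₀∈ E⊈G₀ ; E⊆L = ⊞-⊆ˡ ; G₀∈ = G₀∈ ; E⊈G₀ = E⊈G₀
      ; others = λ {G} G∈ E⊈G → ⊆-trans (⊞-⊆ʳ {E}) (⊆-trans (⊆-dim⇒⊇ (∩-⊆ʳ {E ⊞ G₀} {E ⊞ G})
          (≤-trans (≤-reflexive (dim-E⊞ G∈ E⊈G)) (common G∈ E⊈G))) ∩-⊆ˡ) }
      where
      fills-G : ∀ {S G} → S ∈ₗ covers a → G ∈ₗ 𝓖 → ¬ (E ⊆ˢ G) → S ⊆ˢ E ⊞ G
      fills-G S∈ G∈ E⊈G = ⊆-trans (sum-fills (All.lookup above-E S∈) ∩-⊆ˡ (covers-dim a S∈) (All.lookup (covers-cover a S∈) G∈)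
        (λ f → E⊈G (⊆-trans f ∩-⊆ʳ))) (⊞-least ⊞-⊆ˡ (⊆-trans ∩-⊆ʳ ⊞-⊆ʳ))
      dim-E⊞ : ∀ {G} → G ∈ₗ 𝓖 → ¬ (E ⊆ˢ G) → dim (E ⊞ G) ≡ suc k
      dim-E⊞ {G} G∈ E⊈G = +-cancelʳ-≡ (dim (E ⊓ G)) _ _ (begin
        dim (E ⊞ G) + dim (E ⊓ G)  ≡⟨ dim-modular E G ⟩
        dim E + dim G  ≡⟨ cong₂ _+_ (trans dE (sym meet)) (All.lookup dimG G∈) ⟩
        suc (dim (E ⊓ G)) + k  ≡⟨ cong suc (+-comm (dim (E ⊓ G)) k) ⟩
        suc k + dim (E ⊓ G)  ∎)
        where
        open ≡-Reasoning
        meet : suc (dim (E ⊓ G)) ≡ t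
        meet = ≤-antisym (let v , v∈ , v∉ = ⊈⇒∃ E⊈G in
                 ≤-trans (dim-strict v ∩-⊆ˡ v∈ (λ p → v∉ (∩-⊆ʳ {E} {G} .on v p))) (≤-reflexive dE))
               (+-cancelˡ-≤ t _ _ (≤-trans (+-mono-≤ (≤-reflexive (sym dE)) (All.lookup (covers-cover a S₀∈) G∈))
                 (≤-trans (dim-meet≥ {E} {S₀ ⊓ G} {S₀} (All.lookup above-E S₀∈) ∩-⊆ˡ)
                 (≤-trans (+-mono-≤ (≤-reflexive (covers-dim a S₀∈)) (dim-mono (∩-mono ⊆-refl ∩-⊆ʳ))) (≤-reflexive (sym (+-suc t _)))))))
      -- If `E ⊞ G₀` and `E ⊞ H` differed, all covers would lie between `E` and a space of dimension
      -- at most k, which leaves room for fewer than `c`.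
      common : ∀ {H} → H ∈ₗ 𝓖 → ¬ (E ⊆ˢ H) → suc k ≤ dim ((E ⊞ G₀) ⊓ (E ⊞ H))
      common {H} H∈ E⊈H = ≮⇒≥ λ lt → <⇒≱ (<-≤-trans (qn-mono-< (short lt)) many) (begin
        length (covers a)  ≤⟨ length-between (covers a) (covers-distinct a) (All.tabulate (covers-dim a)) above-E
                                                                (All.tabulate λ S∈ → ∩-greatest (fills-G S∈ G₀∈ E⊈G₀) (fills-G S∈ H∈ E⊈H))
                                                                (∩-greatest ⊞-⊆ˡ ⊞-⊆ˡ) (≤-trans (≤-reflexive dE) (n≤1+n t)) ⟩
        G (dim I ∸ dim E) (suc t ∸ dim E)  ≡⟨ cong₂ (λ x y → G (dim I ∸ x) y) dE (trans (cong (suc t ∸_) dE) (m+n∸n≡m 1 t)) ⟩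
        G (dim I ∸ t) 1  ≡⟨ G-1 (dim I ∸ t) ⟩
        qn (dim I ∸ t)  ∎)
        where
        open ≤-Reasoning
        I = (E ⊞ G₀) ⊓ (E ⊞ H)
        short : dim I < suc k → dim I ∸ t < suc (k ∸ t)
        short (s≤s le) = s≤s (∸-monoˡ-≤ t le)

    -- `F ⊓ L` contains `F ⊓ G₀`, of dimension at least t, and also `E`, which is not contained in
    -- `G₀`.
    wing-meet : ∀ {E} (w : Wing 𝓖 E) → dim E ≡ t → ∀ {F} → F ∈ₗ 𝓕 → E ⊆ˢ F → suc t ≤ dim (F ⊓ Wing.L w)
    wing-meet {E} w dE {F} F∈ E⊆F = let v , v∈ , v∉ = ⊈⇒∃ {E} {F ⊓ G₀} (λ f → E⊈G₀ (⊆-trans f ∩-⊆ʳ)) in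
        ≤-<-trans (cross F∈ G₀∈) (dim-strict v (∩-mono ⊆-refl (others G₀∈ E⊈G₀)) (∈⊓-intro {F} (E⊆F .on v v∈) (E⊆L .on v v∈)) v∉)
      where open Wing w

  hyperplanes-through : ∀ {L} S → S ⊆ˢ L → dim L ≡ suc k → dim S ≤ k → # within L (subs k) ∋ S ≡ qn (suc (k ∸ dim S))
  hyperplanes-through {L} S S⊆L dL s≤k = begin
    # within L (subs k) ∋ S  ≡⟨ #-between S⊆L s≤k ⟩
    G (dim L ∸ dim S) (k ∸ dim S)  ≡⟨ cong (λ z → G z (k ∸ dim S)) (trans (cong (_∸ dim S) dL) (+-∸-assoc 1 s≤k)) ⟩
    G (suc (k ∸ dim S)) (k ∸ dim S)  ≡⟨ G-hyperplane (k ∸ dim S) ⟩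
    qn (suc (k ∸ dim S))  ∎
    where open ≡-Reasoning

  -- Of the `qn (suc k)` hyperplanes of a (k+1)-space, `c` contain a given t-space; those that do
  -- not are more numerous.
  2c<hyperplanes : c + c < qn (suc k)
  2c<hyperplanes = begin-strict
    c + c  ≡⟨ cong (c +_) (+-identityʳ c) ⟨
    2 * c  <⟨ n<1+n _ ⟩
    1 + 2 * c  ≤⟨ +-mono-≤ (≤-trans (≤-reflexive (sym qn1≡1)) (qn-mono 1≤t)) (*-monoˡ-≤ c (≤-trans (2≤q^1+ 0) (^-monoʳ-≤ q 1≤t))) ⟩
    qn t + q ^ t * c  ≡⟨ qn-+ t (suc (k ∸ t)) ⟨
    qn (t + suc (k ∸ t))  ≡⟨ cong qn (trans (+-suc t (k ∸ t)) (cong suc (m+[n∸m]≡n (<⇒≤ t<k)))) ⟩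
    qn (suc k)  ∎
    where open ≤-Reasoning

  cover-count : ∀ {𝓕} → Distinct 𝓕 → All (λ F → dim F ≡ k) 𝓕 → ∀ {P Q : Subspace → Set} (P? : Decidable P) (Q? : Decidable Q) →
                (∀ {A B} → A ≐ B → P A → P B) → (∀ {A B} → A ≐ B → Q A → Q B) → (∀ {F} → F ∈ₗ 𝓕 → P F ⊎ Q F) →
                length 𝓕 ≤ ∑ (subs k) (λ F → ι (P? F)) + ∑ (subs k) (λ F → ι (Q? F))
  cover-count {𝓕} dist dims P? Q? respP respQ split = begin
    length 𝓕  ≡⟨ ∑-1 𝓕 ⟨
    ∑ 𝓕 (λ _ → 1)  ≤⟨ ∑-mono-All (All.tabulate λ {F} F∈ → ι-⊎≤ (yes F∈) (P? F) (Q? F) split) ⟩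
    ∑ 𝓕 (λ F → ι (P? F) + ι (Q? F))  ≡⟨ ∑-+ 𝓕 _ _ ⟩
    ∑ 𝓕 (λ F → ι (P? F)) + ∑ 𝓕 (λ F → ι (Q? F))  ≤⟨ +-mono-≤ (∑-subs-≥ 𝓕 _ dist dims λ {A} {B} e → ι-mono (P? A) (P? B) (respP {A} {B} e))
                                                                          (∑-subs-≥ 𝓕 _ dist dims λ {A} {B} e → ι-mono (Q? A) (Q? B) (respQ {A} {B} e)) ⟩
    ∑ (subs k) (λ F → ι (P? F)) + ∑ (subs k) (λ F → ι (Q? F)) ∎
    where open ≤-Reasoning

  Rich : Subspace → Subspace → Subspace → Set
  Rich E L F = E ⊆ˢ F × suc t ≤ dim (F ⊓ L)

  rich? : ∀ E L → Decidable (Rich E L)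
  rich? E L F = (E ⊆ˢ? F) ×-dec (suc t ≤? dim (F ⊓ L))

  rich-resp : ∀ E L {A B} → A ≐ B → Rich E L A → Rich E L B
  rich-resp E L {A} {B} e (f , le) = ⊆-trans f (≐⇒⊆ A B e) , ≤-trans le (dim-mono (∩-mono (≐⇒⊆ A B e) ⊆-refl))

  count-between : ∀ {L} S → S ⊆ˢ L → dim L ≡ suc k → dim S ≤ k → ∑ (subs k) (λ F → ι ((F ⊆ˢ? L) ×-dec (S ⊆ˢ? F))) ≡ qn (suc (k ∸ dim S))
  count-between {L} S S⊆L dL s≤k = trans (∑-cong (subs k) λ F → ι-× (F ⊆ˢ? L) (S ⊆ˢ? F))
    (trans (sym (∑-filter (_⊆ˢ? L) (subs k) _)) (hyperplanes-through S S⊆L dL s≤k))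

  count-hyperplanes : ∀ {L} → dim L ≡ suc k → ∑ (subs k) (λ F → ι (F ⊆ˢ? L)) ≡ qn (suc k)
  count-hyperplanes {L} dL = trans (∑-cong (subs k) λ F → ι-⇔ (F ⊆ˢ? L) ((F ⊆ˢ? L) ×-dec (0ˢ ⊆ˢ? F)) (λ f → f , 0ˢ⊆) proj₁)
    (trans (count-between 0ˢ 0ˢ⊆ dL (dim-0ˢ≤)) (cong (λ z → qn (suc (k ∸ z))) dim-0ˢ))

  -- The left side overcounts H₁ by at most the hyperplanes of `M` through `E`, of which there are
  -- `c`.
  h₁-lower : ∀ {L M E} → Frame L M E → rich E L 1 + qn (suc k) ≤ length (h₁ L M E) + c
  h₁-lower {L} {M} {E} fr = begin
    rich E L 1 + qn (suc k)  ≡⟨ cong (rich E L 1 +_) (count-hyperplanes dM) ⟨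
    rich E L 1 + ∑ (subs k) (λ F → ι (F ⊆ˢ? M))  ≡⟨ ∑-+ (subs k) _ _ ⟨
    ∑ (subs k) (λ F → ι (rich? E L F) + ι (F ⊆ˢ? M))  ≤⟨ ∑-mono (subs k) pt ⟩
    ∑ (subs k) (λ F → ι (inH₁? L M E F) + ι ((F ⊆ˢ? M) ×-dec (E ⊆ˢ? F)))  ≡⟨ ∑-+ (subs k) _ _ ⟩
    ∑ (subs k) (λ F → ι (inH₁? L M E F)) + ∑ (subs k) (λ F → ι ((F ⊆ˢ? M) ×-dec (E ⊆ˢ? F)))
      ≡⟨ cong₂ _+_ (sym (length-filter-ι (inH₁? L M E) (subs k))) (trans (count-between E E⊆M dM (≤-trans (≤-reflexive dE) (<⇒≤ t<k))) (cong (λ z → qn (suc (k ∸ z))) dE)) ⟩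
    length (h₁ L M E) + c  ∎
    where
    open ≤-Reasoning
    open Frame fr
    pt : ∀ F → ι (rich? E L F) + ι (F ⊆ˢ? M) ≤ ι (inH₁? L M E F) + ι ((F ⊆ˢ? M) ×-dec (E ⊆ˢ? F))
    pt F with E ⊆ˢ? F | F ⊆ˢ? M | suc t ≤? dim (F ⊓ L)
    ... | yes _ | yes _ | yes _ = ≤-refl
    ... | yes _ | yes _ | no _  = ≤-refl
    ... | yes _ | no _  | yes _ = ≤-refl
    ... | yes _ | no _  | no _  = ≤-refl
    ... | no _  | yes _ | _     = ≤-refl
    ... | no _  | no _  | _     = ≤-refl

  -- In the double count over vectors of `L` outside `E`, a k-space through `E` meeting `L` in
  -- dimension t + j has weight `qn j`. The coefficients come from `qn 1 = 1` and `qn 2 = 1 + q`.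
  rich-upper : ∀ {L M E} → Frame L M E → rich E L 1 + q * rich E L 2 ≤ c * A
  rich-upper {L} {M} {E} fr = *-cancelˡ-≤ pq {{p*q^>0 t}} (begin
    pq * (rich E L 1 + q * rich E L 2)  ≡⟨ cong (λ z → pq * (rich E L 1 + z)) (∑-*ˡ (subs k) q _) ⟨
    pq * (rich E L 1 + ∑ (subs k) (λ F → q * r₂ F))  ≡⟨ cong (pq *_) (∑-+ (subs k) _ _) ⟨
    pq * ∑ (subs k) (λ F → r₁ F + q * r₂ F)  ≡⟨ ∑-*ˡ (subs k) pq _ ⟨
    ∑ (subs k) (λ F → pq * (r₁ F + q * r₂ F))  ≤⟨ ∑-mono (subs k) pt ⟩
    ∑ (subs k) (λ F → ι (E ⊆ˢ? F) * gap (F ⊓ L) E)  ≡⟨ double-count (subs k) E L ⟨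
    ∑ allV (λ v → ι ((v ∈ˢ? L) ×-dec ¬? (v ∈ˢ? E)) * # subs k ∋ (E +ᵛ v))  ≡⟨ ∑-cong allV (λ v → ι-*≡ ((v ∈ˢ? L) ×-dec ¬? (v ∈ˢ? E)) λ (_ , v∉) →
        trans (#-subs k (E +ᵛ v)) (cong (N n k) (trans (dim-+ᵛ v∉) (cong suc dE)))) ⟩
    ∑ allV (λ v → ι ((v ∈ˢ? L) ×-dec ¬? (v ∈ˢ? E)) * A)  ≡⟨ ∑-*ʳ allV _ A ⟩
    gap L E * A  ≡⟨ cong (_* A) (trans (gap-card L E) (cong₂ (λ x y → p * q ^ x * qn (y ∸ x)) dEL dL)) ⟩
    pq * qn (suc k ∸ t) * A  ≡⟨ cong (λ z → pq * qn z * A) (+-∸-assoc 1 (<⇒≤ t<k)) ⟩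
    pq * c * A  ≡⟨ *-assoc pq c A ⟩
    pq * (c * A)  ∎)
    where
    open ≤-Reasoning
    open Frame fr
    pq = p * q ^ t
    r₁ r₂ : Subspace → ℕ
    r₁ F = ι ((E ⊆ˢ? F) ×-dec (1 + t ≤? dim (F ⊓ L)))
    r₂ F = ι ((E ⊆ˢ? F) ×-dec (2 + t ≤? dim (F ⊓ L)))
    dEL : dim (E ⊓ L) ≡ t
    dEL = trans (≤-antisym (dim-mono ∩-⊆ˡ) (dim-mono (∩-greatest ⊆-refl E⊆L))) dE
    levels : ∀ d → ι (1 + t ≤? d) + q * ι (2 + t ≤? d) ≤ qn (d ∸ t)
    levels d with 1 + t ≤? d | 2 + t ≤? d
    ... | w     | yes l = ≤-trans (≤-trans (+-monoˡ-≤ (q * 1) (ι≤1 w)) (≤-reflexive (cong (λ z → 1 + q * z) (sym qn1≡1))))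
                            (qn-mono (≤-trans (≤-reflexive (sym (m+n∸n≡m 2 t))) (∸-monoˡ-≤ t l)))
    ... | yes l | no _  = ≤-trans (≤-reflexive (cong suc (*-zeroʳ q))) (≤-trans (≤-reflexive (sym qn1≡1))
                            (qn-mono (≤-trans (≤-reflexive (sym (m+n∸n≡m 1 t))) (∸-monoˡ-≤ t l))))
    ... | no _  | no _  = ≤-trans (≤-reflexive (*-zeroʳ q)) z≤n
    pt : ∀ F → pq * (r₁ F + q * r₂ F) ≤ ι (E ⊆ˢ? F) * gap (F ⊓ L) E
    pt F with E ⊆ˢ? F
    ... | no _ = ≤-reflexive (trans (cong (pq *_) (*-zeroʳ q)) (*-zeroʳ pq))
    ... | yes E⊆F = ≤-trans (*-monoʳ-≤ pq (≤-trans (≤-reflexive (cong₂ (λ x y → x + q * y) (strip (1 + t)) (strip (2 + t)))) (levels (dim (F ⊓ L)))))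
                      (≤-reflexive (sym (trans (+-identityʳ _) (trans (gap-through E⊆F) (cong (λ x → p * q ^ x * qn (dim (F ⊓ L) ∸ x)) dEL)))))
      where strip : ∀ i → ι (yes E⊆F ×-dec (i ≤? dim (F ⊓ L))) ≡ ι (i ≤? dim (F ⊓ L))
            strip i = ι-⇔ (yes E⊆F ×-dec (i ≤? dim (F ⊓ L))) (i ≤? dim (F ⊓ L)) proj₂ (λ le → E⊆F , le)

  -- For k = 2t + 1 the leading terms of H₁ and H₂ agree; the k-spaces meeting L in dimension t + 2 decide.
  h₁<h₂ : ∀ {𝓕 L M E Z} → k ≡ 2 * t + 1 → 2 ≤ t → Distinct 𝓕 → All (λ F → dim F ≡ k) 𝓕 → Frame L M E →
          (∀ {F} → F ∈ₗ 𝓕 → InH₁ L M E F) → dim Z ≡ 2 + t → length 𝓕 < length (h₂ Z)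
  h₁<h₂ {𝓕} {L} {M} {E} {Z} k≡ 2≤t dist dims fr inH₁ dZ = +-cancelʳ-< (q * (m * B)) _ _ (begin-strict
    -- `r₁ + q * r₂` is at most `c * A`, the main term of H₂, while `r₂` is about `m * B`. So H₁
    -- loses about `q * m * B`, and H₂ only `c * B`.
    length 𝓕 + q * (m * B)  ≤⟨ +-mono-≤ size (*-monoʳ-≤ q mB≤) ⟩
    (r₁ + qn (suc k)) + q * (r₂ + B)  ≡⟨ lem₁ r₁ (qn (suc k)) q r₂ B ⟩
    (r₁ + q * r₂) + (q * B + qn (suc k))  ≤⟨ +-monoˡ-≤ _ (≤-trans (rich-upper fr) cA≤) ⟩
    (length (h₂ Z) + c * B) + (q * B + qn (suc k))  <⟨ +-monoʳ-< (length (h₂ Z) + c * B) (+-monoʳ-< (q * B) qn<B) ⟩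
    (length (h₂ Z) + c * B) + (q * B + B)  ≡⟨ lem₂ (length (h₂ Z)) c B q ⟩
    length (h₂ Z) + (c + q + 1) * B  ≤⟨ +-monoʳ-≤ (length (h₂ Z)) (*-monoˡ-≤ B c+q+1≤) ⟩
    length (h₂ Z) + q * m * B  ≡⟨ cong (length (h₂ Z) +_) (*-assoc q m B) ⟩
    length (h₂ Z) + q * (m * B)  ∎)
    where
    open ≤-Reasoning
    open Frame fr
    r₁ = rich E L 1
    r₂ = rich E L 2
    m = G (2 + t) 2
    lem₁ : ∀ a x q b y → (a + x) + q * (b + y) ≡ (a + q * b) + (q * y + x)
    lem₁ = solve-∀
    lem₂ : ∀ h c b q → (h + c * b) + (q * b + b) ≡ h + (c + q + 1) * b
    lem₂ = solve-∀
    k∸t : suc (k ∸ t) ≡ 2 + t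
    k∸t = cong suc (trans (cong (_∸ t) (trans k≡ (lem t))) (m+n∸m≡n t (suc t)))
      where lem : ∀ t → 2 * t + 1 ≡ t + suc t
            lem = solve-∀
    size : length 𝓕 ≤ r₁ + qn (suc k)
    size = ≤-trans (cover-count dist dims (rich? E L) (_⊆ˢ? M) (λ {A} {B} → rich-resp E L {A} {B}) (λ {A} {B} e f → ⊆-trans (≐⇒⊇ A B e) f) split)
                   (≤-reflexive (cong (r₁ +_) (count-hyperplanes dM)))
      where split : ∀ {F} → F ∈ₗ 𝓕 → Rich E L F ⊎ F ⊆ˢ M
            split F∈ with inH₁ F∈
            ... | inj₁ r = inj₁ r
            ... | inj₂ (f , _) = inj₂ f
    cA≤ : c * A ≤ length (h₂ Z) + c * B
    cA≤ = subst (λ z → qn z * A ≤ length (h₂ Z) + qn z * B) (sym k∸t) (h₂-lower dZ)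
    mB≤ : m * B ≤ r₂ + B
    mB≤ = ≤-trans (subst (λ d → G d 2 * B ≤ r₂ + G d 2 * G d 2 * N n k (3 + t)) (trans (cong (_∸ t) dL) (trans (+-∸-assoc 1 (<⇒≤ t<k)) k∸t)) (rich-lower {i = 2} dE E⊆L))
      (+-monoʳ-≤ r₂ (absorb (pow-bound {i = 2 * t + 3} {j = 2 * t + 3} (G-2≤ t) (G-2≤ t)) small (2 + t)))
      where
      small : 2 * t + 3 + (2 * t + 3) ≤ 3 * k + 6
      small = begin
        2 * t + 3 + (2 * t + 3)  ≤⟨ m≤m+n _ (2 * t + 3) ⟩
        2 * t + 3 + (2 * t + 3) + (2 * t + 3)  ≡⟨ lem t ⟩
        3 * (2 * t + 1) + 6  ≡⟨ cong (λ z → 3 * z + 6) k≡ ⟨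
        3 * k + 6  ∎
        where lem : ∀ t → 2 * t + 3 + (2 * t + 3) + (2 * t + 3) ≡ 3 * (2 * t + 1) + 6
              lem = solve-∀
    -- This uses k ≥ t + 3. For t = 1 and k = 3 one has `B = 1`, and the hyperplanes of `M` are no
    -- longer negligible.
    qn<B : qn (suc k) < B
    qn<B = begin-strict
      qn (suc k)  <⟨ qn<q^ (suc k) ⟩
      q ^ suc k  ≤⟨ m≤m*n (q ^ suc k) (N n k (3 + t)) {{>-nonZero (N-positive 3+t≤k k≤n)}} ⟩
      q ^ suc k * N n k (3 + t)  ≤⟨ absorb ≤-refl (≤-trans (m≤m+n (suc k) (2 * k + 5)) (≤-reflexive (lem k))) (2 + t) ⟩
      B  ∎
      where
      lem : ∀ k → suc k + (2 * k + 5) ≡ 3 * k + 6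
      lem = solve-∀
      3+t≤k : 3 + t ≤ k
      3+t≤k = ≤-trans (+-monoˡ-≤ t (+-monoʳ-≤ 1 2≤t)) (≤-reflexive (trans (lem₃ t) (sym k≡)))
        where lem₃ : ∀ t → 1 + t + t ≡ 2 * t + 1
              lem₃ = solve-∀
    c+q+1≤ : c + q + 1 ≤ q * m
    c+q+1≤ = begin
      c + q + 1  ≡⟨ cong (λ z → qn z + q + 1) k∸t ⟩
      1 + q * x + q + 1  ≡⟨ lem₃ q x ⟩
      q * x + q + 2  ≤⟨ +-mono-≤ (+-monoʳ-≤ (q * x) (m≤m*n q x)) (≤-trans 2≤q (m≤m*n q x)) ⟩
      q * x + q * x + q * x  ≤⟨ m≤m+n _ (q * x) ⟩
      q * x + q * x + q * x + q * x  ≡⟨ lem₄ q x ⟩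
      q * (4 * x)  ≤⟨ *-monoʳ-≤ q (*-monoˡ-≤ x (≤-trans (*-mono-≤ 2≤q 2≤q) (≤-trans (≤-reflexive (cong (q *_) (sym (*-identityʳ q)))) (^-monoʳ-≤ q 2≤t)))) ⟩
      q * (q ^ t * x)  ≤⟨ *-monoʳ-≤ q (G-2≥ t) ⟩
      q * m  ∎
      where
      x = qn (suc t)
      lem₃ : ∀ q x → 1 + q * x + q + 1 ≡ q * x + q + 2
      lem₃ = solve-∀
      lem₄ : ∀ q x → q * x + q * x + q * x + q * x ≡ q * (4 * x)
      lem₄ = solve-∀

  wings-frame : ∀ {𝓕 𝓖 E} (a : Adm 𝓕 𝓖) (w : Wing 𝓖 E) (w′ : Wing 𝓕 E) → dim E ≡ t → Frame (Wing.L w) (Wing.L w′) E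
  wings-frame a w w′ dE = record { dL = Wing.dL w ; dM = Wing.dL w′ ; dE = dE ; E⊆L = Wing.E⊆L w ; E⊆M = Wing.E⊆L w′ }

  wings-H₁ : ∀ {𝓕 𝓖 E} (a : Adm 𝓕 𝓖) (w : Wing 𝓖 E) (w′ : Wing 𝓕 E) → dim E ≡ t →
             ∀ {F} → F ∈ₗ 𝓕 → InH₁ (Wing.L w) (Wing.L w′) E F
  wings-H₁ {E = E} a w w′ dE {F} F∈ with E ⊆ˢ? F
  ... | yes E⊆F = inj₁ (E⊆F , wing-meet a w dE F∈ E⊆F)
  ... | no E⊈F  = inj₂ (Wing.others w′ F∈ E⊈F , E⊈F)

  -- If M ∩ L is too small, all members of 𝓕 not through E contain the same t-space G₀ ∩ M ∩ L.
  thin-half : ∀ {𝓕 𝓖 E} (a : Adm 𝓕 𝓖) (w : Wing 𝓖 E) (w′ : Wing 𝓕 E) → dim E ≡ t →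
              dim (Wing.L w′ ⊓ Wing.L w) ≤ suc t → length 𝓕 ≤ rich E (Wing.L w) 1 + c
  thin-half {𝓕} {𝓖} {E} a w w′ dE thin = ≤-trans
      (cover-count distF dimF (rich? E L) (λ F → (F ⊆ˢ? M) ×-dec (R ⊆ˢ? F)) (λ {A} {B} → rich-resp E L {A} {B})
        (λ {A} {B} e (f , g) → ⊆-trans (≐⇒⊇ A B e) f , ⊆-trans g (≐⇒⊆ A B e)) split)
      (≤-reflexive (cong (rich E L 1 +_) (trans (count-between R R⊆M (Wing.dL w′) (≤-trans (≤-reflexive dR) (<⇒≤ t<k))) (cong (λ z → qn (suc (k ∸ z))) dR))))
    where
    open Adm a
    open Wing w
    M = Wing.L w′
    F₀ = Wing.G₀ w′
    D = M ⊓ L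
    R = G₀ ⊓ D
    R⊆M : R ⊆ˢ M
    R⊆M = ⊆-trans ∩-⊆ʳ ∩-⊆ˡ
    R≤t : dim R ≤ t
    R≤t = s≤s⁻¹ (≰⇒> λ le → E⊈G₀ (⊆-trans (∩-greatest (Wing.E⊆L w′) E⊆L) (⊆-trans (⊆-dim⇒⊇ ∩-⊆ʳ (≤-trans thin le)) ∩-⊆ˡ)))
    inR : ∀ {F} → F ∈ₗ 𝓕 → ¬ (E ⊆ˢ F) → F ⊓ G₀ ⊆ˢ R
    inR F∈ E⊈F = ∩-greatest ∩-⊆ʳ (∩-mono (Wing.others w′ F∈ E⊈F) (others G₀∈ E⊈G₀))
    dR : dim R ≡ t
    dR = ≤-antisym R≤t (≤-trans (cross (Wing.G₀∈ w′) G₀∈) (dim-mono (inR (Wing.G₀∈ w′) (Wing.E⊈G₀ w′))))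
    split : ∀ {F} → F ∈ₗ 𝓕 → Rich E L F ⊎ (F ⊆ˢ M × R ⊆ˢ F)
    split {F} F∈ with wings-H₁ a w w′ dE F∈
    ... | inj₁ r = inj₁ r
    ... | inj₂ (F⊆M , E⊈F) = inj₂ (F⊆M , ⊆-trans (⊆-dim⇒⊇ (inR F∈ E⊈F) (≤-trans R≤t (cross F∈ G₀∈))) ∩-⊆ˡ)

  H₁Shape H₂Shape : List Subspace → List Subspace → Set
  H₁Shape 𝓕 𝓖 = ∃ λ M → ∃ λ L → ∃ λ E → Frame L M E × 2 + t ≤ dim (M ⊓ L) ×
                  (∀ {F} → F ∈ₗ 𝓕 → InH₁ L M E F) × (∀ {G} → G ∈ₗ 𝓖 → InH₁ M L E G)
  H₂Shape 𝓕 𝓖 = ∃ λ Z → dim Z ≡ 2 + t × (∀ {F} → F ∈ₗ 𝓕 → InH₂ Z F) × (∀ {G} → G ∈ₗ 𝓖 → InH₂ Z G)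

  -- H₁ may be formed with `M = L`. The second half of `h₁ L L E` then has `qn (suc k) − c` members,
  -- against at most `c` for 𝓕 and for 𝓖.
  thin-absurd : ∀ {𝓕 𝓖 E} (a : Adm 𝓕 𝓖) → Max 𝓕 𝓖 → (w : Wing 𝓖 E) (w′ : Wing 𝓕 E) → dim E ≡ t →
                length 𝓕 ≤ rich E (Wing.L w) 1 + c → length 𝓖 ≤ rich E (Wing.L w) 1 + c → ∀ {X : Set} → X
  thin-absurd {𝓕} {𝓖} {E} a mx w w′ dE f≤ g≤ = contradiction (mx (h₁ L L E) (h₁ L L E) (h₁-adm fr (≤-trans (s≤s t<k)
      (≤-trans (≤-reflexive (sym dL)) (dim-mono (∩-greatest ⊆-refl ⊆-refl)))))) (<⇒≱ (*-mono-< (≤-<-trans f≤ below) (≤-<-trans g≤ below)))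
    where
    open Wing w
    fr : Frame L L E
    fr = record { dL = dL ; dM = dL ; dE = dE ; E⊆L = E⊆L ; E⊆M = E⊆L }
    below : rich E L 1 + c < length (h₁ L L E)
    below = +-cancelʳ-< c _ _ (begin-strict
      rich E L 1 + c + c  ≡⟨ +-assoc (rich E L 1) c c ⟩
      rich E L 1 + (c + c)  <⟨ +-monoʳ-< (rich E L 1) 2c<hyperplanes ⟩
      rich E L 1 + qn (suc k)  ≤⟨ h₁-lower fr ⟩
      length (h₁ L L E) + c  ∎)
      where open ≤-Reasoning

  wings-shape : ∀ {𝓕 𝓖 E} (a : Adm 𝓕 𝓖) → Max 𝓕 𝓖 → Wing 𝓖 E → Wing 𝓕 E → dim E ≡ t → H₁Shape 𝓕 𝓖
  wings-shape {𝓕} {𝓖} {E} a mx w w′ dE with 2 + t ≤? dim (Wing.L w′ ⊓ Wing.L w)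
  ... | yes wide = Wing.L w′ , Wing.L w , E , wings-frame a w w′ dE , wide , wings-H₁ a w w′ dE , wings-H₁ (swapAdm a) w′ w dE
  -- One space has to beat both families, so the one with the larger `rich` count is taken.
  ... | no narrow with ≤-total (rich E (Wing.L w′) 1) (rich E (Wing.L w) 1)
  ...   | inj₁ le = thin-absurd a mx w w′ dE (thin-half a w w′ dE thin) (≤-trans (thin-half (swapAdm a) w′ w dE thin′) (+-monoˡ-≤ c le))
    where thin = s≤s⁻¹ (≰⇒> narrow)
          thin′ = ≤-trans (dim-mono (∩-comm (Wing.L w) (Wing.L w′))) thin
  ...   | inj₂ le = thin-absurd (swapAdm a) (swapMax {𝓕} {𝓖} mx) w′ w dE (thin-half (swapAdm a) w′ w dE thin′) (≤-trans (thin-half a w w′ dE thin) (+-monoˡ-≤ c le))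
    where thin = s≤s⁻¹ (≰⇒> narrow)
          thin′ = ≤-trans (dim-mono (∩-comm (Wing.L w) (Wing.L w′))) thin

  both-full : ∀ {m a b} → 0 < m → a ≤ m → b ≤ m → m * m ≤ a * b → m ≤ a × m ≤ b
  both-full {m} {a} {b} 0<m a≤ b≤ le =
      *-cancelʳ-≤ m a m {{>-nonZero 0<m}} (≤-trans le (*-monoʳ-≤ a b≤))
    , *-cancelˡ-≤ m {{>-nonZero 0<m}} (≤-trans le (*-monoˡ-≤ b a≤))

  sq-≤ : ∀ {m n} → m * m ≤ n * n → m ≤ n
  sq-≤ le = ≮⇒≥ λ lt → <⇒≱ (*-mono-< lt lt) le

  module _ {𝓕 𝓖 : List Subspace} (a : Adm 𝓕 𝓖) (mx : Max 𝓕 𝓖) where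

    private
      𝓢 = covers a
      𝓣 = covers (swapAdm a)

    sunflower-shape : Sunflower 𝓢 𝓣 → c * c ≤ length 𝓢 * length 𝓣 → H₁Shape 𝓕 𝓖
    sunflower-shape (E , dE , E⊆𝓢 , E⊆𝓣) le =
      let full = both-full z<s (≤-trans (≤-reflexive (#-all E⊆𝓢)) (covers-star a E dE)) (≤-trans (≤-reflexive (#-all E⊆𝓣)) (covers-star (swapAdm a) E dE)) le
      in wings-shape a mx (wing a dE E⊆𝓢 (proj₁ full)) (wing (swapAdm a) dE E⊆𝓣 (proj₂ full)) dE

    sunflower-≤ : Sunflower 𝓢 𝓣 → length 𝓢 * length 𝓣 ≤ c * c
    sunflower-≤ (E , dE , E⊆𝓢 , E⊆𝓣) = *-mono-≤ (≤-trans (≤-reflexive (#-all E⊆𝓢)) (covers-star a E dE))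
                                                  (≤-trans (≤-reflexive (#-all E⊆𝓣)) (covers-star (swapAdm a) E dE))

    flat-≤ : Flat 𝓢 𝓣 → length 𝓢 ≤ qn (2 + t) × length 𝓣 ≤ qn (2 + t)
    flat-≤ (Z , dZ , S⊆Z , T⊆Z) = length-hyperplanes (covers-distinct a) (covers-dim a) dZ S⊆Z
                                , length-hyperplanes (covers-distinct (swapAdm a)) (covers-dim (swapAdm a)) dZ T⊆Z

    c≤q^ : c ≤ q ^ (2 + k)
    c≤q^ = q^*-≤ (qn≤q^ (suc (k ∸ t))) (s≤s (≤-trans (m∸n≤m k t) (n≤1+n k)))

    -- The comparison is with `h₁ L L E`, whose first half alone has main term `c * A`.
    many-covers₁ : c * c ≤ length 𝓢 * length 𝓣
    many-covers₁ =
      let E , E⊆1 , dE = of-dim {1ˢ} (≤n⇒≤1ˢ (≤-trans (<⇒≤ t<k) k≤n))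
          L , E⊆L , _ , dL = above {1ˢ} E ⊆1ˢ (≤-trans (≤-reflexive dE) (≤-trans (<⇒≤ t<k) (n≤1+n k))) (≤n⇒≤1ˢ k<n)
          fr = record { dL = dL ; dM = dL ; dE = dE ; E⊆L = E⊆L ; E⊆M = E⊆L }
      in many-covers a mx (h₁ L L E) (h₁-adm fr (≤-trans (s≤s t<k) (≤-trans (≤-reflexive (sym dL)) (dim-mono (∩-greatest ⊆-refl ⊆-refl))))) c≤q^ (begin
        c * scale * A  ≡⟨ lem₁ c scale A ⟩
        c * A * scale  ≤⟨ *-monoˡ-≤ scale (subst (λ m → m * A ≤ rich E L 1 + m * m * B)
                                                                        (trans (G-1 (dim L ∸ t)) (cong qn (trans (cong (_∸ t) dL) (+-∸-assoc 1 (<⇒≤ t<k))))) (rich-lower {i = 1} dE E⊆L)) ⟩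
        (rich E L 1 + c * c * B) * scale  ≡⟨ lem₂ (rich E L 1) c B scale ⟩
        rich E L 1 * scale + c * (c * scale) * B  ≤⟨ +-mono-≤ (*-monoˡ-≤ scale (≤-trans (∑-mono (subs k) (λ F →
                                                                        ι-mono (rich? E L F) (inH₁? L L E F) inj₁)) (≤-reflexive (sym (length-filter-ι (inH₁? L L E) (subs k))))))
                                                                        (absorb (pow-bound {i = suc (k ∸ t)} (qn≤q^ (suc (k ∸ t))) (pow-bound {i = suc (k ∸ t)} {j = k + t + 3} (qn≤q^ (suc (k ∸ t))) ≤-refl)) exponent (suc t)) ⟩
        length (h₁ L L E) * scale + A  ∎)
      where
      open ≤-Reasoning
      lem₁ : ∀ c s a → c * s * a ≡ c * a * s
      lem₁ = solve-∀
      lem₂ : ∀ r c b s → (r + c * c * b) * s ≡ r * s + c * (c * s) * b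
      lem₂ = solve-∀
      e₁ : ∀ t x → suc x + (suc x + (t + x + t + 3)) + suc t ≡ 3 * (t + x) + 6
      e₁ = solve-∀
      exponent : suc (k ∸ t) + (suc (k ∸ t) + (k + t + 3)) ≤ 3 * k + 6
      exponent = ≤-trans (m≤m+n _ (suc t)) (≤-reflexive (subst (λ z → suc (k ∸ t) + (suc (k ∸ t) + (z + t + 3)) + suc t ≡ 3 * z + 6) (m+[n∸m]≡n (<⇒≤ t<k)) (e₁ t (k ∸ t))))

    many-covers₂ : qn (2 + t) * qn (2 + t) ≤ length 𝓢 * length 𝓣
    many-covers₂ = many-covers a mx (h₂ Z) (h₂-adm dZ) (q^*-≤ (qn≤q^ (2 + t)) (s≤s (s≤s (<⇒≤ t<k)))) (begin
        qn (2 + t) * scale * A  ≡⟨ lem₁ (qn (2 + t)) scale A ⟩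
        qn (2 + t) * A * scale  ≤⟨ *-monoˡ-≤ scale (h₂-lower dZ) ⟩
        (length (h₂ Z) + qn (2 + t) * B) * scale  ≡⟨ lem₂ (length (h₂ Z)) (qn (2 + t)) B scale ⟩
        length (h₂ Z) * scale + qn (2 + t) * scale * B  ≤⟨ +-monoʳ-≤ (length (h₂ Z) * scale) (absorb (pow-bound {i = 2 + t} {j = k + t + 3} (qn≤q^ (2 + t)) ≤-refl) exponent (suc t)) ⟩
        length (h₂ Z) * scale + A  ∎)
      where
      open ≤-Reasoning
      Z = proj₁ Z₀
      dZ = proj₂ Z₀
      lem₁ : ∀ c s a → c * s * a ≡ c * a * s
      lem₁ = solve-∀
      lem₂ : ∀ h x b s → (h + x * b) * s ≡ h * s + x * s * b
      lem₂ = solve-∀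
      exponent : 2 + t + (k + t + 3) ≤ 3 * k + 6
      exponent = ≤-trans (≤-reflexive (e₁ t k)) (≤-trans (+-monoˡ-≤ (k + 3) (+-mono-≤ t<k t<k)) (≤-trans (m≤m+n _ 3) (≤-reflexive (e₂ k))))
        where e₁ : ∀ t k → 2 + t + (k + t + 3) ≡ suc t + suc t + (k + 3)
              e₁ = solve-∀
              e₂ : ∀ k → k + k + (k + 3) + 3 ≡ 3 * k + 6
              e₂ = solve-∀

    large-k : 2 * t + 1 < k → H₁Shape 𝓕 𝓖
    large-k lt with classify {c} {c} ≤-refl (qn-mono 2+t≤) 1≤t (cover-lists a mx)
      where 2+t≤ = s≤s (m+n≤o⇒m≤o∸n (suc t) (≤-trans (≤-reflexive (lem t)) (<⇒≤ lt)))
              where lem : ∀ t → suc t + t ≡ 2 * t + 1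
                    lem = solve-∀
    ... | inj₁ small        = contradiction many-covers₁ (<⇒≱ small)
    ... | inj₂ (inj₁ sun)   = sunflower-shape sun many-covers₁
    ... | inj₂ (inj₂ flat)  = contradiction many-covers₁ (<⇒≱ (≤-<-trans (*-mono-≤ (proj₁ (flat-≤ flat)) (proj₂ (flat-≤ flat))) (*-mono-< 2+t< 2+t<)))
      where 2+t< : qn (2 + t) < c
            2+t< = qn-mono-< (s≤s (m+n≤o⇒m≤o∸n (2 + t) (≤-trans (≤-reflexive (lem t)) lt)))
              where lem : ∀ t → 2 + t + t ≡ suc (2 * t + 1)
                    lem = solve-∀

    -- Here `c ≤ qn (2 + t)`, and covers with a common t-space number at most `c` on each side. They
    -- reach the required product only if `c = qn (2 + t)`, that is k = 2t + 1, and `h₁<h₂` then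
    -- leaves t = 1.
    small-k : k ≤ 2 * t + 1 → H₂Shape 𝓕 𝓖 ⊎ (k ≡ 3 × t ≡ 1 × H₁Shape 𝓕 𝓖)
    small-k le with classify {c} {qn (2 + t)} (qn-mono (s≤s (m≤n+o⇒m∸n≤o k t (≤-trans le (≤-reflexive (lem t)))))) ≤-refl 1≤t (cover-lists a mx)
      where lem : ∀ t → 2 * t + 1 ≡ t + suc t
            lem = solve-∀
    ... | inj₁ small = contradiction many-covers₂ (<⇒≱ small)
    ... | inj₂ (inj₂ flat@(Z , dZ , S⊆Z , T⊆Z)) =
      let full = both-full z<s (proj₁ (flat-≤ flat)) (proj₂ (flat-≤ flat)) many-covers₂ in
      inj₁ (Z , dZ , flat-half (swapAdm a) dZ T⊆Z (proj₂ full) , flat-half a dZ S⊆Z (proj₁ full))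
    ... | inj₂ (inj₁ sun) = inj₂ (by-t (sunflower-shape sun (≤-trans (*-mono-≤ c≤ c≤) many-covers₂)))
      where
      lem : ∀ t → 2 * t + 1 ≡ t + suc t
      lem = solve-∀
      c≤ : c ≤ qn (2 + t)
      c≤ = qn-mono (s≤s (m≤n+o⇒m∸n≤o k t (≤-trans le (≤-reflexive (lem t)))))
      k≡ : k ≡ 2 * t + 1
      k≡ = ≤-antisym le (≮⇒≥ λ lt → <⇒≱ (qn-mono-< {suc (k ∸ t)} {2 + t} (s≤s (s≤s (m≤n+o⇒m∸n≤o k t (s≤s⁻¹ (≤-trans lt (≤-reflexive (trans (lem t) (+-suc t t)))))))))
             (sq-≤ (≤-trans many-covers₂ (sunflower-≤ sun))))
      by-t : H₁Shape 𝓕 𝓖 → k ≡ 3 × t ≡ 1 × H₁Shape 𝓕 𝓖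
      by-t shape@(M , L , E , fr , wide , inF , inG) with t ≟ 1
      ... | yes t≡1 = trans k≡ (cong (λ z → 2 * z + 1) t≡1) , t≡1 , shape
      ... | no t≢1 = contradiction (mx (h₂ (proj₁ Z₀)) (h₂ (proj₁ Z₀)) (h₂-adm (proj₂ Z₀))) (<⇒≱ (*-mono-<
              (h₁<h₂ k≡ 2≤t (Adm.distF a) (Adm.dimF a) fr inF (proj₂ Z₀)) (h₁<h₂ k≡ 2≤t (Adm.distG a) (Adm.dimG a) (swapFrame fr) inG (proj₂ Z₀))))
        where 2≤t = ≤∧≢⇒< 1≤t (λ e → t≢1 (sym e))

-- Translation back to families

module Conclusion {q : ℕ} (𝔽 : FiniteField q) (n k t : ℕ) (1≤t : 1 ≤ t) (t<k : t < k) (n≥ : 4 * k + 6 ≤ n) where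
  open Structure 𝔽 n k t 1≤t t<k n≥
  open Geometry 𝔽 n using (_∈_)

  maximum⇒Max : ∀ {𝓕 𝓖 : Family k} → (∀ (𝓕′ 𝓖′ : Family k) → Admissible t 𝓕′ 𝓖′ → ∣ 𝓕′ ∣ * ∣ 𝓖′ ∣ ≤ ∣ 𝓕 ∣ * ∣ 𝓖 ∣) → Max (members 𝓕) (members 𝓖)
  maximum⇒Max best 𝓕′ 𝓖′ a = best (toFamily 𝓕′ distF dimF) (toFamily 𝓖′ distG dimG) (toAdmissible a)
    where open Adm a

  -- Inclusion of 𝓕 in `P` is enough when k-spaces satisfying `P` cover 𝓖: by maximality they
  -- already belong to 𝓕.
  ≈fam-intro : ∀ {𝓕 : Family k} {𝓖 P} → Adm (members 𝓕) 𝓖 → Max (members 𝓕) 𝓖 →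
               (∀ {A B} → A ≐ B → P A → P B) → (∀ {F} → F ∈ₗ members 𝓕 → P F) →
               (∀ {F} → dim F ≡ k → P F → Cover 𝓖 F) → 𝓕 ≈fam P
  ≈fam-intro a mx resp inP cov W hd =
      (λ W∈ → let F , F∈ , e = find∈ W∈ in resp {F} {W} (≐-sym {W} {F} e) (inP F∈))
    , (λ pW → saturated a mx W (HasDim⇒dim {W} hd) (cov (HasDim⇒dim {W} hd) pW))

  ≈fam-map : ∀ {𝓕 : Family k} {P Q : Subspace → Set} → (∀ W → P W → Q W) → (∀ W → Q W → P W) → 𝓕 ≈fam P → 𝓕 ≈fam Q
  ≈fam-map f g e W hd = (λ W∈ → f W (proj₁ (e W hd) W∈)) , (λ qW → proj₂ (e W hd) (g W qW))

  InH₁⇒H₁ : ∀ L M E F → InH₁ L M E F → H₁ t L M E F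
  InH₁⇒H₁ L M E F (inj₁ (f , le)) = inj₁ (f .on , ⇒DimGE-⊓ {F} {L} le)
  InH₁⇒H₁ L M E F (inj₂ (g , ¬f)) = inj₂ (g .on , λ f → ¬f (sub f))

  H₁⇒InH₁ : ∀ L M E F → H₁ t L M E F → InH₁ L M E F
  H₁⇒InH₁ L M E F (inj₁ (f , d)) = inj₁ (sub f , DimGE-⊓⇒ {F} {L} d)
  H₁⇒InH₁ L M E F (inj₂ (g , ¬f)) = inj₂ (sub g , λ f → ¬f (f .on))

  module _ {𝓕 𝓖 : Family k} (a : Adm (members 𝓕) (members 𝓖)) (mx : Max (members 𝓕) (members 𝓖)) where
    open Adm a

    private
      mx′ : Max (members 𝓖) (members 𝓕)
      mx′ = swapMax {members 𝓕} {members 𝓖} mx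

    H₁Shape⇒H₁Pair : H₁Shape (members 𝓕) (members 𝓖) → H₁Pair t (k + 1) 𝓕 𝓖
    H₁Shape⇒H₁Pair (M , L , E , fr , wide , inF , inG) =
      M , L , E , dim⇒HasDim {M} (trans dM (+-comm 1 k)) , dim⇒HasDim {L} (trans dL (+-comm 1 k)) ,
      ⇒DimGE-⊓ {M} {L} (≤-trans (≤-reflexive (+-comm t 2)) wide) ,
      (λ v v∈ → ∧-intro (E⊆M .on v v∈) (E⊆L .on v v∈)) , dim⇒HasDim {E} dE ,
      ≈fam-map {𝓕} (InH₁⇒H₁ L M E) (H₁⇒InH₁ L M E) (≈fam-intro {𝓕} {members 𝓖} a mx (λ {A} {B} → inH₁-resp L M E {A} {B}) inF
        (λ dF inH → All.tabulate λ G∈ → h₁-cross fr wide dF (All.lookup dimG G∈) inH (inG G∈))) ,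
      ≈fam-map {𝓖} (InH₁⇒H₁ M L E) (H₁⇒InH₁ M L E) (≈fam-intro {𝓖} {members 𝓕} (swapAdm a) mx′ (λ {A} {B} → inH₁-resp M L E {A} {B}) inG
        (λ dG inH → All.tabulate λ F∈ → h₁-cross (swapFrame fr) (≤-trans wide (dim-mono (∩-comm M L))) dG (All.lookup dimF F∈) inH (inF F∈)))
      where open Frame fr

    H₂Shape⇒H₂ : H₂Shape (members 𝓕) (members 𝓖) → Σ Subspace λ Z → HasDim (mem Z) (t + 2) × (𝓕 ≈fam H₂ t Z) × (𝓖 ≈fam H₂ t Z)
    H₂Shape⇒H₂ (Z , dZ , inF , inG) = Z , dim⇒HasDim {Z} (trans dZ (+-comm 2 t)) ,
        ≈fam-map {𝓕} (λ F → ⇒DimGE-⊓ {F} {Z}) (λ F → DimGE-⊓⇒ {F} {Z}) (≈fam-intro {𝓕} {members 𝓖} a mx resp inF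
          (λ {F} _ inH → All.tabulate λ {G} G∈ → h₂-cross dZ {F} {G} inH (inG G∈))) ,
        ≈fam-map {𝓖} (λ F → ⇒DimGE-⊓ {F} {Z}) (λ F → DimGE-⊓⇒ {F} {Z}) (≈fam-intro {𝓖} {members 𝓕} (swapAdm a) mx′ resp inG
          (λ {G} _ inH → All.tabulate λ {F} F∈ → h₂-cross dZ {G} {F} inH (inF F∈)))
      where
      resp : ∀ {A B} → A ≐ B → InH₂ Z A → InH₂ Z B
      resp {A} {B} e le = ≤-trans le (dim-mono (∩-mono (≐⇒⊆ A B e) ⊆-refl))

theorem1p3 : (q : ℕ) (𝔽 : FiniteField q) (n k t : ℕ) →
    1 ≤ n → 1 ≤ k → 1 ≤ t → t + 1 ≤ k → 4 * k + 6 ≤ n →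
    let open Geometry 𝔽 n in
    (𝓕 𝓖 : Family k) →
    Admissible t 𝓕 𝓖 →
    (∀ (𝓕′ 𝓖′ : Family k) → Admissible t 𝓕′ 𝓖′ → ∣ 𝓕′ ∣ * ∣ 𝓖′ ∣ ≤ ∣ 𝓕 ∣ * ∣ 𝓖 ∣) →
    (2 * t + 1 < k → H₁Pair t (k + 1) 𝓕 𝓖)
    × (k ≤ 2 * t + 1 →
    (Σ Subspace λ Z → HasDim (mem Z) (t + 2) × (𝓕 ≈fam H₂ t Z) × (𝓖 ≈fam H₂ t Z))
    ⊎ (k ≡ 3 × t ≡ 1 × H₁Pair t 4 𝓕 𝓖))
theorem1p3 q 𝔽 n k t _ _ 1≤t t+1≤k n≥ 𝓕 𝓖 adm best =
  (λ lt → H₁Shape⇒H₁Pair {𝓕} {𝓖} a mx (large-k a mx lt)) , small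
  where
  open Geometry 𝔽 n using (Subspace; HasDim; mem; _≈fam_; H₂; H₁Pair)
  t<k : t < k
  t<k = ≤-trans (≤-reflexive (+-comm 1 t)) t+1≤k
  open Conclusion 𝔽 n k t 1≤t t<k n≥
  open Structure 𝔽 n k t 1≤t t<k n≥ using (fromAdmissible; Adm; Max; large-k; small-k)
  a = fromAdmissible {𝓕} {𝓖} adm
  mx = maximum⇒Max {𝓕} {𝓖} best
  small : k ≤ 2 * t + 1 →
    (Σ Subspace λ Z → HasDim (mem Z) (t + 2) × (𝓕 ≈fam H₂ t Z) × (𝓖 ≈fam H₂ t Z))
    ⊎ (k ≡ 3 × t ≡ 1 × H₁Pair t 4 𝓕 𝓖)
  small le with small-k a mx le
  ... | inj₁ shape = inj₁ (H₂Shape⇒H₂ {𝓕} {𝓖} a mx shape)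
  ... | inj₂ (refl , t≡1 , shape) = inj₂ (refl , t≡1 , H₁Shape⇒H₁Pair {𝓕} {𝓖} a mx shape)
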